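{- Let $\mathcal{A}$ be a central and essential arrangement in $\mathbb{Q}^l$ as in the context, $\sigma$ a term ordering, and $p$ a prime that is good and $(\sigma,l)$-lucky for $\mathcal{A}$. Let $q$ be a power of $p$. Then $$\overline{\chi}_{\mathcal{A}}(q,t)=\sum_{P\in\mathbb{F}_q^l}t^{h(P)},$$ where $h(P)$ is the number of hyperplanes of $\mathcal{A}_{\mathbb{F}_q}$ containing $P$.
   Context: $\mathcal{A}=\{H_1,\dots,H_n\}$: $n$ distinct linear hyperplanes in $\mathbb{Q}^l$ with $\bigcap H_i=\{0\}$, $H_i=\{\alpha_i=0\}$, $\alpha_i\in\mathbb{Z}[x_1,\dots,x_l]$ a nonzero linear form whose coefficients are not all divisible by any prime, $Q(\mathcal{A})=\prod\alpha_i$. $p$ is good if the reduction of $Q(\mathcal{A})$ mod $p$ is reduced (no reduction $(\alpha_i)_p$ is a scalar multiple of $(\alpha_j)_p$, $i<j$). $\mathcal{A}_{\mathbb{F}_q}$ is the arrangement in $\mathbb{F}_q^l$ defined by the image of $Q(\mathcal{A})$ in $\mathbb{F}_q[x_1,\dots,x_l]$, i.e. the hyperplanes $\{\bar\alpha_i=0\}$. For a term ordering $\sigma$ and nonzero $f\in\mathbb{Z}[x_1,\dots,x_l]$, $\mathrm{LM}_\sigma(f)$ is the $\sigma$-leading term times its coefficient $\mathrm{LC}_\sigma(f)$. A minimal strong $\sigma$-Gröbner basis of an ideal $I\subseteq\mathbb{Z}[x_1,\dots,x_l]$ is a finite generating set $G$ of nonzero elements of $I$ such that every nonzero $f\in I$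 has $\mathrm{LM}_\sigma(f)$ divisible by some $\mathrm{LM}_\sigma(g)$, $g\in G$, and no $\mathrm{LM}_\sigma(g)$ divides $\mathrm{LM}_\sigma(g')$ for distinct $g,g'$; its set of leading coefficients is independent of the choice. $p$ is $\sigma$-lucky for $I$ if it divides none of these leading coefficients; $p$ is $(\sigma,l)$-lucky for $\mathcal{A}$ if it is $\sigma$-lucky for every ideal $\langle\alpha_{i_1},\dots,\alpha_{i_l}\rangle$ with $i_1<\dots<i_l$ and $\operatorname{codim}(H_{i_1}\cap\dots\cap H_{i_l})=l$. The coboundary polynomial is $\overline{\chi}_{\mathcal{A}}(x,y)=\sum_{\mathcal{B}\subseteq\mathcal{A}}x^{\mathrm{rk}(\mathcal{A})-\mathrm{rk}(\mathcal{B})}(y-1)^{|\mathcal{B}|}$, where $\mathrm{rk}(\mathcal{B})=\operatorname{codim}\bigcap_{H\in\mathcal{B}}H$ (the sum is over all subsets since $\mathcal{A}$ is central). -}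

module Defs where

open import Algebra.Bundles using (CommutativeRing)
open import Algebra.Bundles.Raw using (RawRing)
import Algebra.Definitions.RawSemiring as SemiringDefs
open import Data.Bool.Base using (if_then_else_)
open import Data.Empty using (⊥-elim)
open import Data.Fin.Base as Fin using (Fin)
import Data.Fin.Properties as Fin
open import Data.Fin.Subset using (Subset; inside; outside; ⊤; ∣_∣) renaming (_∈_ to _∈ₛ_)
open import Data.Fin.Subset.Properties using (_∈?_)
open import Data.Integer.Base as ℤ using (ℤ; +_; -[1+_]; 0ℤ; 1ℤ)
open import Data.Integer.Divisibility using () renaming (_∣_ to _∣ℤ_)
import Data.Integer.Properties as ℤ
open import Data.List.Base as List
  using (List; []; _∷_; _++_; allFin; cartesianProductWith; deduplicate; filter; foldr; length)
import Data.List.Extrema as Extrema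
open import Data.List.Membership.Propositional using () renaming (_∈_ to _∈ₗ_)
open import Data.List.Membership.Propositional.Properties using (∈-allFin; ∈-filter⁺; ∈-filter⁻; ∈-map⁺)
open import Data.List.Relation.Unary.All as All using (All; []; _∷_)
import Data.List.Relation.Unary.All.Properties as All
open import Data.List.Relation.Unary.AllPairs using (AllPairs)
open import Data.Nat.Base as ℕ using (ℕ; zero; suc; _∸_)
open import Data.Nat.Primality using (Prime)
import Data.Nat.Properties as ℕ
open import Data.Product using (Σ; ∃; ∃-syntax; _×_; _,_; proj₁; proj₂)
open import Data.Rational.Base as ℚ using (ℚ; 0ℚ; 1ℚ)
import Data.Rational.Properties as ℚ
open import Algebra.Properties.Group ℚ.+-0-group using (⁻¹-involutive)
open import Data.Vec.Base as Vec using (Vec; []; _∷_; lookup; map; replicate; tabulate; zipWith)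
import Data.Vec.Properties as Vec
open import Function.Base using (_∘_; _on_)
open import Function.Bundles using (Inverse)
import Function.Properties.Inverse as Inverse
open import Level using (Level; 0ℓ; _⊔_) renaming (suc to lsuc)
open import Relation.Binary.Bundles using (TotalOrder)
open import Relation.Binary.Core using (Rel)
import Relation.Binary.Definitions as Rel
open import Relation.Binary.PropositionalEquality as ≡
  using (_≡_; _≢_; refl; cong; cong₂; trans; subst; module ≡-Reasoning)
open import Relation.Binary.Structures using (IsTotalOrder)
open import Relation.Nullary using (¬_; Dec; yes; no; does)
open import Relation.Nullary.Decidable using (¬?; _×-dec_; _→-dec_; via-injection)
open import Relation.Unary using (Pred; _≐_)

private variable
  c ℓ : Level
  A : Set c
  d l m n : ℕ

------------------------------------------------------------------------
-- Evaluation of integral expressions in an arbitrary ring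

module Over (R : RawRing c ℓ) where
  open RawRing R
  open SemiringDefs rawSemiring using (_^_) renaming (_×_ to _·_)

  sumOver : List A → (A → Carrier) → Carrier
  sumOver xs f = foldr (λ x s → f x + s) 0# xs

  fromℤ : ℤ → Carrier
  fromℤ (+ k)      = k · 1#
  fromℤ (-[1+ k ]) = - (suc k · 1#)

  dot : Vec Carrier n → Vec Carrier n → Carrier
  dot []       []       = 0#
  dot (a ∷ as) (v ∷ vs) = a * v + dot as vs

  power : Vec Carrier n → Vec ℕ n → Carrier
  power []       []       = 1#
  power (v ∷ vs) (e ∷ es) = v ^ e * power vs es

  ⟪_,_⟫ : Vec ℤ n → Vec Carrier n → Carrier
  ⟪ a , v ⟫ = dot (map fromℤ a) v

  eval : List (ℤ × Vec ℕ n) → Vec Carrier n → Carrier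
  eval f v = sumOver f λ (a , e) → fromℤ a * power v e

allVecs : List A → ∀ n → List (Vec A n)
allVecs xs zero    = [] ∷ []
allVecs xs (suc n) = cartesianProductWith _∷_ xs (allVecs xs n)

subsets : ∀ n → List (Subset n)
subsets = allVecs (inside ∷ outside ∷ [])

------------------------------------------------------------------------
-- Integer polynomials

Monomial : ℕ → Set
Monomial = Vec ℕ

_≟ₘ_ : Rel.DecidableEquality (Monomial n)
_≟ₘ_ = Vec.≡-dec ℕ._≟_

-- A polynomial is an unnormalised list of terms: monomials may be repeated and
-- coefficients may be zero, so polynomials are compared by _≈ₚ_, never by _≡_.
Poly : ℕ → Set
Poly n = List (ℤ × Monomial n)

coeff : Poly n → Monomial n → ℤ
coeff []            e = 0ℤ
coeff ((a , e′) ∷ f) e = (if does (e′ ≟ₘ e) then a else 0ℤ) ℤ.+ coeff f e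

infix 4 _≈ₚ_
_≈ₚ_ : Rel (Poly n) 0ℓ
f ≈ₚ g = ∀ e → coeff f e ≡ coeff g e

term : ℤ → Monomial n → Poly n
term a e = (a , e) ∷ []

const : ℤ → Poly n
const a = term a (replicate _ 0)

unit : Fin n → Monomial n
unit i = replicate _ 0 Vec.[ i ]≔ 1

var : Fin n → Poly n
var i = term 1ℤ (unit i)

polyRing : ℕ → RawRing 0ℓ 0ℓ
polyRing n = record
  { Carrier = Poly n
  ; _≈_     = _≈ₚ_
  ; _+_     = _++_
  ; _*_     = cartesianProductWith λ (a , e) (b , e′) → a ℤ.* b , zipWith ℕ._+_ e e′
  ; -_      = List.map λ (a , e) → ℤ.- a , e
  ; 0#      = []
  ; 1#      = const 1ℤ
  }

linearForm : Vec ℤ n → Poly n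
linearForm a = Vec.toList (tabulate λ i → lookup a i , unit i)

⟨_⟩ : List (Poly n) → Pred (Poly n) 0ℓ
⟨_⟩ {n} gs f = Σ (Fin (length gs) → Carrier) λ h → f ≈ sum (λ i → h i * List.lookup gs i)
  where
  open RawRing (polyRing n)
  open SemiringDefs rawSemiring using (sum)

------------------------------------------------------------------------
-- Term orderings and strong Gröbner bases over ℤ

-- Well-foundedness is not listed: it follows from 1≤ (Dickson's lemma).
record TermOrdering (n : ℕ) : Set₁ where
  field
    _≤_          : Rel (Monomial n) 0ℓ
    isTotalOrder : IsTotalOrder _≡_ _≤_
    1≤           : ∀ e → replicate n 0 ≤ e
    *-mono       : ∀ {e e′} u → e ≤ e′ → zipWith ℕ._+_ u e ≤ zipWith ℕ._+_ u e′

  totalOrder : TotalOrder 0ℓ 0ℓ 0ℓ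
  totalOrder = record { isTotalOrder = isTotalOrder }

module _ (σ : TermOrdering n) where
  open RawRing (polyRing n)
  open SemiringDefs rawSemiring using (_∣_; _∤_)

  support : Poly n → List (Monomial n)
  support f = filter (λ e → ¬? (coeff f e ℤ.≟ 0ℤ)) (List.map proj₂ f)

  -- The default value 1 of the maximum is the σ-least monomial, so it is only
  -- attained spuriously by f = 0, in which case LC f = 0.
  LT : Poly n → Monomial n
  LT f = Extrema.max (TermOrdering.totalOrder σ) (replicate n 0) (support f)

  LC : Poly n → ℤ
  LC f = coeff f (LT f)

  LM : Poly n → Poly n
  LM f = term (LC f) (LT f)

  record IsMinimalStrongGröbner (G : List (Poly n)) (I : Pred (Poly n) 0ℓ) : Set where
    field
      nonzero   : ∀ {g} → g ∈ₗ G → ¬ g ≈ 0#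
      generates : ⟨ G ⟩ ≐ I
      strong    : ∀ f → I f → ¬ f ≈ 0# → ∃[ g ] g ∈ₗ G × LM g ∣ LM f
      minimal   : AllPairs (λ g g′ → LM g ∤ LM g′ × LM g′ ∤ LM g) G

  -- Every ideal has a minimal strong Gröbner basis and the leading coefficients
  -- agree, up to sign, for all of them, so one basis witnesses luckiness.
  Lucky : ℕ → Pred (Poly n) 0ℓ → Set
  Lucky p I = ∃[ G ] IsMinimalStrongGröbner G I × (∀ {g} → g ∈ₗ G → ¬ (+ p) ∣ℤ LC g)

------------------------------------------------------------------------
-- Dimension of subspaces of ℚˡ

module ℚᵒ = Over ℚ.+-*-rawRing

infixl 6 _⊕_
infixr 7 _⊙_

𝟘 : Vec ℚ l
𝟘 = replicate _ 0ℚ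

_⊕_ : Vec ℚ l → Vec ℚ l → Vec ℚ l
_⊕_ = zipWith ℚ._+_

_⊙_ : ℚ → Vec ℚ l → Vec ℚ l
a ⊙ v = map (a ℚ.*_) v

lincomb : Vec ℚ d → Vec (Vec ℚ l) d → Vec ℚ l
lincomb []       []       = 𝟘
lincomb (a ∷ as) (b ∷ bs) = a ⊙ b ⊕ lincomb as bs

record IsBasis (bs : Vec (Vec ℚ l) d) (V : Pred (Vec ℚ l) 0ℓ) : Set where
  field
    contained   : ∀ as → V (lincomb as bs)
    spanning    : ∀ v → V v → ∃[ as ] lincomb as bs ≡ v
    independent : ∀ as → lincomb as bs ≡ 𝟘 → as ≡ 𝟘

HasDim : Pred (Vec ℚ l) 0ℓ → ℕ → Set
HasDim {l} V d = ∃[ bs ] IsBasis {l} {d} bs V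

module Kernel where
  dot : Vec ℚ l → Vec ℚ l → ℚ
  dot = ℚᵒ.dot

  interchange : ∀ a b x y → (a ℚ.+ b) ℚ.+ (x ℚ.+ y) ≡ (a ℚ.+ x) ℚ.+ (b ℚ.+ y)
  interchange a b x y = begin
    (a ℚ.+ b) ℚ.+ (x ℚ.+ y)  ≡⟨ ℚ.+-assoc a b _ ⟩
    a ℚ.+ (b ℚ.+ (x ℚ.+ y))  ≡⟨ cong (a ℚ.+_) (≡.sym (ℚ.+-assoc b x y)) ⟩
    a ℚ.+ ((b ℚ.+ x) ℚ.+ y)  ≡⟨ cong (λ z → a ℚ.+ (z ℚ.+ y)) (ℚ.+-comm b x) ⟩
    a ℚ.+ ((x ℚ.+ b) ℚ.+ y)  ≡⟨ cong (a ℚ.+_) (ℚ.+-assoc x b y) ⟩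
    a ℚ.+ (x ℚ.+ (b ℚ.+ y))  ≡⟨ ≡.sym (ℚ.+-assoc a x _) ⟩
    (a ℚ.+ x) ℚ.+ (b ℚ.+ y)  ∎
    where open ≡-Reasoning

  ⊕-identityˡ : (v : Vec ℚ l) → 𝟘 ⊕ v ≡ v
  ⊕-identityˡ = Vec.zipWith-identityˡ ℚ.+-identityˡ

  ⊕-identityʳ : (v : Vec ℚ l) → v ⊕ 𝟘 ≡ v
  ⊕-identityʳ = Vec.zipWith-identityʳ ℚ.+-identityʳ

  ⊕-interchange : (u v w x : Vec ℚ l) → (u ⊕ v) ⊕ (w ⊕ x) ≡ (u ⊕ w) ⊕ (v ⊕ x)
  ⊕-interchange [] [] [] [] = refl
  ⊕-interchange (a ∷ u) (b ∷ v) (x ∷ w) (y ∷ z) =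
    cong₂ _∷_ (interchange a b x y) (⊕-interchange u v w z)

  ⊙-zeroʳ : ∀ l a → a ⊙ 𝟘 {l} ≡ 𝟘
  ⊙-zeroʳ zero    a = refl
  ⊙-zeroʳ (suc l) a = cong₂ _∷_ (ℚ.*-zeroʳ a) (⊙-zeroʳ l a)

  ⊙-zeroˡ : (v : Vec ℚ l) → 0ℚ ⊙ v ≡ 𝟘
  ⊙-zeroˡ []      = refl
  ⊙-zeroˡ (x ∷ v) = cong₂ _∷_ (ℚ.*-zeroˡ x) (⊙-zeroˡ v)

  ⊙-distribˡ : ∀ a (u v : Vec ℚ l) → a ⊙ (u ⊕ v) ≡ a ⊙ u ⊕ a ⊙ v
  ⊙-distribˡ a []      []      = refl
  ⊙-distribˡ a (x ∷ u) (y ∷ v) = cong₂ _∷_ (ℚ.*-distribˡ-+ a x y) (⊙-distribˡ a u v)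

  ⊙-distribʳ : ∀ a b (v : Vec ℚ l) → (a ℚ.+ b) ⊙ v ≡ a ⊙ v ⊕ b ⊙ v
  ⊙-distribʳ a b []      = refl
  ⊙-distribʳ a b (x ∷ v) = cong₂ _∷_ (ℚ.*-distribʳ-+ x a b) (⊙-distribʳ a b v)

  ⊙-assoc : ∀ a b (v : Vec ℚ l) → (a ℚ.* b) ⊙ v ≡ a ⊙ b ⊙ v
  ⊙-assoc a b []      = refl
  ⊙-assoc a b (x ∷ v) = cong₂ _∷_ (ℚ.*-assoc a b x) (⊙-assoc a b v)

  dot-comm : (u v : Vec ℚ l) → dot u v ≡ dot v u
  dot-comm []      []      = refl
  dot-comm (x ∷ u) (y ∷ v) = cong₂ ℚ._+_ (ℚ.*-comm x y) (dot-comm u v)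

  dot-⊕ : (φ u v : Vec ℚ l) → dot φ (u ⊕ v) ≡ dot φ u ℚ.+ dot φ v
  dot-⊕ []      []      []      = refl
  dot-⊕ (a ∷ φ) (x ∷ u) (y ∷ v) =
    trans (cong₂ ℚ._+_ (ℚ.*-distribˡ-+ a x y) (dot-⊕ φ u v)) (interchange (a ℚ.* x) (a ℚ.* y) (dot φ u) (dot φ v))

  dot-⊙ : ∀ (φ : Vec ℚ l) a u → dot φ (a ⊙ u) ≡ a ℚ.* dot φ u
  dot-⊙ []      a []      = ≡.sym (ℚ.*-zeroʳ a)
  dot-⊙ (b ∷ φ) a (x ∷ u) = begin
    b ℚ.* (a ℚ.* x) ℚ.+ dot φ (a ⊙ u)    ≡⟨ cong₂ ℚ._+_ lem (dot-⊙ φ a u) ⟩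
    a ℚ.* (b ℚ.* x) ℚ.+ a ℚ.* dot φ u    ≡⟨ ≡.sym (ℚ.*-distribˡ-+ a _ _) ⟩
    a ℚ.* (b ℚ.* x ℚ.+ dot φ u)          ∎
    where
    open ≡-Reasoning
    lem : b ℚ.* (a ℚ.* x) ≡ a ℚ.* (b ℚ.* x)
    lem = trans (≡.sym (ℚ.*-assoc b a x)) (trans (cong (ℚ._* x) (ℚ.*-comm b a)) (ℚ.*-assoc a b x))

  dot-𝟘 : (φ : Vec ℚ l) → dot φ 𝟘 ≡ 0ℚ
  dot-𝟘 []      = refl
  dot-𝟘 (a ∷ φ) = cong₂ ℚ._+_ (ℚ.*-zeroʳ a) (dot-𝟘 φ)

  dot-lincomb : ∀ (φ : Vec ℚ l) as (bs : Vec _ d) → dot φ (lincomb as bs) ≡ dot (map (dot φ) bs) as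
  dot-lincomb φ []       []       = dot-𝟘 φ
  dot-lincomb φ (a ∷ as) (b ∷ bs) = trans (dot-⊕ φ (a ⊙ b) _)
    (cong₂ ℚ._+_ (trans (dot-⊙ φ a b) (ℚ.*-comm a _)) (dot-lincomb φ as bs))

  record Linear (f : Vec ℚ m → Vec ℚ l) : Set where
    field
      pres-⊕ : ∀ u v → f (u ⊕ v) ≡ f u ⊕ f v
      pres-⊙ : ∀ a u → f (a ⊙ u) ≡ a ⊙ f u
      pres-𝟘 : f 𝟘 ≡ 𝟘

  lincomb-map : {f : Vec ℚ m → Vec ℚ l} → Linear f →
                ∀ as (bs : Vec _ d) → lincomb as (map f bs) ≡ f (lincomb as bs)
  lincomb-map lin []       []       = ≡.sym (Linear.pres-𝟘 lin)
  lincomb-map lin (a ∷ as) (b ∷ bs) = ≡.sym (trans (pres-⊕ (a ⊙ b) _)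
    (cong₂ _⊕_ (pres-⊙ a b) (≡.sym (lincomb-map lin as bs))))
    where open Linear lin

  lincomb-linear : (bs : Vec (Vec ℚ l) d) → Linear (λ as → lincomb as bs)
  lincomb-linear bs = record { pres-⊕ = add bs ; pres-⊙ = mul bs ; pres-𝟘 = nul bs }
    where
    add : ∀ (bs : Vec (Vec ℚ l) d) u v → lincomb (u ⊕ v) bs ≡ lincomb u bs ⊕ lincomb v bs
    add []       []      []      = ≡.sym (⊕-identityˡ 𝟘)
    add (b ∷ bs) (x ∷ u) (y ∷ v) =
      trans (cong₂ _⊕_ (⊙-distribʳ x y b) (add bs u v)) (⊕-interchange (x ⊙ b) (y ⊙ b) _ _)
    mul : ∀ (bs : Vec (Vec ℚ l) d) a u → lincomb (a ⊙ u) bs ≡ a ⊙ lincomb u bs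
    mul []       a []      = ≡.sym (⊙-zeroʳ _ a)
    mul (b ∷ bs) a (x ∷ u) =
      trans (cong₂ _⊕_ (⊙-assoc a x b) (mul bs a u)) (≡.sym (⊙-distribˡ a (x ⊙ b) _))
    nul : (bs : Vec (Vec ℚ l) d) → lincomb 𝟘 bs ≡ 𝟘
    nul []       = refl
    nul (b ∷ bs) = trans (cong₂ _⊕_ (⊙-zeroˡ b) (nul bs)) (⊕-identityˡ 𝟘)

  cons0-linear : Linear {l} (0ℚ ∷_)
  cons0-linear = record
    { pres-⊕ = λ u v → refl
    ; pres-⊙ = λ a u → cong (_∷ a ⊙ u) (≡.sym (ℚ.*-zeroʳ a))
    ; pres-𝟘 = refl
    }

  extend : Vec (Vec ℚ l) d → Vec (Vec ℚ (suc l)) (suc d)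
  extend bs = (1ℚ ∷ 𝟘) ∷ map (0ℚ ∷_) bs

  lincomb-extend : ∀ x as (bs : Vec (Vec ℚ l) d) →
                   lincomb (x ∷ as) (extend bs) ≡ x ∷ lincomb as bs
  lincomb-extend x as bs = trans
    (cong (x ⊙ (1ℚ ∷ 𝟘) ⊕_) (lincomb-map cons0-linear as bs))
    (cong₂ _∷_ (trans (ℚ.+-identityʳ _) (ℚ.*-identityʳ x))
               (trans (cong (_⊕ _) (⊙-zeroʳ _ x)) (⊕-identityˡ _)))

  standard : ∀ l → Vec (Vec ℚ l) l
  standard zero    = []
  standard (suc l) = extend (standard l)

  lincomb-standard : (v : Vec ℚ l) → lincomb v (standard l) ≡ v
  lincomb-standard []      = refl
  lincomb-standard (x ∷ v) =
    trans (lincomb-extend x v (standard _)) (cong (x ∷_) (lincomb-standard v))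

  kernel₁ : (φ : Vec ℚ l) → ∃ (HasDim λ v → dot φ v ≡ 0ℚ)
  kernel₁ [] = 0 , [] , record
    { contained   = λ where [] → refl
    ; spanning    = λ where [] _ → [] , refl
    ; independent = λ where [] _ → refl
    }
  kernel₁ (a ∷ φ) with a ℚ.≟ 0ℚ
  kernel₁ (a ∷ φ) | yes refl with kernel₁ φ
  ... | d , bs , basis = suc d , extend bs , record
    { contained   = λ where
        (x ∷ as) → subst (λ v → dot (0ℚ ∷ φ) v ≡ 0ℚ) (≡.sym (lincomb-extend x as bs))
                     (trans (drop0 x _) (B.contained as))
    ; spanning    = λ where
        (x ∷ v) eq → let as , p = B.spanning v (trans (≡.sym (drop0 x v)) eq) in
                     x ∷ as , trans (lincomb-extend x as bs) (cong (x ∷_) p)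
    ; independent = λ where
        (x ∷ as) eq → let p = trans (≡.sym (lincomb-extend x as bs)) eq in
                      cong₂ _∷_ (Vec.∷-injectiveˡ p) (B.independent as (Vec.∷-injectiveʳ p))
    }
    where
    module B = IsBasis basis
    drop0 : ∀ x v → 0ℚ ℚ.* x ℚ.+ dot φ v ≡ dot φ v
    drop0 x v = trans (cong (ℚ._+ dot φ v) (ℚ.*-zeroˡ x)) (ℚ.+-identityˡ _)
  kernel₁ {suc l} (a ∷ φ) | no a≢0 = l , map lift (standard l) , record
    { contained   = λ as → subst (λ v → dot (a ∷ φ) v ≡ 0ℚ) (≡.sym (span as)) (kills as)
    ; spanning    = λ where (x ∷ v) eq → v , trans (span v) (cong (_∷ v) (solve x v eq))
    ; independent = λ as eq → Vec.∷-injectiveʳ (trans (≡.sym (span as)) eq)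
    }
    where
    open ≡-Reasoning
    instance a-nz = ℚ.≢-nonZero a≢0
    s : ℚ
    s = ℚ.- (ℚ.1/ a)
    a*s* : ∀ x → a ℚ.* (s ℚ.* x) ≡ ℚ.- x
    a*s* x = begin
      a ℚ.* (s ℚ.* x)              ≡⟨ ≡.sym (ℚ.*-assoc a s x) ⟩
      (a ℚ.* s) ℚ.* x              ≡⟨ cong (ℚ._* x) (≡.sym (ℚ.neg-distribʳ-* a _)) ⟩
      (ℚ.- (a ℚ.* ℚ.1/ a)) ℚ.* x   ≡⟨ cong (λ z → (ℚ.- z) ℚ.* x) (ℚ.*-inverseʳ a) ⟩
      (ℚ.- 1ℚ) ℚ.* x               ≡⟨ ≡.sym (ℚ.neg-distribˡ-* 1ℚ x) ⟩
      ℚ.- (1ℚ ℚ.* x)               ≡⟨ cong (λ z → ℚ.- z) (ℚ.*-identityˡ x) ⟩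
      ℚ.- x                        ∎
    lift : Vec ℚ l → Vec ℚ (suc l)
    lift v = s ℚ.* dot φ v ∷ v
    lift-linear : Linear lift
    lift-linear = record
      { pres-⊕ = λ u v → cong (_∷ u ⊕ v)
          (trans (cong (s ℚ.*_) (dot-⊕ φ u v)) (ℚ.*-distribˡ-+ s _ _))
      ; pres-⊙ = λ b u → cong (_∷ b ⊙ u) (trans (cong (s ℚ.*_) (dot-⊙ φ b u))
          (trans (≡.sym (ℚ.*-assoc s b _)) (trans (cong (ℚ._* _) (ℚ.*-comm s b)) (ℚ.*-assoc b s _))))
      ; pres-𝟘 = cong (_∷ 𝟘) (trans (cong (s ℚ.*_) (dot-𝟘 φ)) (ℚ.*-zeroʳ s))
      }
    span : ∀ as → lincomb as (map lift (standard l)) ≡ lift as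
    span as = trans (lincomb-map lift-linear as (standard l)) (cong lift (lincomb-standard as))
    kills : ∀ v → dot (a ∷ φ) (lift v) ≡ 0ℚ
    kills v = trans (cong (ℚ._+ dot φ v) (a*s* (dot φ v))) (ℚ.+-inverseˡ (dot φ v))
    solve : ∀ x v → a ℚ.* x ℚ.+ dot φ v ≡ 0ℚ → s ℚ.* dot φ v ≡ x
    solve x v eq = begin
      s ℚ.* y                       ≡⟨ cong (s ℚ.*_) y≡ ⟩
      s ℚ.* (ℚ.- (a ℚ.* x))         ≡⟨ cong (s ℚ.*_) (ℚ.neg-distribʳ-* a x) ⟩
      s ℚ.* (a ℚ.* (ℚ.- x))         ≡⟨ ≡.sym (ℚ.*-assoc s a _) ⟩
      (s ℚ.* a) ℚ.* (ℚ.- x)         ≡⟨ cong (ℚ._* (ℚ.- x)) (ℚ.*-comm s a) ⟩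
      (a ℚ.* s) ℚ.* (ℚ.- x)         ≡⟨ ℚ.*-assoc a s _ ⟩
      a ℚ.* (s ℚ.* (ℚ.- x))         ≡⟨ a*s* (ℚ.- x) ⟩
      ℚ.- (ℚ.- x)                   ≡⟨ ⁻¹-involutive x ⟩
      x                             ∎
      where
      y = dot φ v
      y≡ : y ≡ ℚ.- (a ℚ.* x)
      y≡ = begin
        y                                     ≡⟨ ≡.sym (ℚ.+-identityˡ y) ⟩
        0ℚ ℚ.+ y                              ≡⟨ cong (ℚ._+ y) (≡.sym (ℚ.+-inverseˡ (a ℚ.* x))) ⟩
        (ℚ.- (a ℚ.* x) ℚ.+ a ℚ.* x) ℚ.+ y     ≡⟨ ℚ.+-assoc (ℚ.- (a ℚ.* x)) (a ℚ.* x) y ⟩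
        ℚ.- (a ℚ.* x) ℚ.+ (a ℚ.* x ℚ.+ y)     ≡⟨ cong (ℚ.- (a ℚ.* x) ℚ.+_) eq ⟩
        ℚ.- (a ℚ.* x) ℚ.+ 0ℚ                  ≡⟨ ℚ.+-identityʳ _ ⟩
        ℚ.- (a ℚ.* x)                         ∎

  kernel : (φs : List (Vec ℚ l)) → ∃ (HasDim λ v → All (λ φ → dot φ v ≡ 0ℚ) φs)
  kernel {l} [] = l , standard l , record
    { contained   = λ _ → []
    ; spanning    = λ v _ → v , lincomb-standard v
    ; independent = λ as eq → trans (≡.sym (lincomb-standard as)) eq
    }
  kernel (φ ∷ φs) with kernel φs
  ... | d , bs , basis with kernel₁ (map (dot φ) bs)
  ... | d′ , cs , basis′ = d′ , map (λ r → lincomb r bs) cs , record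
    { contained   = λ as → subst (λ v → All (λ φ → dot φ v ≡ 0ℚ) (φ ∷ φs)) (≡.sym (comp as))
        (trans (dot-lincomb φ (lincomb as cs) bs) (C.contained as) ∷ B.contained (lincomb as cs))
    ; spanning    = λ where
        v (p ∷ ps) → let as , q = B.spanning v ps
                         r      = trans (≡.sym (dot-lincomb φ as bs)) (trans (cong (dot φ) q) p)
                         es , t = C.spanning as r
                     in es , trans (comp es) (trans (cong (λ w → lincomb w bs) t) q)
    ; independent = λ as eq →
        C.independent as (B.independent (lincomb as cs) (trans (≡.sym (comp as)) eq))
    }
    where
    module B = IsBasis basis
    module C = IsBasis basis′
    comp : ∀ as → lincomb as (map (λ r → lincomb r bs) cs) ≡ lincomb (lincomb as cs) bs
    comp as = lincomb-map (lincomb-linear bs) as cs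

------------------------------------------------------------------------
-- Arrangements over ℚ

module _ (α : Fin n → Vec ℤ l) where

  H : Fin n → Pred (Vec ℚ l) 0ℓ
  H i v = ℚᵒ.⟪ α i , v ⟫ ≡ 0ℚ

  ⋂ : Subset n → Pred (Vec ℚ l) 0ℓ
  ⋂ B v = ∀ {i} → i ∈ₛ B → H i v

  members : Subset n → List (Fin n)
  members B = filter (_∈? B) (allFin n)

  dim⋂ : ∀ B → ∃ (HasDim (⋂ B))
  dim⋂ B with Kernel.kernel (List.map (map ℚᵒ.fromℤ ∘ α) (members B))
  ... | d , bs , basis = d , bs , record
    { contained   = λ as i∈B → All.lookup (contained as)
        (∈-map⁺ _ (∈-filter⁺ (_∈? B) (∈-allFin _) i∈B))
    ; spanning    = λ v v∈⋂ → spanning v (All.map⁺ (All.tabulate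
        λ i∈ → v∈⋂ (proj₂ (∈-filter⁻ (_∈? B) {xs = allFin n} i∈))))
    ; independent = independent
    }
    where open IsBasis basis

  -- The codimension of ⋂ B; the dimension found by elimination is the only d
  -- with HasDim (⋂ B) d.
  rk : Subset n → ℕ
  rk B = l ∸ proj₁ (dim⋂ B)

record Arrangement (l n : ℕ) : Set where
  field
    α           : Fin n → Vec ℤ l
    nonzero     : ∀ i → α i ≢ replicate l 0ℤ
    isPrimitive : ∀ i p → Prime p → ¬ (∀ k → (+ p) ∣ℤ lookup (α i) k)
    distinct    : ∀ {i j} → i ≢ j → ¬ (H α i ≐ H α j)
    essential   : ⋂ α ⊤ ≐ (_≡ 𝟘)

module _ (𝒜 : Arrangement l n) where
  open Arrangement 𝒜

  -- s ranges over integer representatives of the scalars of 𝔽ₚ.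
  Good : ℕ → Set
  Good p = ∀ {i j} → i Fin.< j →
    ¬ (∃[ s ] ∀ k → (+ p) ∣ℤ (lookup (α i) k ℤ.- s ℤ.* lookup (α j) k))

  -- An increasing sequence i₁ < ⋯ < iₗ is the same thing as an l-element subset.
  LuckyFor : TermOrdering l → ℕ → Set
  LuckyFor σ p = ∀ (B : Subset n) → ∣ B ∣ ≡ l → rk α B ≡ l →
    Lucky σ p ⟨ List.map (linearForm ∘ α) (members α B) ⟩

  coboundary : Poly 2
  coboundary = sumOver (subsets n) λ B → x ^ (rk α ⊤ ∸ rk α B) * (y + - 1#) ^ ∣ B ∣
    where
    open RawRing (polyRing 2)
    open SemiringDefs rawSemiring using (_^_)
    open Over (polyRing 2) using (sumOver)
    x = var Fin.zero
    y = var (Fin.suc Fin.zero)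

------------------------------------------------------------------------
-- Finite fields and the reduced arrangement

record FiniteField (q : ℕ) c ℓ : Set (lsuc (c ⊔ ℓ)) where
  field
    commutativeRing : CommutativeRing c ℓ

  open CommutativeRing commutativeRing public

  field
    1≉0         : ¬ 1# ≈ 0#
    inverse     : ∀ x → ¬ x ≈ 0# → ∃[ y ] x * y ≈ 1#
    enumeration : Inverse (≡.setoid (Fin q)) setoid

  _≟_ : Rel.Decidable _≈_
  _≟_ = via-injection (Inverse.Inverse⇒Injection (Inverse.sym enumeration)) Fin._≟_

  points : ∀ l → List (Vec Carrier l)
  points = allVecs (List.map (Inverse.to enumeration) (allFin q))

module Reduced {q} (𝒜 : Arrangement l n) (𝔽 : FiniteField q c ℓ) where
  open Arrangement 𝒜
  open FiniteField 𝔽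
  open Over rawRing using (⟪_,_⟫)

  H̄ : Fin n → Pred (Vec Carrier l) ℓ
  H̄ i P = ⟪ α i , P ⟫ ≈ 0#

  H̄? : ∀ P i → Dec (H̄ i P)
  H̄? P i = ⟪ α i , P ⟫ ≟ 0#

  SameHyperplane : Rel (Fin n) (c ⊔ ℓ)
  SameHyperplane i j = All (λ P → (H̄ i P → H̄ j P) × (H̄ j P → H̄ i P)) (points l)

  sameHyperplane? : Rel.Decidable SameHyperplane
  sameHyperplane? i j = All.all? (λ P → (H̄? P i →-dec H̄? P j) ×-dec (H̄? P j →-dec H̄? P i)) (points l)

  -- One index for each hyperplane of the reduced arrangement, which is a set:
  -- indices whose hyperplanes coincide over 𝔽 count once.
  hyperplanes : List (Fin n)
  hyperplanes = deduplicate sameHyperplane? (allFin n)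

  h : Vec Carrier l → ℕ
  h P = length (filter (H̄? P) hyperplanes)

{-
Both sides expand in powers of t - 1: writing t = 1 + (t - 1), the right hand
side is Σ_B #(⋂_B H̄) (t - 1)^|B|, so it suffices that the subspace ⋂_B H̄ of 𝔽ˡ
has q^(l - rk B) points for every B, where goodness of p guarantees that the
reduced hyperplanes remain distinct.

Choose a basis I of the forms in B and extend it to a basis J of all forms.
Luckiness for J makes the lattice L spanned by J saturated at p, that is,
p v ∈ L implies v ∈ L: if LM(g) divides LM(p v), then g has no constant term, so
LT(g) is a variable, the linear part of g lies in L, and it cancels the leading
term of v because its leading coefficient is prime to p. Only linear forms are
reduced, so this terminates without Dickson's lemma. Saturation means that J is
independent modulo p, and dividing out p as often as possible turns the rational
dual basis of J into integral vectors C_j with α_i(C_j) = m δ_ij and p ∤ m.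
Every form in B satisfies m α_b = Σ_I α_b(C_i) α_i, so I and B have the same
zeros over 𝔽; translating along the C_i shows that each form of I divides the
number of zeros by q.
-}
module Submission where

open import Defs
open import Algebra.Bundles using (CommutativeRing)
open import Algebra.Bundles.Raw using (RawRing)
import Algebra.Definitions.RawMagma as MagmaDefs
import Algebra.Definitions.RawSemiring as SemiringDefs
open import Algebra.Definitions.RawSemiring (RawRing.rawSemiring (polyRing 1)) using () renaming (_^_ to _^ₚ_)
open import Data.Bool.Base using (true; false; if_then_else_)
open import Data.Empty using (⊥-elim)
open import Data.Fin.Base as Fin using (Fin; zero; suc)
open import Data.Fin.Induction using (spo-wellFounded)
import Data.Fin.Permutation as Perm
import Data.Fin.Properties as Fin
open import Data.Fin.Subset using (Subset; inside; outside; ⊤; ⊥; ∣_∣; _∪_; ⁅_⁆; _⊆_) renaming (_∈_ to _∈ₛ_)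
open import Data.Fin.Subset.Properties
  using (_∈?_; _⊆?_; x∈p∪q⁻; p⊆p∪q; q⊆p∪q; x∈⁅x⁆; x∈⁅y⁆⇒x≡y; ∉⊥; ∈⊤)
open import Data.Integer.Base as ℤ using (ℤ; +_; -[1+_]; 0ℤ; 1ℤ)
open import Data.Integer.Divisibility using () renaming (_∣_ to _∣ℤ_)
open import Data.Integer.Divisibility.Signed as ℤ∣ using (∣ᵤ⇒∣; ∣⇒∣ᵤ; divides)
import Data.Integer.Properties as ℤ
import Data.Integer.Tactic.RingSolver as ℤ
open import Data.List.Base as List
  using (List; []; _∷_; _++_; allFin; cartesianProductWith; deduplicate; filter; length)
import Data.List.Extrema as Extrema
open import Data.List.Membership.Propositional using () renaming (_∈_ to _∈ₗ_)
open import Data.List.Membership.Propositional.Properties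
  using (∈-allFin; ∈-cartesianProductWith⁺; ∈-filter⁺; ∈-filter⁻; ∈-map⁺)
import Data.List.Properties as List
open import Data.List.Relation.Unary.All as All using (All; []; _∷_)
open import Data.List.Relation.Unary.AllPairs using ([]; _∷_)
open import Data.List.Relation.Unary.Any using (here; there)
open import Data.List.Relation.Unary.Unique.Propositional using (Unique)
import Data.List.Relation.Unary.Unique.Propositional.Properties as Unique
open import Data.Nat.Base as ℕ using (ℕ; zero; suc; z≤n; s≤s; _∸_)
open import Data.Nat.Coprimality using (Coprime; coprime-Bézout)
import Data.Nat.Divisibility as ℕ∣
open import Data.Nat.GCD using (module Bézout)
open import Data.Nat.Induction using (<-wellFounded)
open import Data.Nat.Primality
  using (Prime; euclidsLemma; prime⇒irreducible; prime⇒nonTrivial; prime⇒nonZero)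
import Data.Nat.Properties as ℕ
open import Data.Product using (Σ; ∃-syntax; _×_; _,_; proj₁; proj₂)
open import Data.Rational.Base as ℚ using (ℚ; 0ℚ; 1ℚ; mkℚ; toℚᵘ)
import Data.Rational.Properties as ℚ
open import Data.Rational.Unnormalised.Base using (mkℚᵘ; *≡*; _≃_)
import Data.Rational.Unnormalised.Properties as ℚᵘ
open import Data.Sum.Base using (_⊎_; inj₁; inj₂; [_,_]′)
open import Data.Vec.Base as Vec using (Vec; []; _∷_; lookup; map; replicate; tabulate; zipWith)
import Data.Vec.Properties as Vec
open import Data.Vec.Relation.Binary.Pointwise.Inductive as Pointwise using (Pointwise; []; _∷_)
open import Function.Base using (_∘_; id)
open import Function.Bundles using (module Inverse)
open import Induction.WellFounded using (WellFounded; Acc; acc)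
open import Level using (0ℓ)
open import Relation.Binary.Core using (Rel)
import Relation.Binary.Definitions as Rel
open import Relation.Binary.PropositionalEquality as ≡ using (_≡_; _≢_; cong; cong₂; subst)
open import Relation.Binary.Structures using (IsTotalOrder)
open import Relation.Nullary using (¬_; Dec; yes; no; does)
open import Relation.Nullary.Decidable using (¬?; dec-true; dec-false; decidable-stable)
open import Relation.Unary using (Pred; Decidable; _≐_)

open Kernel hiding (dot; interchange)

-- Luckiness speaks only of `l` forms of rank `l`; this is why the basis `I` of the forms in `B` has
-- to be treated inside a basis `J` of all forms. The number `m` starts as a common denominator of
-- the rational dual basis. The unit covectors satisfy `m e_k = Σ_j C_j(k) α_j`, so if `p` divides
-- `m`, independence of `J` modulo `p` makes every entry of every `C_j` divisible by `p`; dividing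
-- by `p` gives a smaller `m`. Once `p` does not divide `m`, the vectors `C_j / m` exist over 𝔽 and
-- are dual to the forms there, and the count rests on translations alone. Translation by 1, applied
-- to the sum of all elements of 𝔽, also shows that `q`, and hence `p`, is zero in 𝔽.
--
-- Ranks are defined by elimination, and dual vectors are what relates them to cardinalities.
-- Goodness concerns the right hand side: `h` counts distinct hyperplanes, the expansion over `B`
-- counts indices, and both counts agree because forms with the same zeros over 𝔽 are proportional
-- modulo `p`. The points are counted in ℤ, and the counts are then mapped to ℤ[t].

private variable
  l d n : ℕ

-- Finite sums and the image of ℤ in a commutative ring

module RingSums {c ℓ} (R : CommutativeRing c ℓ) where
  open CommutativeRing R hiding (zero)
  open Over rawRing
  open import Algebra.Properties.Ring ring public
    using (-‿+-comm; -‿distribˡ-*; -‿distribʳ-*; -‿involutive; -0#≈0#)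
  open import Algebra.Properties.CommutativeSemigroup
    (CommutativeRing.+-commutativeSemigroup R) using (interchange)
  open import Algebra.Properties.Semiring.Mult semiring
    using (×-homo-+; ×1-homo-*) renaming (_×_ to _·_)
  open import Algebra.Properties.Monoid.Sum +-monoid using (sum)
  open import Relation.Binary.Reasoning.Setoid setoid

  module _ {a} {A : Set a} where

    sum-cong-∈ : ∀ xs {f g : A → Carrier} → (∀ {x} → x ∈ₗ xs → f x ≈ g x) →
                 sumOver xs f ≈ sumOver xs g
    sum-cong-∈ []       eq = refl
    sum-cong-∈ (x ∷ xs) eq = +-cong (eq (here ≡.refl)) (sum-cong-∈ xs (eq ∘ there))

    sum-cong : ∀ xs {f g : A → Carrier} → (∀ x → f x ≈ g x) → sumOver xs f ≈ sumOver xs g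
    sum-cong xs eq = sum-cong-∈ xs λ {x} _ → eq x

    sum-zero : ∀ xs {f : A → Carrier} → (∀ {x} → x ∈ₗ xs → f x ≈ 0#) → sumOver xs f ≈ 0#
    sum-zero []       eq = refl
    sum-zero (x ∷ xs) eq =
      trans (+-cong (eq (here ≡.refl)) (sum-zero xs (eq ∘ there))) (+-identityˡ 0#)

    sum-+ : ∀ xs (f g : A → Carrier) →
            sumOver xs (λ x → f x + g x) ≈ sumOver xs f + sumOver xs g
    sum-+ []       f g = sym (+-identityˡ 0#)
    sum-+ (x ∷ xs) f g = trans (+-congˡ (sum-+ xs f g)) (interchange _ _ _ _)

    sum-*ˡ : ∀ xs b (f : A → Carrier) → sumOver xs (λ x → b * f x) ≈ b * sumOver xs f
    sum-*ˡ []       b f = sym (zeroʳ b)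
    sum-*ˡ (x ∷ xs) b f = trans (+-congˡ (sum-*ˡ xs b f)) (sym (distribˡ b _ _))

    sum-*ʳ : ∀ xs b (f : A → Carrier) → sumOver xs (λ x → f x * b) ≈ sumOver xs f * b
    sum-*ʳ []       b f = sym (zeroˡ b)
    sum-*ʳ (x ∷ xs) b f = trans (+-congˡ (sum-*ʳ xs b f)) (sym (distribʳ b _ _))

    sum-++ : ∀ xs ys (f : A → Carrier) →
             sumOver (xs ++ ys) f ≈ sumOver xs f + sumOver ys f
    sum-++ []       ys f = sym (+-identityˡ _)
    sum-++ (x ∷ xs) ys f = trans (+-congˡ (sum-++ xs ys f)) (sym (+-assoc _ _ _))

    sum-single : ∀ {xs} → Unique xs → ∀ {i} → i ∈ₗ xs → (f : A → Carrier) →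
               (∀ {j} → j ∈ₗ xs → j ≢ i → f j ≈ 0#) → sumOver xs f ≈ f i
    sum-single (i∉ ∷ u) (here ≡.refl) f eq = trans
      (+-congˡ (sum-zero _ λ j∈ → eq (there j∈) (All.lookup i∉ j∈ ∘ ≡.sym))) (+-identityʳ _)
    sum-single (x∉ ∷ u) (there i∈)    f eq = trans
      (+-cong (eq (here ≡.refl) (All.lookup x∉ i∈)) (sum-single u i∈ f (eq ∘ there)))
        (+-identityˡ _)

  sum-swap : ∀ {a b} {A : Set a} {B : Set b} xs ys (f : A → B → Carrier) →
             sumOver xs (λ x → sumOver ys (f x)) ≈ sumOver ys (λ y → sumOver xs λ x → f x y)
  sum-swap []       ys f = sym (sum-zero ys λ _ → refl)
  sum-swap (x ∷ xs) ys f = trans (+-congˡ (sum-swap xs ys f)) (sym (sum-+ ys _ _))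

  sum-map : ∀ {a b} {A : Set a} {B : Set b} (g : A → B) xs f →
            sumOver (List.map g xs) f ≡ sumOver xs (f ∘ g)
  sum-map g []       f = ≡.refl
  sum-map g (x ∷ xs) f = cong (λ s → f (g x) + s) (sum-map g xs f)

  sum-allFin-suc : ∀ n f → sumOver (allFin (suc n)) f ≡ f zero + sumOver (allFin n) (f ∘ suc)
  sum-allFin-suc n f = cong (λ s → f zero + s)
    (≡.trans (cong (λ xs → sumOver xs f) (≡.sym (List.map-tabulate id suc)))
      (sum-map suc (allFin n) f))

  sum-allFin : ∀ n f → sumOver (allFin n) f ≡ sum f
  sum-allFin zero    f = ≡.refl
  sum-allFin (suc n) f =
    ≡.trans (sum-allFin-suc n f) (cong (λ s → f zero + s) (sum-allFin n (f ∘ suc)))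

  sum-cartesianProductWith : ∀ {a b d} {A : Set a} {B : Set b} {D : Set d} (g : A → B → D) xs ys f →
    sumOver (cartesianProductWith g xs ys) f ≈ sumOver xs λ x → sumOver ys λ y → f (g x y)
  sum-cartesianProductWith g []       ys f = refl
  sum-cartesianProductWith g (x ∷ xs) ys f = trans (sum-++ (List.map (g x) ys) _ f)
    (+-cong (reflexive (sum-map (g x) ys f)) (sum-cartesianProductWith g xs ys f))

  sum-const : ∀ {a} {A : Set a} (xs : List A) b → sumOver xs (λ _ → b) ≈ fromℤ (+ length xs) * b
  sum-const []       b = sym (zeroˡ b)
  sum-const (x ∷ xs) b =
    trans (+-cong (sym (*-identityˡ b)) (sum-const xs b)) (sym (distribʳ b _ _))

  -- A unit vector. Pairing a form with it reads off one coefficient, which turns identities between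
  -- values into identities between coefficients.
  basis : ∀ {l} → Fin l → Vec Carrier l
  basis k = tabulate λ k′ → if does (k′ Fin.≟ k) then 1# else 0#

  sum-basis : ∀ {l} k (f : Fin l → Carrier) →
              sumOver (allFin l) (λ k′ → lookup (basis k) k′ * f k′) ≈ f k
  sum-basis {l} k f = trans
    (sum-single (Unique.allFin⁺ l) (∈-allFin k) _ λ {k′} _ k′≢k →
      trans (*-congʳ (trans (entry k′) (off k′≢k))) (zeroˡ (f k′)))
    (trans (*-congʳ (trans (entry k) on)) (*-identityˡ (f k)))
    where
    entry : ∀ k′ → lookup (basis k) k′ ≈ (if does (k′ Fin.≟ k) then 1# else 0#)
    entry k′ = reflexive (Vec.lookup∘tabulate (λ k′ → if does (k′ Fin.≟ k) then 1# else 0#) k′)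
    off : ∀ {k′} → k′ ≢ k → (if does (k′ Fin.≟ k) then 1# else 0#) ≈ 0#
    off {k′} ne with k′ Fin.≟ k
    ... | yes eq = ⊥-elim (ne eq)
    ... | no _   = refl
    on : (if does (k Fin.≟ k) then 1# else 0#) ≈ 1#
    on with k Fin.≟ k
    ... | yes _ = refl
    ... | no ne = ⊥-elim (ne ≡.refl)

  fromℤ-⊖ : ∀ m n → fromℤ (m ℤ.⊖ n) ≈ fromℤ (+ m) - fromℤ (+ n)
  fromℤ-⊖ zero    zero    = sym (-‿inverseʳ 0#)
  fromℤ-⊖ zero    (suc n) = sym (+-identityˡ _)
  fromℤ-⊖ (suc m) zero    = sym (trans (+-congˡ -0#≈0#) (+-identityʳ _))
  fromℤ-⊖ (suc m) (suc n) = begin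
    fromℤ (suc m ℤ.⊖ suc n)                ≡⟨ cong fromℤ (ℤ.[1+m]⊖[1+n]≡m⊖n m n) ⟩
    fromℤ (m ℤ.⊖ n)                        ≈⟨ fromℤ-⊖ m n ⟩
    m · 1# - n · 1#                        ≈⟨ +-identityˡ _ ⟨
    0# + (m · 1# - n · 1#)                 ≈⟨ +-congʳ (-‿inverseʳ 1#) ⟨
    (1# - 1#) + (m · 1# - n · 1#)          ≈⟨ interchange _ _ _ _ ⟩
    (1# + m · 1#) + (- 1# - n · 1#)        ≈⟨ +-congˡ (-‿+-comm _ _) ⟩
    (1# + m · 1#) - (1# + n · 1#)          ∎

  fromℤ-+ : ∀ i j → fromℤ (i ℤ.+ j) ≈ fromℤ i + fromℤ j
  fromℤ-+ (+ m)    (+ n)    = ×-homo-+ 1# m n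
  fromℤ-+ (+ m)    -[1+ n ] = fromℤ-⊖ m (suc n)
  fromℤ-+ -[1+ m ] (+ n)    = trans (fromℤ-⊖ n (suc m)) (+-comm _ _)
  fromℤ-+ -[1+ m ] -[1+ n ] = begin
    - (suc (suc (m ℕ.+ n)) · 1#)     ≡⟨ cong (λ k → - (suc k · 1#)) (≡.sym (ℕ.+-suc m n)) ⟩
    - ((suc m ℕ.+ suc n) · 1#)       ≈⟨ -‿cong (×-homo-+ 1# (suc m) (suc n)) ⟩
    - (suc m · 1# + suc n · 1#)      ≈⟨ -‿+-comm _ _ ⟨
    - (suc m · 1#) - (suc n · 1#)    ∎
    where import Data.Nat.Properties as ℕ

  fromℤ-neg : ∀ i → fromℤ (ℤ.- i) ≈ - fromℤ i
  fromℤ-neg (+ zero)  = sym -0#≈0#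
  fromℤ-neg (+ suc n) = refl
  fromℤ-neg -[1+ n ]  = sym (-‿involutive _)

  fromℤ-*-pos : ∀ m j → fromℤ (+ m ℤ.* j) ≈ fromℤ (+ m) * fromℤ j
  fromℤ-*-pos m (+ n) = trans (reflexive (cong fromℤ (≡.sym (ℤ.pos-* m n)))) (×1-homo-* m n)
  fromℤ-*-pos m -[1+ n ] = begin
    fromℤ (+ m ℤ.* ℤ.- + suc n)      ≡⟨ cong fromℤ (≡.sym (ℤ.neg-distribʳ-* (+ m) (+ suc n))) ⟩
    fromℤ (ℤ.- (+ m ℤ.* + suc n))    ≈⟨ fromℤ-neg (+ m ℤ.* + suc n) ⟩
    - fromℤ (+ m ℤ.* + suc n)        ≈⟨ -‿cong (fromℤ-*-pos m (+ suc n)) ⟩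
    - (m · 1# * suc n · 1#)          ≈⟨ -‿distribʳ-* _ _ ⟩
    m · 1# * fromℤ -[1+ n ]          ∎

  fromℤ-* : ∀ i j → fromℤ (i ℤ.* j) ≈ fromℤ i * fromℤ j
  fromℤ-* (+ m)    j = fromℤ-*-pos m j
  fromℤ-* -[1+ m ] j = begin
    fromℤ (ℤ.- + suc m ℤ.* j)        ≡⟨ cong fromℤ (≡.sym (ℤ.neg-distribˡ-* (+ suc m) j)) ⟩
    fromℤ (ℤ.- (+ suc m ℤ.* j))      ≈⟨ fromℤ-neg (+ suc m ℤ.* j) ⟩
    - fromℤ (+ suc m ℤ.* j)          ≈⟨ -‿cong (fromℤ-*-pos (suc m) j) ⟩
    - (suc m · 1# * fromℤ j)         ≈⟨ -‿distribˡ-* _ _ ⟩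
    fromℤ -[1+ m ] * fromℤ j         ∎

  fromℤ-1 : fromℤ 1ℤ ≈ 1#
  fromℤ-1 = +-identityʳ 1#

  fromℤ-sum : ∀ {a} {A : Set a} (xs : List A) f →
              fromℤ (Over.sumOver ℤ.+-*-rawRing xs f) ≈ sumOver xs (fromℤ ∘ f)
  fromℤ-sum []       f = refl
  fromℤ-sum (x ∷ xs) f = trans (fromℤ-+ (f x) _) (+-congˡ (fromℤ-sum xs f))

  dot-sum : ∀ {n} (u v : Vec Carrier n) →
            dot u v ≈ sumOver (allFin n) λ k → lookup u k * lookup v k
  dot-sum []      []      = refl
  dot-sum (x ∷ u) (y ∷ v) = trans (+-congˡ (dot-sum u v))
    (reflexive (≡.sym (sum-allFin-suc _ λ k → lookup (x ∷ u) k * lookup (y ∷ v) k)))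

  ⟪⟫-sum : ∀ {n} (a : Vec ℤ n) v →
           ⟪ a , v ⟫ ≈ sumOver (allFin n) λ k → fromℤ (lookup a k) * lookup v k
  ⟪⟫-sum a v = trans (dot-sum (Vec.map fromℤ a) v)
    (sum-cong (allFin _) λ k → *-congʳ (reflexive (lookup-map k fromℤ a)))
    where open import Data.Vec.Properties using (lookup-map)

length-filter-tabulate : ∀ {a p} {A : Set a} {P : Pred A p} (P? : Decidable P) (f : Fin n → A) →
                         length (filter P? (List.tabulate f)) ≡ ∣ tabulate (does ∘ P? ∘ f) ∣
length-filter-tabulate {n = zero}  P? f = ≡.refl
length-filter-tabulate {n = suc n} P? f with does (P? (f zero))
... | true  = cong suc (length-filter-tabulate P? (f ∘ suc))
... | false = length-filter-tabulate P? (f ∘ suc)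

does-∈? : ∀ (i : Fin n) B → does (i ∈? B) ≡ lookup B i
does-∈? i B with lookup B i in eq
... | true  = dec-true (i ∈? B) (Vec.lookup⇒[]= i B eq)
... | false = dec-false (i ∈? B) λ i∈B → case-≡ (≡.trans (≡.sym eq) (Vec.[]=⇒lookup i∈B))
  where
  case-≡ : ¬ (false ≡ true)
  case-≡ ()

-- Dimension

-- Only the branch of `kernel₁` with a nonzero leading coefficient loses a dimension, and the
-- recursion stops there.
kernel₁-dim : (φ : Vec ℚ l) → l ℕ.≤ suc (proj₁ (kernel₁ φ))
kernel₁-dim []      = z≤n
kernel₁-dim (a ∷ φ) with a ℚ.≟ 0ℚ
... | yes ≡.refl = s≤s (kernel₁-dim φ)
... | no _     = ℕ.≤-refl

head-lincomb : ∀ as (bs : Vec (Vec ℚ (suc l)) d) →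
  Vec.head (lincomb as bs) ≡ Kernel.dot (map Vec.head bs) as
head-lincomb []       []              = ≡.refl
head-lincomb (a ∷ as) ((b ∷ bs) ∷ cs) with lincomb as cs | head-lincomb as cs
... | x ∷ xs | eq = cong₂ ℚ._+_ (ℚ.*-comm a b) eq

tail-lincomb-linear : (bs : Vec (Vec ℚ (suc l)) d) → Linear (λ as → Vec.tail (lincomb as bs))
tail-lincomb-linear bs = record
  { pres-⊕ = λ u v → ≡.trans (cong Vec.tail (L.pres-⊕ u v)) (tail-⊕ (lincomb u bs) (lincomb v bs))
  ; pres-⊙ = λ a u → ≡.trans (cong Vec.tail (L.pres-⊙ a u)) (tail-⊙ a (lincomb u bs))
  ; pres-𝟘 = cong Vec.tail L.pres-𝟘
  }
  where
  module L = Linear (lincomb-linear bs)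
  tail-⊕ : ∀ {l} (u v : Vec ℚ (suc l)) → Vec.tail (u ⊕ v) ≡ Vec.tail u ⊕ Vec.tail v
  tail-⊕ (_ ∷ _) (_ ∷ _) = ≡.refl
  tail-⊙ : ∀ {l} a (u : Vec ℚ (suc l)) → Vec.tail (a ⊙ u) ≡ a ⊙ Vec.tail u
  tail-⊙ a (_ ∷ _) = ≡.refl

1∷𝟘≢𝟘 : (1ℚ ∷ 𝟘 {l}) ≢ 𝟘
1∷𝟘≢𝟘 ()

-- Induction on `l`. The coefficient vectors whose combination has first entry zero form a space of
-- dimension at least `d - 1`; on it the tails of the combinations, one entry shorter, remain
-- independent.
independent⇒≤ : (bs : Vec (Vec ℚ l) d) → (∀ as → lincomb as bs ≡ 𝟘 → as ≡ 𝟘) → d ℕ.≤ l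
independent⇒≤ {zero}  {zero}  bs ind = z≤n
independent⇒≤ {zero}  {suc d} bs ind with lincomb (1ℚ ∷ 𝟘) bs | ind (1ℚ ∷ 𝟘)
... | [] | f = ⊥-elim (1∷𝟘≢𝟘 (f ≡.refl))
independent⇒≤ {suc l} {d}     bs ind with kernel₁ (map Vec.head bs) | kernel₁-dim (map Vec.head bs)
... | e , cs , basis | d≤1+e =
  ℕ.≤-trans d≤1+e (s≤s (independent⇒≤ (map (λ c → Vec.tail (lincomb c bs)) cs) ind′))
  where
  open IsBasis basis
  ind′ : ∀ as → lincomb as (map (λ c → Vec.tail (lincomb c bs)) cs) ≡ 𝟘 → as ≡ 𝟘
  ind′ as eq = independent as (ind (lincomb as cs) (glue (lincomb (lincomb as cs) bs)
    (≡.trans (head-lincomb _ bs) (contained as))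
    (≡.trans (≡.sym (lincomb-map (tail-lincomb-linear bs) as cs)) eq)))
    where
    glue : ∀ (v : Vec ℚ (suc l)) → Vec.head v ≡ 0ℚ → Vec.tail v ≡ 𝟘 → v ≡ 𝟘
    glue (x ∷ v) p q = cong₂ _∷_ p q

-- Two applications of `independent⇒≤`: to the basis itself, and to the coordinates of the standard
-- vectors with respect to it, which are independent because `lincomb` maps them back to the
-- standard basis.
dim-full : ∀ {V : Pred (Vec ℚ l) 0ℓ} → (∀ v → V v) → HasDim V d → d ≡ l
dim-full {l} {d} {V} full (bs , basis) =
  ℕ.≤-antisym (independent⇒≤ bs independent) (independent⇒≤ (map coord (standard l)) ind)
  where
  open IsBasis basis
  open ≡.≡-Reasoning
  coord : Vec ℚ l → Vec ℚ d
  coord v = proj₁ (spanning v (full v))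
  ind : ∀ as → lincomb as (map coord (standard l)) ≡ 𝟘 → as ≡ 𝟘
  ind as eq = begin
    as                                                  ≡⟨ lincomb-standard as ⟨
    lincomb as (standard l)
      ≡⟨ cong (lincomb as) (Vec.map-id (standard l)) ⟨
    lincomb as (map id (standard l))
      ≡⟨ cong (lincomb as) (Vec.map-cong (λ v → ≡.sym (proj₂ (spanning v (full v)))) (standard l)) ⟩
    lincomb as (map (f ∘ coord) (standard l))
      ≡⟨ cong (lincomb as) (Vec.map-∘ f coord (standard l)) ⟩
    lincomb as (map f (map coord (standard l)))
      ≡⟨ lincomb-map (lincomb-linear bs) as (map coord (standard l)) ⟩
    lincomb (lincomb as (map coord (standard l))) bs    ≡⟨ cong f eq ⟩
    lincomb 𝟘 bs                                        ≡⟨ Linear.pres-𝟘 (lincomb-linear bs) ⟩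
    𝟘                                                   ∎
    where
    f : Vec ℚ d → Vec ℚ l
    f c = lincomb c bs

dim-trivial : ∀ {V : Pred (Vec ℚ l) 0ℓ} → (∀ v → V v → v ≡ 𝟘) → HasDim V d → d ≡ 0
dim-trivial {d = zero}  _       _            = ≡.refl
dim-trivial {d = suc d} trivial (bs , basis) =
  ⊥-elim (1∷𝟘≢𝟘 (independent (1ℚ ∷ 𝟘) (trivial _ (contained (1ℚ ∷ 𝟘)))))
  where open IsBasis basis

HasDim-resp-≐ : ∀ {V W : Pred (Vec ℚ l) 0ℓ} → V ≐ W → HasDim V d → HasDim W d
HasDim-resp-≐ (V⊆W , W⊆V) (bs , basis) = bs , record
  { contained   = V⊆W ∘ contained
  ; spanning    = λ v → spanning v ∘ W⊆V
  ; independent = independent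
  }
  where open IsBasis basis

dot-lin : ∀ (φ : Vec ℚ l) a w v → Kernel.dot φ (a ⊙ w ⊕ v) ≡ a ℚ.* Kernel.dot φ w ℚ.+ Kernel.dot φ v
dot-lin φ a w v = ≡.trans (dot-⊕ φ _ v) (cong (ℚ._+ _) (dot-⊙ φ a w))

-- `U` is the direct sum of `V` and the line through `w`, with `Kernel.dot ψ` as the coordinate
-- along `w`. This is how dropping one equation raises the dimension by one.
HasDim-suc : ∀ {V U : Pred (Vec ℚ l) 0ℓ} (ψ w : Vec ℚ l) → Kernel.dot ψ w ≡ 1ℚ →
             (∀ {v} → V v → Kernel.dot ψ v ≡ 0ℚ) →
             (∀ a {v} → V v → U (a ⊙ w ⊕ v)) →
             (∀ {v} → U v → V ((ℚ.- Kernel.dot ψ v) ⊙ w ⊕ v)) →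
             HasDim V d → HasDim U (suc d)
HasDim-suc {l} ψ w ψw≡1 V⇒ψ≡0 V⇒U U⇒V (bs , basis) = w ∷ bs , record
  { contained   = λ where (a ∷ as) → V⇒U a (contained as)
  ; spanning    = λ v Uv → let as , eq = spanning _ (U⇒V Uv) in
      Kernel.dot ψ v ∷ as , ≡.trans (cong (Kernel.dot ψ v ⊙ w ⊕_) eq) (cancel (Kernel.dot ψ v) w v)
  ; independent = λ where
      (a ∷ as) eq →
        let ψ-eq = begin
              a                                                                ≡⟨ ℚ.*-identityʳ a ⟨
              a ℚ.* 1ℚ
                ≡⟨ cong (a ℚ.*_) ψw≡1 ⟨
              a ℚ.* Kernel.dot ψ w                                             ≡⟨ ℚ.+-identityʳ _ ⟨
              a ℚ.* Kernel.dot ψ w ℚ.+ 0ℚ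
                ≡⟨ cong (a ℚ.* Kernel.dot ψ w ℚ.+_) (V⇒ψ≡0 (contained as)) ⟨
              a ℚ.* Kernel.dot ψ w ℚ.+ Kernel.dot ψ (lincomb as bs)            ≡⟨ dot-lin ψ a w _ ⟨
              Kernel.dot ψ (a ⊙ w ⊕ lincomb as bs)
                ≡⟨ cong (Kernel.dot ψ) eq ⟩
              Kernel.dot ψ 𝟘                                                   ≡⟨ dot-𝟘 ψ ⟩
              0ℚ                                                               ∎
            as-eq = begin
              lincomb as bs                 ≡⟨ ⊕-identityˡ _ ⟨
              𝟘 ⊕ lincomb as bs             ≡⟨ cong (_⊕ lincomb as bs) (⊙-zeroˡ w) ⟨
              0ℚ ⊙ w ⊕ lincomb as bs        ≡⟨ cong (λ x → x ⊙ w ⊕ lincomb as bs) ψ-eq ⟨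
              a ⊙ w ⊕ lincomb as bs         ≡⟨ eq ⟩
              𝟘                             ∎
        in cong₂ _∷_ ψ-eq (independent as as-eq)
  }
  where
  open IsBasis basis
  open ≡.≡-Reasoning
  cancel : ∀ {l} a (w v : Vec ℚ l) → a ⊙ w ⊕ ((ℚ.- a) ⊙ w ⊕ v) ≡ v
  cancel a []      []      = ≡.refl
  cancel a (x ∷ w) (y ∷ v) = cong₂ _∷_
    (begin
      a ℚ.* x ℚ.+ ((ℚ.- a) ℚ.* x ℚ.+ y)    ≡⟨ ℚ.+-assoc (a ℚ.* x) _ y ⟨
      (a ℚ.* x ℚ.+ (ℚ.- a) ℚ.* x) ℚ.+ y    ≡⟨ cong (ℚ._+ y) (ℚ.*-distribʳ-+ x a (ℚ.- a)) ⟨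
      (a ℚ.+ (ℚ.- a)) ℚ.* x ℚ.+ y          ≡⟨ cong (λ z → z ℚ.* x ℚ.+ y) (ℚ.+-inverseʳ a) ⟩
      0ℚ ℚ.* x ℚ.+ y                       ≡⟨ cong (ℚ._+ y) (ℚ.*-zeroˡ x) ⟩
      0ℚ ℚ.+ y                             ≡⟨ ℚ.+-identityˡ y ⟩
      y                                    ∎)
    (cancel a w v)

nonzero-value : (β : Vec ℚ l) → β ≢ 𝟘 → ∃[ as ] Kernel.dot β as ≢ 0ℚ
nonzero-value []      β≢𝟘 = ⊥-elim (β≢𝟘 ≡.refl)
nonzero-value (b ∷ β) β≢𝟘 with b ℚ.≟ 0ℚ
... | no b≢0   =
  1ℚ ∷ 𝟘 , λ eq → b≢0 (≡.trans
    (≡.sym (≡.trans (cong₂ ℚ._+_ (ℚ.*-identityʳ b) (dot-𝟘 β)) (ℚ.+-identityʳ b))) eq)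
... | yes ≡.refl with nonzero-value β (β≢𝟘 ∘ cong (0ℚ ∷_))
...   | as , ne = 0ℚ ∷ as , λ eq → ne (≡.trans (≡.sym (ℚ.+-identityˡ _)) eq)

dot-zeroˡ : (v : Vec ℚ l) → Kernel.dot 𝟘 v ≡ 0ℚ
dot-zeroˡ v = ≡.trans (dot-comm 𝟘 v) (dot-𝟘 v)

-- Independent subarrangements and dual vectors

module Duals {n l} (α : Fin n → Vec ℤ l) where

  φ : Fin n → Vec ℚ l
  φ i = map ℚᵒ.fromℤ (α i)

  form : Fin n → Vec ℚ l → ℚ
  form i v = ℚᵒ.⟪ α i , v ⟫

  -- The existence of `w` expresses linear independence of the forms indexed by `S` and at the same
  -- time supplies the vectors to compute with. `w` is a total function, constrained only on `S`.
  record Dual (S : Subset n) (w : Fin n → Vec ℚ l) : Set where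
    field
      diagonal    : ∀ {i} → i ∈ₛ S → form i (w i) ≡ 1ℚ
      offDiagonal : ∀ {i j} → i ∈ₛ S → j ∈ₛ S → i ≢ j → form i (w j) ≡ 0ℚ

  open Dual

  Dual-⊥ : ∀ {w} → Dual ⊥ w
  Dual-⊥ = record { diagonal = ⊥-elim ∘ ∉⊥ ; offDiagonal = λ i∈ → ⊥-elim (∉⊥ i∈) }

  Dual-⊆ : ∀ {I J w} → I ⊆ J → Dual J w → Dual I w
  Dual-⊆ I⊆J D = record
    { diagonal    = diagonal D ∘ I⊆J
    ; offDiagonal = λ i∈ j∈ → offDiagonal D (I⊆J i∈) (I⊆J j∈)
    }

  -- Whether `α x` lies in the rational span of the forms in `S` is decided on the dual side, by
  -- evaluating it on the basis of `⋂ α S` found by elimination. A negative answer comes with the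
  -- vector that `adjoin` takes.
  vanishes? : ∀ S x → (∀ {v} → ⋂ α S v → H α x v) ⊎ (∃[ u ] ⋂ α S u × form x u ≢ 0ℚ)
  vanishes? S x with dim⋂ α S
  ... | d , bs , basis with Vec.≡-dec ℚ._≟_ (map (form x) bs) 𝟘
  ...   | yes eq = inj₁ λ {v} v∈ → let as , p = spanning v v∈ in begin
      form x v                         ≡⟨ cong (form x) p ⟨
      form x (lincomb as bs)           ≡⟨ dot-lincomb (φ x) as bs ⟩
      Kernel.dot (map (form x) bs) as  ≡⟨ cong (λ β → Kernel.dot β as) eq ⟩
      Kernel.dot 𝟘 as                  ≡⟨ dot-zeroˡ as ⟩
      0ℚ                               ∎
    where
    open IsBasis basis
    open ≡.≡-Reasoning
  ...   | no neq with nonzero-value (map (form x) bs) neq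
  ...     | as , ne = inj₂ (lincomb as bs , (λ i∈ → IsBasis.contained basis as i∈) ,
      λ eq → ne (≡.trans (≡.sym (dot-lincomb (φ x) as bs)) eq))

  -- Adding a multiple of `u` changes no value of a form in `S`. So `u`, scaled, serves as dual
  -- vector of `x`, and each old vector is corrected by the multiple of `u` that makes `form x`
  -- vanish on it.
  adjoin : ∀ {S w x u} → Dual S w → ⋂ α S u → form x u ≢ 0ℚ → ∃[ w′ ] Dual (S ∪ ⁅ x ⁆) w′
  adjoin {S} {w} {x} {u} D u∈ x∤u = w′ , record
    { diagonal    = λ i∈ → [ diag-old , (λ { ≡.refl → diag-new }) ]′ (split i∈)
    ; offDiagonal = λ i∈ j∈ i≢j → off (split i∈) (split j∈) i≢j
    }
    where
    open ≡.≡-Reasoning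
    instance _ = ℚ.≢-nonZero x∤u
    s = ℚ.1/ form x u
    w′ : Fin n → Vec ℚ l
    w′ j with j Fin.≟ x
    ... | yes _ = s ⊙ u
    ... | no _  = (ℚ.- form x (w j) ℚ.* s) ⊙ u ⊕ w j
    split : ∀ {i} → i ∈ₛ S ∪ ⁅ x ⁆ → i ∈ₛ S ⊎ i ≡ x
    split i∈ with x∈p∪q⁻ S ⁅ x ⁆ i∈
    ... | inj₁ i∈S = inj₁ i∈S
    ... | inj₂ i∈x = inj₂ (x∈⁅y⁆⇒x≡y x i∈x)
    w′-new : w′ x ≡ s ⊙ u
    w′-new with x Fin.≟ x
    ... | yes _  = ≡.refl
    ... | no x≢x = ⊥-elim (x≢x ≡.refl)
    w′-old : ∀ {j} → j ∈ₛ S → w′ j ≡ (ℚ.- form x (w j) ℚ.* s) ⊙ u ⊕ w j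
    w′-old {j} j∈ with j Fin.≟ x
    ... | yes ≡.refl = ⊥-elim (x∤u (u∈ j∈))
    ... | no _     = ≡.refl
    form-old : ∀ i {j} → i ∈ₛ S → j ∈ₛ S → form i (w′ j) ≡ form i (w j)
    form-old i {j} i∈ j∈ = begin
      form i (w′ j)                            ≡⟨ cong (form i) (w′-old j∈) ⟩
      form i (b ⊙ u ⊕ w j)                     ≡⟨ dot-lin (φ i) b u (w j) ⟩
      b ℚ.* form i u ℚ.+ form i (w j)          ≡⟨ cong (λ z → b ℚ.* z ℚ.+ form i (w j)) (u∈ i∈) ⟩
      b ℚ.* 0ℚ ℚ.+ form i (w j)                ≡⟨ cong (ℚ._+ form i (w j)) (ℚ.*-zeroʳ b) ⟩
      0ℚ ℚ.+ form i (w j)                      ≡⟨ ℚ.+-identityˡ _ ⟩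
      form i (w j)                             ∎
      where b = ℚ.- form x (w j) ℚ.* s
    diag-new : form x (w′ x) ≡ 1ℚ
    diag-new = ≡.trans (cong (form x) w′-new) (≡.trans (dot-⊙ (φ x) s u) (ℚ.*-inverseˡ (form x u)))
    diag-old : ∀ {i} → i ∈ₛ S → form i (w′ i) ≡ 1ℚ
    diag-old i∈ = ≡.trans (form-old _ i∈ i∈) (diagonal D i∈)
    off : ∀ {i j} → i ∈ₛ S ⊎ i ≡ x → j ∈ₛ S ⊎ j ≡ x → i ≢ j → form i (w′ j) ≡ 0ℚ
    off (inj₁ i∈)   (inj₁ j∈)   i≢j = ≡.trans (form-old _ i∈ j∈) (offDiagonal D i∈ j∈ i≢j)
    off {i} (inj₁ i∈)   (inj₂ ≡.refl) i≢j = begin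
      form i (w′ x)        ≡⟨ cong (form i) w′-new ⟩
      form i (s ⊙ u)       ≡⟨ dot-⊙ (φ i) s u ⟩
      s ℚ.* form i u       ≡⟨ cong (s ℚ.*_) (u∈ i∈) ⟩
      s ℚ.* 0ℚ             ≡⟨ ℚ.*-zeroʳ s ⟩
      0ℚ                   ∎
    off {_} {j} (inj₂ ≡.refl) (inj₁ j∈)   i≢j = begin
      form x (w′ j)                                    ≡⟨ cong (form x) (w′-old j∈) ⟩
      form x ((ℚ.- y ℚ.* s) ⊙ u ⊕ w j)                 ≡⟨ dot-lin (φ x) (ℚ.- y ℚ.* s) u (w j) ⟩
      (ℚ.- y ℚ.* s) ℚ.* form x u ℚ.+ y
        ≡⟨ cong (ℚ._+ y) (ℚ.*-assoc (ℚ.- y) s (form x u)) ⟩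
      ℚ.- y ℚ.* (s ℚ.* form x u) ℚ.+ y
        ≡⟨ cong (λ z → ℚ.- y ℚ.* z ℚ.+ y) (ℚ.*-inverseˡ (form x u)) ⟩
      ℚ.- y ℚ.* 1ℚ ℚ.+ y                               ≡⟨ cong (ℚ._+ y) (ℚ.*-identityʳ (ℚ.- y)) ⟩
      ℚ.- y ℚ.+ y                                      ≡⟨ ℚ.+-inverseˡ y ⟩
      0ℚ                                               ∎
      where y = form x (w j)
    off (inj₂ ≡.refl) (inj₂ ≡.refl) i≢j = ⊥-elim (i≢j ≡.refl)

  record Extension (S : Subset n) (xs : List (Fin n)) : Set where
    field
      subset  : Subset n
      vectors : Fin n → Vec ℚ l
      dual    : Dual subset vectors
      extends : S ⊆ subset
      within  : ∀ {i} → i ∈ₛ subset → i ∈ₛ S ⊎ i ∈ₗ xs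
      spans   : ∀ {x} → x ∈ₗ xs → ∀ {v} → ⋂ α subset v → H α x v

  -- Greedy choice: `x` joins the set exactly when its form does not already vanish on the
  -- intersection of the chosen ones. `within` is what later places the chosen set inside `B`.
  extension : ∀ xs S w → Dual S w → Extension S xs
  extension [] S w D = record
    { subset = S ; vectors = w ; dual = D ; extends = id ; within = inj₁ ; spans = λ () }
  extension (x ∷ xs) S w D with vanishes? S x
  ... | inj₁ vanish = record
    { subset = subset ; vectors = vectors ; dual = dual ; extends = extends
    ; within = [ inj₁ , inj₂ ∘ there ]′ ∘ within
    ; spans  = λ where
        (here ≡.refl) v∈ → vanish (v∈ ∘ extends)
        (there x∈)  v∈ → spans x∈ v∈
    }
    where open Extension (extension xs S w D)
  ... | inj₂ (u , u∈ , ne) with adjoin D u∈ ne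
  ...   | w′ , D′ = record
    { subset = subset ; vectors = vectors ; dual = dual
    ; extends = extends ∘ p⊆p∪q ⁅ x ⁆
    ; within = λ i∈ → [ ([ inj₁ , inj₂ ∘ here ∘ x∈⁅y⁆⇒x≡y x ]′ ∘ x∈p∪q⁻ S ⁅ x ⁆) , inj₂ ∘ there ]′
        (within i∈)
    ; spans  = λ where
        (here ≡.refl) v∈ → v∈ (extends (q⊆p∪q S ⁅ x ⁆ (x∈⁅x⁆ x)))
        (there x∈)  v∈ → spans x∈ v∈
    }
    where open Extension (extension xs (S ∪ ⁅ x ⁆) w′ D′)

  ∈-members⁺ : ∀ {i B} → i ∈ₛ B → i ∈ₗ members α B
  ∈-members⁺ {B = B} i∈ = ∈-filter⁺ (_∈? B) (∈-allFin _) i∈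

  ∈-members⁻ : ∀ {i B} → i ∈ₗ members α B → i ∈ₛ B
  ∈-members⁻ {B = B} i∈ = proj₂ (∈-filter⁻ (_∈? B) {xs = allFin n} i∈)

  members-unique : ∀ B → Unique (members α B)
  members-unique B = Unique.filter⁺ (_∈? B) (Unique.allFin⁺ n)

  length-members : ∀ B → length (members α B) ≡ ∣ B ∣
  length-members B = ≡.trans (length-filter-tabulate (_∈? B) id) (cong ∣_∣
    (≡.trans (Vec.tabulate-cong λ i → does-∈? i B) (Vec.tabulate∘lookup B)))

  -- Dropping the equations of `S` one after the other reaches the full space. The dual vector of
  -- the dropped form is the new direction, because it satisfies the remaining equations.
  Dual-dim : ∀ {S w} → Dual S w → HasDim (⋂ α S) d → ∣ S ∣ ℕ.+ d ≡ l
  Dual-dim {d} {S} {w} D hd = ≡.trans (cong (ℕ._+ d) (≡.sym (length-members S)))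
    (dim-full {V = V []} (λ v ()) (peel (members α S) ∈-members⁻ (members-unique S)
      (HasDim-resp-≐ {V = ⋂ α S} {W = V (members α S)}
        ((λ {v} v∈ {j} j∈ → v∈ (∈-members⁻ j∈)) , λ {v} v∈ {j} j∈ → v∈ (∈-members⁺ j∈)) hd)))
    where
    V : List (Fin n) → Pred (Vec ℚ l) 0ℓ
    V js v = ∀ {j} → j ∈ₗ js → H α j v
    peel : ∀ js → (∀ {j} → j ∈ₗ js → j ∈ₛ S) → Unique js → ∀ {d} →
           HasDim (V js) d → HasDim (V []) (length js ℕ.+ d)
    peel []       _   _          hd = hd
    peel (j ∷ js) js⊆ (j∉ ∷ uniq) hd = subst (HasDim (V [])) (ℕ.+-suc (length js) _)
      (peel js (js⊆ ∘ there) uniq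
        (HasDim-suc {V = V (j ∷ js)} {U = V js} (φ j) (w j) (diagonal D j∈)
        (λ v∈ → v∈ (here ≡.refl))
        (λ a {v} v∈ {i} i∈ → ≡.trans (dot-lin (φ i) a (w j) v)
          (≡.trans (cong₂ (λ x y → a ℚ.* x ℚ.+ y) (off i∈) (v∈ (there i∈)))
            (≡.trans (ℚ.+-identityʳ _) (ℚ.*-zeroʳ a))))
        (λ {v} v∈ → λ where
          (here ≡.refl) → ≡.trans (dot-lin (φ j) (ℚ.- form j v) (w j) v)
            (≡.trans (cong (λ x → (ℚ.- form j v) ℚ.* x ℚ.+ form j v) (diagonal D j∈))
              (≡.trans (cong (ℚ._+ form j v) (ℚ.*-identityʳ (ℚ.- form j v)))
                (ℚ.+-inverseˡ (form j v))))
          {i} (there i∈) → ≡.trans (dot-lin (φ i) (ℚ.- form j v) (w j) v)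
            (≡.trans (cong₂ (λ x y → (ℚ.- form j v) ℚ.* x ℚ.+ y) (off i∈) (v∈ i∈))
              (≡.trans (ℚ.+-identityʳ _) (ℚ.*-zeroʳ (ℚ.- form j v)))))
        hd))
      where
      j∈ : j ∈ₛ S
      j∈ = js⊆ (here ≡.refl)
      off : ∀ {i} → i ∈ₗ js → form i (w j) ≡ 0ℚ
      off i∈ = offDiagonal D (js⊆ (there i∈)) j∈ (λ eq → All.lookup j∉ i∈ (≡.sym eq))

module ℚΣ = RingSums ℚ.+-*-commutativeRing
module ℤΣ = RingSums ℤ.+-*-commutativeRing
module ℤᵒ = Over ℤ.+-*-rawRing

-- Integers inside the rationals

-- `fromℤ` builds an integer as an iterated sum of `1ℚ`; among unnormalised fractions such sums are
-- computed without reducing by a gcd.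
toℚᵘ-fromℕ : ∀ k → toℚᵘ (ℚᵒ.fromℤ (+ k)) ≃ mkℚᵘ (+ k) 0
toℚᵘ-fromℕ zero    = *≡* ≡.refl
toℚᵘ-fromℕ (suc k) = ℚᵘ.≃-trans (ℚ.toℚᵘ-homo-+ 1ℚ (ℚᵒ.fromℤ (+ k)))
  (ℚᵘ.≃-trans (ℚᵘ.+-congʳ (toℚᵘ 1ℚ) (toℚᵘ-fromℕ k)) (*≡* (lemma (+ k))))
  where
  lemma : ∀ k → (1ℤ ℤ.* 1ℤ ℤ.+ k ℤ.* 1ℤ) ℤ.* 1ℤ ≡ (1ℤ ℤ.+ k) ℤ.* (1ℤ ℤ.* 1ℤ)
  lemma = ℤ.solve-∀

toℚᵘ-fromℤ : ∀ z → toℚᵘ (ℚᵒ.fromℤ z) ≃ mkℚᵘ z 0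
toℚᵘ-fromℤ (+ k)    = toℚᵘ-fromℕ k
toℚᵘ-fromℤ -[1+ k ] =
  ℚᵘ.≃-trans (ℚ.toℚᵘ-homo‿- (ℚᵒ.fromℤ (+ suc k))) (ℚᵘ.-‿cong (toℚᵘ-fromℕ (suc k)))

fromℤ-injective : ∀ {i j} → ℚᵒ.fromℤ i ≡ ℚᵒ.fromℤ j → i ≡ j
fromℤ-injective {i} {j} eq
  with *≡* p ← ℚᵘ.≃-trans (ℚᵘ.≃-sym (toℚᵘ-fromℤ i))
    (ℚᵘ.≃-trans (ℚᵘ.≃-reflexive (cong toℚᵘ eq)) (toℚᵘ-fromℤ j))
  = ≡.trans (≡.sym (ℤ.*-identityʳ i)) (≡.trans p (ℤ.*-identityʳ j))

clear-denominator : ∀ r → ℚᵒ.fromℤ (ℚ.↧ r) ℚ.* r ≡ ℚᵒ.fromℤ (ℚ.↥ r)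
clear-denominator r@(mkℚ num den-1 _) = ℚ.toℚᵘ-injective (ℚᵘ.≃-trans
  (ℚ.toℚᵘ-homo-* (ℚᵒ.fromℤ (ℚ.↧ r)) r) (ℚᵘ.≃-trans
  (ℚᵘ.*-congʳ {toℚᵘ r} (toℚᵘ-fromℤ (ℚ.↧ r))) (ℚᵘ.≃-trans
  (*≡* (lemma (ℚ.↧ r) num)) (ℚᵘ.≃-sym (toℚᵘ-fromℤ num)))))
  where
  lemma : ∀ d n → (d ℤ.* n) ℤ.* 1ℤ ≡ n ℤ.* (1ℤ ℤ.* d)
  lemma = ℤ.solve-∀

-- Stated for any property stable under multiples, so that one argument serves two nested uses: for
-- the entries of a vector and for the vectors of a family.
common-multiple : ∀ {n} (Q : Fin n → ℕ → Set) → (∀ i {m} k → Q i m → Q i (k ℕ.* m)) →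
                  (∀ i → ∃[ m ] ℕ.NonZero m × Q i m) → ∃[ m ] ℕ.NonZero m × ∀ i → Q i m
common-multiple {zero}  Q mult ms = 1 , _ , λ ()
common-multiple {suc n} Q mult ms
  with m₀ , nz₀ , q₀ ← ms zero
  with m , nz , q ← common-multiple (Q ∘ suc) (mult ∘ suc) (ms ∘ suc)
  = m ℕ.* m₀ , ℕ.m*n≢0 m m₀ {{nz}} {{nz₀}} , λ where
      zero    → mult zero m q₀
      (suc i) → subst (Q (suc i)) (ℕ.*-comm m₀ m) (mult (suc i) m₀ (q i))

Clears : ℕ → ℚ → Set
Clears m r = ∃[ c ] ℚᵒ.fromℤ c ≡ ℚᵒ.fromℤ (+ m) ℚ.* r

Clears-* : ∀ {m r} k → Clears m r → Clears (k ℕ.* m) r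
Clears-* {m} {r} k (c , eq) = + k ℤ.* c , (begin
  ℚᵒ.fromℤ (+ k ℤ.* c)                              ≡⟨ ℚΣ.fromℤ-* (+ k) c ⟩
  ℚᵒ.fromℤ (+ k) ℚ.* ℚᵒ.fromℤ c                     ≡⟨ cong (ℚᵒ.fromℤ (+ k) ℚ.*_) eq ⟩
  ℚᵒ.fromℤ (+ k) ℚ.* (ℚᵒ.fromℤ (+ m) ℚ.* r)         ≡⟨ ℚ.*-assoc (ℚᵒ.fromℤ (+ k)) _ r ⟨
  ℚᵒ.fromℤ (+ k) ℚ.* ℚᵒ.fromℤ (+ m) ℚ.* r           ≡⟨ cong (ℚ._* r) (ℚΣ.fromℤ-* (+ k) (+ m)) ⟨
  ℚᵒ.fromℤ (+ k ℤ.* + m) ℚ.* r                      ≡⟨ cong (λ z → ℚᵒ.fromℤ z ℚ.* r) (ℤ.pos-* k m) ⟨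
  ℚᵒ.fromℤ (+ (k ℕ.* m)) ℚ.* r                      ∎)
  where open ≡.≡-Reasoning

clear-denominators : ∀ {n l} (w : Fin n → Vec ℚ l) →
  ∃[ m ] ℕ.NonZero m × ∀ j k → Clears m (lookup (w j) k)
clear-denominators w = common-multiple (λ j m → ∀ k → Clears m (lookup (w j) k))
  (λ j m q k → Clears-* m (q k))
  (λ j → common-multiple (λ k m → Clears m (lookup (w j) k)) (λ k m → Clears-* m)
    λ k → ℚ.↧ₙ lookup (w j) k , _ , ℚ.↥ lookup (w j) k , ≡.sym (clear-denominator (lookup (w j) k)))

-- Frames

pair : ∀ {l} → Vec ℤ l → (Fin l → ℤ) → ℤ
pair {l} a v = ℤᵒ.sumOver (allFin l) λ k → lookup a k ℤ.* v k

dot-basis : ∀ {l} (φ : Vec ℚ l) k → Kernel.dot φ (ℚΣ.basis k) ≡ lookup φ k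
dot-basis φ k = ≡.trans (dot-comm φ (ℚΣ.basis k))
  (≡.trans (ℚΣ.dot-sum (ℚΣ.basis k) φ) (ℚΣ.sum-basis k (lookup φ)))

module Expansion {n l} (α : Fin n → Vec ℤ l) where
  open Duals α
  open Dual

  comb : List (Fin n) → (Fin n → ℚ) → (Fin n → Vec ℚ l) → Vec ℚ l
  comb []       a w = 𝟘
  comb (j ∷ js) a w = a j ⊙ w j ⊕ comb js a w

  dot-comb : ∀ ψ js a w → Kernel.dot ψ (comb js a w) ≡ ℚᵒ.sumOver js λ j →
    a j ℚ.* Kernel.dot ψ (w j)
  dot-comb ψ []       a w = dot-𝟘 ψ
  dot-comb ψ (j ∷ js) a w =
    ≡.trans (dot-lin ψ (a j) (w j) _) (cong (a j ℚ.* Kernel.dot ψ (w j) ℚ.+_) (dot-comb ψ js a w))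

  -- v and Σ form j v · w j differ by an element of ⋂ I.
  expand : ∀ {I w} → Dual I w → ∀ ψ → (∀ {v} → ⋂ α I v → Kernel.dot ψ v ≡ 0ℚ) → ∀ v →
           Kernel.dot ψ v ≡ ℚᵒ.sumOver (members α I) λ i → form i v ℚ.* Kernel.dot ψ (w i)
  expand {I} {w} D ψ vanish v = begin
    Kernel.dot ψ v                                  ≡⟨ ℚ.+-identityˡ _ ⟨
    0ℚ ℚ.+ Kernel.dot ψ v                           ≡⟨ cong (ℚ._+ Kernel.dot ψ v) (ℚ.+-inverseʳ s) ⟨
    (s ℚ.+ ℚ.- s) ℚ.+ Kernel.dot ψ v                ≡⟨ ℚ.+-assoc s _ _ ⟩
    s ℚ.+ (ℚ.- s ℚ.+ Kernel.dot ψ v)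
      ≡⟨ cong (λ z → s ℚ.+ (z ℚ.+ Kernel.dot ψ v)) (neg s) ⟩
    s ℚ.+ ((ℚ.- 1ℚ) ℚ.* s ℚ.+ Kernel.dot ψ v)       ≡⟨ cong (s ℚ.+_) (dot-lin ψ (ℚ.- 1ℚ) c v) ⟨
    s ℚ.+ Kernel.dot ψ ((ℚ.- 1ℚ) ⊙ c ⊕ v)           ≡⟨ cong (s ℚ.+_) (vanish residue) ⟩
    s ℚ.+ 0ℚ                                        ≡⟨ ℚ.+-identityʳ s ⟩
    s                                               ≡⟨ dot-comb ψ (members α I) (λ i → form i v) w ⟩
    ℚᵒ.sumOver (members α I) (λ i → form i v ℚ.* Kernel.dot ψ (w i))  ∎
    where
    open ≡.≡-Reasoning
    c = comb (members α I) (λ i → form i v) w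
    s = Kernel.dot ψ c
    neg : ∀ x → ℚ.- x ≡ (ℚ.- 1ℚ) ℚ.* x
    neg x = ≡.trans (cong ℚ.-_ (≡.sym (ℚ.*-identityˡ x))) (ℚ.neg-distribˡ-* 1ℚ x)
    residue : ⋂ α I ((ℚ.- 1ℚ) ⊙ c ⊕ v)
    residue {i} i∈ = begin
      form i ((ℚ.- 1ℚ) ⊙ c ⊕ v)                     ≡⟨ dot-lin (φ i) (ℚ.- 1ℚ) c v ⟩
      (ℚ.- 1ℚ) ℚ.* form i c ℚ.+ form i v            ≡⟨ cong (ℚ._+ form i v) (neg (form i c)) ⟨
      ℚ.- form i c ℚ.+ form i v                     ≡⟨ cong (λ z → ℚ.- z ℚ.+ form i v) c≡ ⟩
      ℚ.- form i v ℚ.+ form i v                     ≡⟨ ℚ.+-inverseˡ (form i v) ⟩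
      0ℚ                                            ∎
      where
      c≡ : form i c ≡ form i v
      c≡ = begin
        form i c                       ≡⟨ dot-comb (φ i) (members α I) (λ i → form i v) w ⟩
        ℚᵒ.sumOver (members α I) f
          ≡⟨ ℚΣ.sum-single (members-unique I) (∈-members⁺ i∈) f (λ {j} j∈ j≢i →
            ≡.trans (cong (form j v ℚ.*_) (offDiagonal D i∈ (∈-members⁻ j∈) (j≢i ∘ ≡.sym)))
              (ℚ.*-zeroʳ (form j v))) ⟩
        form i v ℚ.* form i (w i)      ≡⟨ cong (form i v ℚ.*_) (diagonal D i∈) ⟩
        form i v ℚ.* 1ℚ                ≡⟨ ℚ.*-identityʳ (form i v) ⟩
        form i v                       ∎
        where
        f : Fin n → ℚ
        f j = form j v ℚ.* form i (w j)

  -- Integral multiples of the dual vectors. The scale is a field because the descent at `p`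
  -- replaces it by a proper divisor, and `scaled` is restricted to `J` because divisibility by `p`
  -- is established only there.
  record ScaledDual (J : Subset n) (w : Fin n → Vec ℚ l) : Set where
    field
      scale   : ℕ
      nonzero : ℕ.NonZero scale
      vector  : Fin n → Fin l → ℤ
      scaled  : ∀ {j} → j ∈ₛ J → ∀ k → ℚᵒ.fromℤ (vector j k) ≡ ℚᵒ.fromℤ (+ scale) ℚ.* lookup (w j) k

  scaledDual : ∀ J w → ScaledDual J w
  scaledDual J w with clear-denominators w
  ... | m , nz , q = record
    { scale = m ; nonzero = nz ; vector = λ j k → proj₁ (q j k) ; scaled = λ _ k → proj₂ (q _ k) }

  module _ {J w} (C : ScaledDual J w) where
    open ScaledDual C

    pair-scaled : ∀ a {j} → j ∈ₛ J →
                  ℚᵒ.fromℤ (pair a (vector j)) ≡ ℚᵒ.fromℤ (+ scale) ℚ.* ℚᵒ.⟪ a , w j ⟫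
    pair-scaled a {j} j∈ = begin
      ℚᵒ.fromℤ (pair a (vector j))
        ≡⟨ ℚΣ.fromℤ-sum (allFin l) (λ k → lookup a k ℤ.* vector j k) ⟩
      ℚᵒ.sumOver (allFin l) (λ k → ℚᵒ.fromℤ (lookup a k ℤ.* vector j k))
        ≡⟨ ℚΣ.sum-cong (allFin l) step ⟩
      ℚᵒ.sumOver (allFin l) (λ k → M ℚ.* (ℚᵒ.fromℤ (lookup a k) ℚ.* lookup (w j) k))
        ≡⟨ ℚΣ.sum-*ˡ (allFin l) M _ ⟩
      M ℚ.* ℚᵒ.sumOver (allFin l) (λ k → ℚᵒ.fromℤ (lookup a k) ℚ.* lookup (w j) k)
        ≡⟨ cong (M ℚ.*_) (ℚΣ.⟪⟫-sum a (w j)) ⟨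
      M ℚ.* ℚᵒ.⟪ a , w j ⟫                                                                ∎
      where
      open ≡.≡-Reasoning
      M = ℚᵒ.fromℤ (+ scale)
      step : ∀ k → ℚᵒ.fromℤ (lookup a k ℤ.* vector j k) ≡ M ℚ.*
        (ℚᵒ.fromℤ (lookup a k) ℚ.* lookup (w j) k)
      step k = begin
        ℚᵒ.fromℤ (lookup a k ℤ.* vector j k)                ≡⟨ ℚΣ.fromℤ-* (lookup a k) _ ⟩
        A ℚ.* ℚᵒ.fromℤ (vector j k)                         ≡⟨ cong (A ℚ.*_) (scaled j∈ k) ⟩
        A ℚ.* (M ℚ.* lookup (w j) k)                        ≡⟨ ℚ.*-assoc A M _ ⟨
        A ℚ.* M ℚ.* lookup (w j) k
          ≡⟨ cong (ℚ._* lookup (w j) k) (ℚ.*-comm A M) ⟩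
        M ℚ.* A ℚ.* lookup (w j) k                          ≡⟨ ℚ.*-assoc M A _ ⟩
        M ℚ.* (A ℚ.* lookup (w j) k)                        ∎
        where A = ℚᵒ.fromℤ (lookup a k)

    pair-diagonal : Dual J w → ∀ {i} → i ∈ₛ J → pair (α i) (vector i) ≡ + scale
    pair-diagonal D {i} i∈ = fromℤ-injective (≡.trans (pair-scaled (α i) i∈)
      (≡.trans (cong (ℚᵒ.fromℤ (+ scale) ℚ.*_) (diagonal D i∈)) (ℚ.*-identityʳ _)))

    pair-offDiagonal : Dual J w → ∀ {i j} → i ∈ₛ J → j ∈ₛ J → i ≢ j → pair (α i) (vector j) ≡ 0ℤ
    pair-offDiagonal D {i} i∈ j∈ i≢j = fromℤ-injective (≡.trans (pair-scaled (α i) j∈)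
      (≡.trans (cong (ℚᵒ.fromℤ (+ scale) ℚ.*_) (offDiagonal D i∈ j∈ i≢j))
        (ℚ.*-zeroʳ (ℚᵒ.fromℤ (+ scale)))))

    -- The value of `expand` at a unit vector, multiplied by the scale so that all coefficients
    -- become integers. With `I = J` it expands unit covectors during the descent; for a basis of
    -- the forms in `B` it expands those forms.
    scaled-expand : ∀ {I} → I ⊆ J → Dual I w → ∀ a → (∀ {v} → ⋂ α I v → ℚᵒ.⟪ a , v ⟫ ≡ 0ℚ) → ∀ k →
      + scale ℤ.* lookup a k ≡ ℤᵒ.sumOver (members α I) λ i → pair a (vector i) ℤ.* lookup (α i) k
    scaled-expand {I} I⊆J D a vanish k = fromℤ-injective (begin
      ℚᵒ.fromℤ (+ scale ℤ.* lookup a k)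
        ≡⟨ ℚΣ.fromℤ-* (+ scale) _ ⟩
      M ℚ.* ℚᵒ.fromℤ (lookup a k)
        ≡⟨ cong (M ℚ.*_) (form-basis a) ⟨
      M ℚ.* ℚᵒ.⟪ a , ℚΣ.basis k ⟫
        ≡⟨ cong (M ℚ.*_) (expand D (map ℚᵒ.fromℤ a) vanish (ℚΣ.basis k)) ⟩
      M ℚ.* ℚᵒ.sumOver (members α I) f
        ≡⟨ ℚΣ.sum-*ˡ (members α I) M f ⟨
      ℚᵒ.sumOver (members α I) (λ i → M ℚ.* f i)
        ≡⟨ ℚΣ.sum-cong-∈ (members α I) step ⟩
      ℚᵒ.sumOver (members α I) (ℚᵒ.fromℤ ∘ g)
        ≡⟨ ℚΣ.fromℤ-sum (members α I) g ⟨
      ℚᵒ.fromℤ (ℤᵒ.sumOver (members α I) g)                                 ∎)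
      where
      open ≡.≡-Reasoning
      M = ℚᵒ.fromℤ (+ scale)
      f : Fin n → ℚ
      f i = form i (ℚΣ.basis k) ℚ.* ℚᵒ.⟪ a , w i ⟫
      g : Fin n → ℤ
      g i = pair a (vector i) ℤ.* lookup (α i) k
      form-basis : ∀ a → ℚᵒ.⟪ a , ℚΣ.basis k ⟫ ≡ ℚᵒ.fromℤ (lookup a k)
      form-basis a = ≡.trans (dot-basis (map ℚᵒ.fromℤ a) k) (Vec.lookup-map k ℚᵒ.fromℤ a)
      step : ∀ {i} → i ∈ₗ members α I →
             M ℚ.* f i ≡ ℚᵒ.fromℤ (g i)
      step {i} i∈ = begin
        M ℚ.* (form i (ℚΣ.basis k) ℚ.* ℚᵒ.⟪ a , w i ⟫)
          ≡⟨ cong (M ℚ.*_) (ℚ.*-comm (form i (ℚΣ.basis k)) _) ⟩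
        M ℚ.* (ℚᵒ.⟪ a , w i ⟫ ℚ.* form i (ℚΣ.basis k))           ≡⟨ ℚ.*-assoc M _ _ ⟨
        M ℚ.* ℚᵒ.⟪ a , w i ⟫ ℚ.* form i (ℚΣ.basis k)
          ≡⟨ cong₂ ℚ._*_ (pair-scaled a (I⊆J (∈-members⁻ i∈))) (≡.sym (form-basis (α i))) ⟨
        ℚᵒ.fromℤ (pair a (vector i)) ℚ.* ℚᵒ.fromℤ (lookup (α i) k)
          ≡⟨ ℚΣ.fromℤ-* (pair a (vector i)) _ ⟨
        ℚᵒ.fromℤ (pair a (vector i) ℤ.* lookup (α i) k)          ∎

module Frames {n l} (𝒜 : Arrangement l n) where
  open Arrangement 𝒜 using (α; essential)
  open Duals α

  -- The basis that defines `rk α B` is also a basis of the equal intersection `⋂ α I`, where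
  -- `Dual-dim` relates its length to `∣ I ∣`.
  ∣∣≡rk : ∀ {I w} B → Dual I w → ⋂ α B ≐ ⋂ α I → ∣ I ∣ ≡ rk α B
  ∣∣≡rk {I} B D eq = ≡.trans (≡.sym (ℕ.m+n∸n≡m ∣ I ∣ dim))
    (cong (_∸ dim) (Dual-dim D (HasDim-resp-≐ {V = ⋂ α B} {W = ⋂ α I} eq (proj₂ (dim⋂ α B)))))
    where dim = proj₁ (dim⋂ α B)

  rk-⊤ : rk α ⊤ ≡ l
  rk-⊤ = cong (l ∸_) (dim-trivial {V = ⋂ α ⊤} (λ v → proj₁ essential) (proj₂ (dim⋂ α ⊤)))

  -- `∣J∣≡l` and `rk-J` are the two premises of `LuckyFor`. Spanning is stated dually, on zeros: a
  -- form lies in a span when it vanishes on the corresponding intersection.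
  record Frame (B : Subset n) : Set where
    field
      I J     : Subset n
      w       : Fin n → Vec ℚ l
      dual    : Dual J w
      I⊆J     : I ⊆ J
      I⊆B     : I ⊆ B
      spans   : ∀ {b} → b ∈ₛ B → ∀ {v} → ⋂ α I v → H α b v
      spans-J : ∀ {v} → ⋂ α J v → v ≡ 𝟘
      ∣I∣≡rk  : ∣ I ∣ ≡ rk α B
      ∣J∣≡l   : ∣ J ∣ ≡ l
      rk-J    : rk α J ≡ l

  frame : ∀ B → Frame B
  frame B = record
    { I = E.subset ; J = F.subset ; w = F.vectors ; dual = F.dual
    ; I⊆J = F.extends
    ; I⊆B = I⊆B
    ; spans = spans
    ; spans-J = spans-J
    ; ∣I∣≡rk = ∣∣≡rk B E.dual ((λ {v} v∈ {i} i∈ → v∈ (I⊆B i∈)) , λ {v} v∈ {i} i∈ → spans i∈ v∈)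
    ; ∣J∣≡l = ≡.trans (∣∣≡rk ⊤ F.dual
        ((λ {v} v∈ {i} i∈ → v∈ ∈⊤) , λ {v} v∈ {i} i∈ → F.spans (∈-allFin _) v∈)) rk-⊤
    ; rk-J = ≡.trans (≡.sym
        (∣∣≡rk F.subset F.dual ((λ {v} v∈ {i} i∈ → v∈ i∈) , λ {v} v∈ {i} i∈ → v∈ i∈)))
        (≡.trans (∣∣≡rk ⊤ F.dual
          ((λ {v} v∈ {i} i∈ → v∈ ∈⊤) , λ {v} v∈ {i} i∈ → F.spans (∈-allFin _) v∈)) rk-⊤)
    }
    where
    module E = Extension (extension (members α B) ⊥ (λ _ → 𝟘) Dual-⊥)
    module F = Extension (extension (allFin n) E.subset E.vectors E.dual)
    I⊆B : E.subset ⊆ B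
    I⊆B i∈ with E.within i∈
    ... | inj₁ i∈⊥ = ⊥-elim (∉⊥ i∈⊥)
    ... | inj₂ i∈B = ∈-members⁻ i∈B
    spans : ∀ {b} → b ∈ₛ B → ∀ {v} → ⋂ α E.subset v → H α b v
    spans b∈ = E.spans (∈-members⁺ b∈)
    spans-J : ∀ {v} → ⋂ α F.subset v → v ≡ 𝟘
    spans-J v∈ = proj₁ essential (λ {i} _ → F.spans (∈-allFin i) v∈)

-- Monomials and the commutative ring of integer polynomials

infixl 6 _∙_
_∙_ : Monomial n → Monomial n → Monomial n
_∙_ = zipWith ℕ._+_

∙-comm : (m m′ : Monomial n) → m ∙ m′ ≡ m′ ∙ m
∙-comm = Vec.zipWith-comm ℕ.+-comm

∙-assoc : (m m′ m″ : Monomial n) → (m ∙ m′) ∙ m″ ≡ m ∙ (m′ ∙ m″)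
∙-assoc = Vec.zipWith-assoc ℕ.+-assoc

∙-cancelˡ : (m {m′ m″} : Monomial n) → m ∙ m′ ≡ m ∙ m″ → m′ ≡ m″
∙-cancelˡ []      {[]}    {[]}    eq = ≡.refl
∙-cancelˡ (x ∷ m) {y ∷ _} {z ∷ _} eq =
  cong₂ _∷_ (ℕ.+-cancelˡ-≡ x y z (Vec.∷-injectiveˡ eq)) (∙-cancelˡ m (Vec.∷-injectiveʳ eq))

divides? : ∀ (m e : Monomial n) → Dec (∃[ m′ ] m ∙ m′ ≡ e)
divides? []      []      = yes ([] , ≡.refl)
divides? (x ∷ m) (y ∷ e) with x ℕ.≤? y | divides? m e
... | yes x≤y | yes (m′ , eq) = yes (y ℕ.∸ x ∷ m′ , cong₂ _∷_ (ℕ.m+[n∸m]≡n x≤y) eq)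
... | no x≰y  | _     =
  no λ where (z ∷ _ , eq) → x≰y (subst (x ℕ.≤_) (Vec.∷-injectiveˡ eq) (ℕ.m≤m+n x z))
... | yes _   | no ne = no λ where (_ ∷ m′ , eq) → ne (m′ , Vec.∷-injectiveʳ eq)

-- What the term with coefficient `a` and monomial `m` contributes to the coefficient at `e`; it is
-- the summand in the definition of `coeff`.
δ : ℤ → Monomial n → Monomial n → ℤ
δ a m e = if does (m ≟ₘ e) then a else 0ℤ

δ-yes : ∀ a {m e : Monomial n} → m ≡ e → δ a m e ≡ a
δ-yes a {m} {e} eq with m ≟ₘ e
... | yes _ = ≡.refl
... | no ne = ⊥-elim (ne eq)

δ-no : ∀ a {m e : Monomial n} → m ≢ e → δ a m e ≡ 0ℤ
δ-no a {m} {e} ne with m ≟ₘ e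
... | yes eq = ⊥-elim (ne eq)
... | no _   = ≡.refl

δ-*ˡ : ∀ b a (m e : Monomial n) → δ (b ℤ.* a) m e ≡ b ℤ.* δ a m e
δ-*ˡ b a m e with does (m ≟ₘ e)
... | true  = ≡.refl
... | false = ≡.sym (ℤ.*-zeroʳ b)

δ-*ʳ : ∀ b a (m e : Monomial n) → δ (b ℤ.* a) m e ≡ δ b m e ℤ.* a
δ-*ʳ b a m e with does (m ≟ₘ e)
... | true  = ≡.refl
... | false = ≡.sym (ℤ.*-zeroˡ a)

coeff-sum : ∀ (f : Poly n) e → coeff f e ≡ ℤᵒ.sumOver f λ (a , m) → δ a m e
coeff-sum []            e = ≡.refl
coeff-sum ((a , m) ∷ f) e = cong (λ z → δ a m e ℤ.+ z) (coeff-sum f e)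

module _ {n : ℕ} where
  open RawRing (polyRing n) using (_*_; -_)

  coeff-++ : ∀ (f g : Poly n) e → coeff (f ++ g) e ≡ coeff f e ℤ.+ coeff g e
  coeff-++ []            g e = ≡.sym (ℤ.+-identityˡ _)
  coeff-++ ((a , m) ∷ f) g e =
    ≡.trans (cong (λ z → δ a m e ℤ.+ z) (coeff-++ f g e)) (≡.sym (ℤ.+-assoc (δ a m e) _ _))

  coeff-neg : ∀ (f : Poly n) e → coeff (- f) e ≡ ℤ.- coeff f e
  coeff-neg []            e = ≡.refl
  coeff-neg ((a , m) ∷ f) e = ≡.trans (cong₂ ℤ._+_ (neg-δ a m) (coeff-neg f e))
    (≡.sym (ℤ.neg-distrib-+ (δ a m e) (coeff f e)))
    where
    neg-δ : ∀ a m → δ (ℤ.- a) m e ≡ ℤ.- δ a m e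
    neg-δ a m with does (m ≟ₘ e)
    ... | true  = ≡.refl
    ... | false = ≡.refl

  -- The coefficient at e of x^m · g.
  shifted : Monomial n → Poly n → Monomial n → ℤ
  shifted m g e = ℤᵒ.sumOver g λ (b , m′) → δ b (m ∙ m′) e

  coeff-* : ∀ (f g : Poly n) e → coeff (f * g) e ≡ ℤᵒ.sumOver f λ (a , m) → a ℤ.* shifted m g e
  coeff-* []            g e = ≡.refl
  coeff-* ((a , m) ∷ f) g e = ≡.trans (coeff-++ (List.map _ g) (f * g) e)
    (cong₂ ℤ._+_ (head g) (coeff-* f g e))
    where
    head : ∀ g → coeff (List.map (λ (b , m′) → a ℤ.* b , m ∙ m′) g) e ≡ a ℤ.* shifted m g e
    head []             = ≡.sym (ℤ.*-zeroʳ a)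
    head ((b , m′) ∷ g) = ≡.trans (cong₂ ℤ._+_ (δ-*ˡ a b (m ∙ m′) e) (head g))
      (≡.sym (ℤ.*-distribˡ-+ a (δ b (m ∙ m′) e) (shifted m g e)))

  -- This is why multiplication respects `≈ₚ` although polynomials are unnormalised lists:
  -- multiplying by the monomial `m` moves the coefficient at `m₀` to `m ∙ m₀`, by cancellation, and
  -- leaves zero at every `e` that `m` does not divide.
  shifted-cong : ∀ m {f g : Poly n} → f ≈ₚ g → ∀ e → shifted m f e ≡ shifted m g e
  shifted-cong m {f} {g} f≈g e with divides? m e
  ... | no ∤e = ≡.trans (none f) (≡.sym (none g))
    where
    none : ∀ f → shifted m f e ≡ 0ℤ
    none f = ℤΣ.sum-zero f λ {(b , m′)} _ → δ-no b λ eq → ∤e (m′ , eq)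
  ... | yes (m₀ , ≡.refl) = ≡.trans (at f) (≡.trans (f≈g m₀) (≡.sym (at g)))
    where
    step : ∀ b m′ → δ b (m ∙ m′) (m ∙ m₀) ≡ δ b m′ m₀
    step b m′ with m′ ≟ₘ m₀
    ... | yes ≡.refl = δ-yes b {m ∙ m₀} ≡.refl
    ... | no ne    = δ-no b (λ eq → ne (∙-cancelˡ m eq))
    at : ∀ f → shifted m f (m ∙ m₀) ≡ coeff f m₀
    at f = ≡.trans (ℤΣ.sum-cong f λ (b , m′) → step b m′) (≡.sym (coeff-sum f m₀))

  *ₚ-congˡ : ∀ (f : Poly n) {g h} → g ≈ₚ h → f * g ≈ₚ f * h
  *ₚ-congˡ f {g} {h} g≈h e = ≡.trans (coeff-* f g e)
    (≡.trans (ℤΣ.sum-cong f λ (a , m) → cong (a ℤ.*_) (shifted-cong m {g} {h} g≈h e))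
      (≡.sym (coeff-* f h e)))

  *ₚ-comm : ∀ (f g : Poly n) → f * g ≈ₚ g * f
  *ₚ-comm f g e = begin
    coeff (f * g) e
      ≡⟨ double f g ⟩
    ℤᵒ.sumOver f (λ (a , m) → ℤᵒ.sumOver g λ (b , m′) → δ (a ℤ.* b) (m ∙ m′) e)
      ≡⟨ ℤΣ.sum-swap f g (λ (a , m) (b , m′) → δ (a ℤ.* b) (m ∙ m′) e) ⟩
    ℤᵒ.sumOver g (λ (b , m′) → ℤᵒ.sumOver f λ (a , m) → δ (a ℤ.* b) (m ∙ m′) e)
      ≡⟨ ℤΣ.sum-cong g (λ (b , m′) → ℤΣ.sum-cong f λ (a , m) →
        cong₂ (λ c k → δ c k e) (ℤ.*-comm a b) (∙-comm m m′)) ⟩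
    ℤᵒ.sumOver g (λ (b , m′) → ℤᵒ.sumOver f λ (a , m) → δ (b ℤ.* a) (m′ ∙ m) e)
      ≡⟨ double g f ⟨
    coeff (g * f) e                                                                     ∎
    where
    open ≡.≡-Reasoning
    double : ∀ f g → coeff (f * g) e ≡ ℤᵒ.sumOver f
      (λ (a , m) → ℤᵒ.sumOver g λ (b , m′) → δ (a ℤ.* b) (m ∙ m′) e)
    double f g = ≡.trans (coeff-* f g e) (ℤΣ.sum-cong f λ (a , m) →
      ≡.trans (≡.sym (ℤΣ.sum-*ˡ g a λ (b , m′) → δ b (m ∙ m′) e))
        (ℤΣ.sum-cong g λ (b , m′) → ≡.sym (δ-*ˡ a b (m ∙ m′) e)))

  -- Distributivity on this side, associativity and the left unit law hold on the nose for lists of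
  -- terms; `*ₚ-comm` reorders terms and holds only for coefficients.
  *ₚ-distribʳ : ∀ (f g h : Poly n) → (g ++ h) * f ≡ g * f ++ h * f
  *ₚ-distribʳ f g h = List.cartesianProductWith-distribʳ-++ _ g h f

  *ₚ-assoc : ∀ (f g h : Poly n) → (f * g) * h ≡ f * (g * h)
  *ₚ-assoc []            g h = ≡.refl
  *ₚ-assoc ((a , m) ∷ f) g h = ≡.trans (*ₚ-distribʳ h (List.map t g) (f * g))
    (cong₂ _++_ (term-* g) (*ₚ-assoc f g h))
    where
    t : ℤ × Monomial n → ℤ × Monomial n
    t (b , m′) = a ℤ.* b , m ∙ m′
    term-* : ∀ g → List.map t g * h ≡ List.map t (g * h)
    term-* []             = ≡.refl
    term-* ((b , m′) ∷ g) = ≡.trans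
      (cong₂ _++_ (≡.trans
        (List.map-cong (λ (c , m″) → cong₂ _,_ (ℤ.*-assoc a b c) (∙-assoc m m′ m″)) h)
          (List.map-∘ h)) (term-* g))
      (≡.sym (List.map-++ t (List.map _ h) (g * h)))

  *ₚ-identityˡ : ∀ (f : Poly n) → const 1ℤ * f ≡ f
  *ₚ-identityˡ f = ≡.trans (List.++-identityʳ _)
    (≡.trans (List.map-cong
      (λ (a , m) → cong₂ _,_ (ℤ.*-identityˡ a) (Vec.zipWith-identityˡ ℕ.+-identityˡ m)) f)
        (List.map-id f))

  ≈ₚ-trans : ∀ {f g h : Poly n} → f ≈ₚ g → g ≈ₚ h → f ≈ₚ h
  ≈ₚ-trans p q e = ≡.trans (p e) (q e)

  ≈ₚ-reflexive : ∀ {f g : Poly n} → f ≡ g → f ≈ₚ g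
  ≈ₚ-reflexive ≡.refl e = ≡.refl

polyCommutativeRing : ℕ → CommutativeRing 0ℓ 0ℓ
polyCommutativeRing n = record
  { Carrier = Carrier ; _≈_ = _≈_ ; _+_ = _+_ ; _*_ = _*_ ; -_ = -_ ; 0# = 0# ; 1# = 1#
  ; isCommutativeRing = record
    { isRing = record
      { +-isAbelianGroup = record
        { isGroup = record
          { isMonoid = record
            { isSemigroup = record
              { isMagma = record
                { isEquivalence = record
                  { refl  = λ _ → ≡.refl
                  ; sym   = λ p e → ≡.sym (p e)
                  ; trans = λ {f} {g} {h} → ≈ₚ-trans {f = f} {g} {h}
                  }
                ; ∙-cong = λ {f} {g} {h} {k} p q e →
                    ≡.trans (coeff-++ f h e)
                      (≡.trans (cong₂ ℤ._+_ (p e) (q e)) (≡.sym (coeff-++ g k e)))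
                }
              ; assoc = λ f g h → ≈ₚ-reflexive (List.++-assoc f g h)
              }
            ; identity = (λ f e → ≡.refl) , λ f → ≈ₚ-reflexive (List.++-identityʳ f)
            }
          ; inverse = (λ f e → ≡.trans (coeff-++ (- f) f e)
              (≡.trans (cong (ℤ._+ coeff f e) (coeff-neg f e)) (ℤ.+-inverseˡ (coeff f e))))
                    , (λ f e → ≡.trans (coeff-++ f (- f) e)
                      (≡.trans (cong (λ z → coeff f e ℤ.+ z) (coeff-neg f e))
                        (ℤ.+-inverseʳ (coeff f e))))
          ; ⁻¹-cong = λ {f} {g} p e →
              ≡.trans (coeff-neg f e) (≡.trans (cong ℤ.-_ (p e)) (≡.sym (coeff-neg g e)))
          }
        ; comm = +-comm
        }
      ; *-cong = λ {f} {g} {h} {k} p q →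
          ≈ₚ-trans {f = f * h} {f * k} {g * k} (*ₚ-congˡ f {h} {k} q)
            (≈ₚ-trans {f = f * k} {k * f} {g * k} (*ₚ-comm f k)
          (≈ₚ-trans {f = k * f} {k * g} {g * k} (*ₚ-congˡ k {f} {g} p) (*ₚ-comm k g)))
      ; *-assoc = λ f g h → ≈ₚ-reflexive (*ₚ-assoc f g h)
      ; *-identity = (λ f → ≈ₚ-reflexive (*ₚ-identityˡ f))
                   , λ f → ≈ₚ-trans {f = f * 1#} {1# * f} {f} (*ₚ-comm f 1#)
                     (≈ₚ-reflexive (*ₚ-identityˡ f))
      ; distrib = distribˡ , λ f g h → ≈ₚ-reflexive (*ₚ-distribʳ f g h)
      }
    ; *-comm = *ₚ-comm
    }
  }
  where
  open RawRing (polyRing n)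
  +-comm : ∀ f g → f + g ≈ g + f
  +-comm f g e =
    ≡.trans (coeff-++ f g e) (≡.trans (ℤ.+-comm (coeff f e) _) (≡.sym (coeff-++ g f e)))
  distribˡ : ∀ f g h → f * (g + h) ≈ f * g + f * h
  distribˡ f g h e = begin
    coeff (f * (g ++ h)) e                    ≡⟨ *ₚ-comm f (g ++ h) e ⟩
    coeff ((g ++ h) * f) e                    ≡⟨ ≈ₚ-reflexive (*ₚ-distribʳ f g h) e ⟩
    coeff (g * f ++ h * f) e                  ≡⟨ coeff-++ (g * f) (h * f) e ⟩
    coeff (g * f) e ℤ.+ coeff (h * f) e       ≡⟨ cong₂ ℤ._+_ (*ₚ-comm g f e) (*ₚ-comm h f e) ⟩
    coeff (f * g) e ℤ.+ coeff (f * h) e       ≡⟨ coeff-++ (f * g) (f * h) e ⟨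
    coeff (f * g ++ f * h) e                  ∎
    where open ≡.≡-Reasoning

-- Linear forms

0ₘ : Monomial n
0ₘ = replicate _ 0

∙-identityˡ : (m : Monomial n) → 0ₘ ∙ m ≡ m
∙-identityˡ = Vec.zipWith-identityˡ ℕ.+-identityˡ

∙≡0 : (m m′ : Monomial n) → m ∙ m′ ≡ 0ₘ → m ≡ 0ₘ × m′ ≡ 0ₘ
∙≡0 []      []       eq = ≡.refl , ≡.refl
∙≡0 (x ∷ m) (y ∷ m′) eq =
  let x+y≡0 = Vec.∷-injectiveˡ eq ; p , q = ∙≡0 m m′ (Vec.∷-injectiveʳ eq)
  in cong₂ _∷_ (ℕ.m+n≡0⇒m≡0 x x+y≡0) p , cong₂ _∷_ (ℕ.m+n≡0⇒n≡0 x x+y≡0) q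

-- A variable has no proper factors. This serves both for the degree one part of a product and for
-- the leading monomials that divide a variable.
∙≡unit : ∀ (m m′ : Monomial n) k → m ∙ m′ ≡ unit k →
         (m ≡ 0ₘ × m′ ≡ unit k) ⊎ (m ≡ unit k × m′ ≡ 0ₘ)
∙≡unit (zero ∷ m)  (y ∷ m′) zero    eq with ∙≡0 m m′ (Vec.∷-injectiveʳ eq)
... | p , q = inj₁ (cong (0 ∷_) p , cong₂ _∷_ (Vec.∷-injectiveˡ eq) q)
∙≡unit (suc x ∷ m) (y ∷ m′) zero    eq with ∙≡0 m m′ (Vec.∷-injectiveʳ eq) | ℕ.suc-injective
  (Vec.∷-injectiveˡ eq)
... | p , q | x+y≡0 =
  inj₂ (cong₂ _∷_ (cong suc (ℕ.m+n≡0⇒m≡0 x x+y≡0)) p , cong₂ _∷_ (ℕ.m+n≡0⇒n≡0 x x+y≡0) q)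
∙≡unit (x ∷ m)     (y ∷ m′) (suc k) eq with Vec.∷-injectiveˡ eq | ∙≡unit m m′ k
  (Vec.∷-injectiveʳ eq)
... | x+y≡0 | inj₁ (p , q) =
  inj₁ (cong₂ _∷_ (ℕ.m+n≡0⇒m≡0 x x+y≡0) p , cong₂ _∷_ (ℕ.m+n≡0⇒n≡0 x x+y≡0) q)
... | x+y≡0 | inj₂ (p , q) =
  inj₂ (cong₂ _∷_ (ℕ.m+n≡0⇒m≡0 x x+y≡0) p , cong₂ _∷_ (ℕ.m+n≡0⇒n≡0 x x+y≡0) q)

unit≢0 : (k : Fin n) → unit k ≢ 0ₘ
unit≢0 zero    ()
unit≢0 (suc k) eq = unit≢0 k (Vec.∷-injectiveʳ eq)

unit-injective : {i k : Fin n} → unit i ≡ unit k → i ≡ k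
unit-injective {i = zero}  {zero}  eq = ≡.refl
unit-injective {i = zero}  {suc k} ()
unit-injective {i = suc i} {zero}  ()
unit-injective {i = suc i} {suc k} eq = cong suc (unit-injective (Vec.∷-injectiveʳ eq))

sum-toList-tabulate : ∀ {n a} {A : Set a} (f : Fin n → A) F →
                      ℤᵒ.sumOver (Vec.toList (tabulate f)) F ≡ ℤᵒ.sumOver (allFin n) (F ∘ f)
sum-toList-tabulate {zero}  f F = ≡.refl
sum-toList-tabulate {suc n} f F =
  ≡.trans (cong (λ z → F (f zero) ℤ.+ z) (sum-toList-tabulate (f ∘ suc) F))
  (≡.sym (ℤΣ.sum-allFin-suc n (F ∘ f)))

module _ {l : ℕ} where
  open RawRing (polyRing l) using (_*_)

  shifted-linearForm : ∀ m (a : Vec ℤ l) e →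
    shifted m (linearForm a) e ≡ ℤᵒ.sumOver (allFin l) λ i → δ (lookup a i) (m ∙ unit i) e
  shifted-linearForm m a e =
    sum-toList-tabulate (λ i → lookup a i , unit i) (λ (b , m′) → δ b (m ∙ m′) e)

  coeff-*-linearForm-0 : ∀ (h : Poly l) a → coeff (h * linearForm a) 0ₘ ≡ 0ℤ
  coeff-*-linearForm-0 h a = ≡.trans (coeff-* h (linearForm a) 0ₘ) (ℤΣ.sum-zero h λ {(b , m)} _ →
    ≡.trans (cong (b ℤ.*_) (≡.trans (shifted-linearForm m a 0ₘ) (ℤΣ.sum-zero (allFin l) λ {i} _ →
      δ-no (lookup a i) λ eq → unit≢0 i (proj₂ (∙≡0 m (unit i) eq))))) (ℤ.*-zeroʳ b))

  -- A linear form has no constant term, so the degree one part of the product involves only the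
  -- constant term of `h`. Hence the degree one part of an ideal generated by linear forms is their
  -- integral span.
  coeff-*-linearForm-unit : ∀ (h : Poly l) a k →
    coeff (h * linearForm a) (unit k) ≡ coeff h 0ₘ ℤ.* lookup a k
  coeff-*-linearForm-unit h a k = begin
    coeff (h * linearForm a) (unit k)
      ≡⟨ coeff-* h (linearForm a) (unit k) ⟩
    ℤᵒ.sumOver h (λ (b , m) → b ℤ.* shifted m (linearForm a) (unit k))
      ≡⟨ ℤΣ.sum-cong h (λ (b , m) → step b m) ⟩
    ℤᵒ.sumOver h (λ (b , m) → δ b m 0ₘ ℤ.* lookup a k)
      ≡⟨ ℤΣ.sum-*ʳ h (lookup a k) (λ (b , m) → δ b m 0ₘ) ⟩
    ℤᵒ.sumOver h (λ (b , m) → δ b m 0ₘ) ℤ.* lookup a k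
      ≡⟨ cong (ℤ._* lookup a k) (coeff-sum h 0ₘ) ⟨
    coeff h 0ₘ ℤ.* lookup a k                                               ∎
    where
    open ≡.≡-Reasoning
    split : ∀ m i → m ∙ unit i ≡ unit k → m ≡ 0ₘ × i ≡ k
    split m i eq with ∙≡unit m (unit i) k eq
    ... | inj₁ (p , q) = p , unit-injective q
    ... | inj₂ (p , q) = ⊥-elim (unit≢0 i q)
    step : ∀ b m → b ℤ.* shifted m (linearForm a) (unit k) ≡ δ b m 0ₘ ℤ.* lookup a k
    step b m with m ≟ₘ 0ₘ
    ... | yes ≡.refl = cong (b ℤ.*_) (≡.trans (shifted-linearForm 0ₘ a (unit k))
      (≡.trans (ℤΣ.sum-single (Unique.allFin⁺ l) (∈-allFin k)
        (λ i → δ (lookup a i) (0ₘ ∙ unit i) (unit k))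
        (λ {i} _ i≢k → δ-no (lookup a i) λ eq → i≢k (proj₂ (split 0ₘ i eq))))
        (δ-yes (lookup a k) (∙-identityˡ (unit k)))))
    ... | no m≢0 =
      ≡.trans (cong (b ℤ.*_)
        (≡.trans (shifted-linearForm m a (unit k)) (ℤΣ.sum-zero (allFin l) λ {i} _ →
      δ-no (lookup a i) λ eq → m≢0 (proj₁ (split m i eq)))))
        (≡.trans (ℤ.*-zeroʳ b) (≡.sym (ℤ.*-zeroˡ (lookup a k))))

  coeff-const-* : ∀ c (f : Poly l) e → coeff (const c * f) e ≡ c ℤ.* coeff f e
  coeff-const-* c f e = ≡.trans (coeff-* (const c) f e) (≡.trans (ℤ.+-identityʳ _) (cong (c ℤ.*_)
    (≡.trans (ℤΣ.sum-cong f λ (b , m) → cong (λ m → δ b m e) (∙-identityˡ m))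
      (≡.sym (coeff-sum f e)))))

  coeff-linearForm-unit : ∀ (a : Vec ℤ l) k → coeff (linearForm a) (unit k) ≡ lookup a k
  coeff-linearForm-unit a k = begin
    coeff (linearForm a) (unit k)
      ≡⟨ cong (λ f → coeff f (unit k)) (*ₚ-identityˡ (linearForm a)) ⟨
    coeff (const 1ℤ * linearForm a) (unit k)        ≡⟨ coeff-*-linearForm-unit (const 1ℤ) a k ⟩
    coeff {l} (const 1ℤ) 0ₘ ℤ.* lookup a k
      ≡⟨ cong (ℤ._* lookup a k) (cong (ℤ._+ 0ℤ) (δ-yes 1ℤ {0ₘ {l}} ≡.refl)) ⟩
    1ℤ ℤ.* lookup a k                               ≡⟨ ℤ.*-identityˡ _ ⟩
    lookup a k                                      ∎
    where open ≡.≡-Reasoning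

  coeff-linearForm-other : ∀ (a : Vec ℤ l) e → (∀ k → unit k ≢ e) → coeff (linearForm a) e ≡ 0ℤ
  coeff-linearForm-other a e ne = ≡.trans (coeff-sum (linearForm a) e)
    (≡.trans (sum-toList-tabulate (λ i → lookup a i , unit i) (λ (b , m) → δ b m e))
      (ℤΣ.sum-zero (allFin l) λ {i} _ → δ-no (lookup a i) (ne i)))

  linearForm-support : ∀ (a : Vec ℤ l) e → coeff (linearForm a) e ≢ 0ℤ → ∃[ k ] unit k ≡ e
  linearForm-support a e ne with Fin.any? (λ k → unit k ≟ₘ e)
  ... | yes k∈ = k∈
  ... | no k∉  = ⊥-elim (ne (coeff-linearForm-other a e λ k eq → k∉ (k , eq)))

-- Ideals

module _ {l : ℕ} where
  open RawRing (polyRing l)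
  open SemiringDefs rawSemiring using (sum)

  sum-[] : ∀ {m} (t : Fin m → Poly l) → (∀ i → t i ≡ []) → sum t ≡ []
  sum-[] {zero}  t eq = ≡.refl
  sum-[] {suc m} t eq = cong₂ _++_ (eq zero) (sum-[] (t ∘ suc) (eq ∘ suc))

  ∈⇒⟨⟩ : ∀ {gs} {g : Poly l} → g ∈ₗ gs → ⟨ gs ⟩ g
  ∈⇒⟨⟩ {g ∷ gs} (here ≡.refl) =
    (λ { zero → 1# ; (suc _) → 0# }) , λ e → ≡.sym (cong (λ f → coeff f e)
    (≡.trans (cong₂ _++_ (*ₚ-identityˡ g) (sum-[] {length gs} (λ _ → []) λ _ → ≡.refl))
      (List.++-identityʳ g)))
  ∈⇒⟨⟩ {g ∷ gs} (there g∈) with ∈⇒⟨⟩ g∈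
  ... | h , eq = (λ { zero → 0# ; (suc i) → h i }) , eq

module Lattice {n l} (α : Fin n → Vec ℤ l) where
  open RawRing (polyRing l) using (_*_; rawSemiring)
  open SemiringDefs rawSemiring using (sum)

  record Span (js : List (Fin n)) (v : Fin l → ℤ) : Set where
    constructor _,_
    field
      coefficients : Fin n → ℤ
      combination  : ∀ k → v k ≡ ℤᵒ.sumOver js λ j → coefficients j ℤ.* lookup (α j) k

  forms : List (Fin n) → List (Poly l)
  forms = List.map (linearForm ∘ α)

  combine : ∀ js (c : Fin n → ℤ) → Σ (Fin (length (forms js)) → Poly l) λ h → ∀ e →
    coeff (sum λ i → h i * List.lookup (forms js) i) e ≡ ℤᵒ.sumOver js λ j →
      c j ℤ.* coeff (linearForm (α j)) e
  combine []       c = (λ ()) , λ e → ≡.refl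
  combine (j ∷ js) c with combine js c
  ... | h , eq = (λ { zero → const (c j) ; (suc i) → h i }) , λ e →
    ≡.trans (coeff-++ (const (c j) * linearForm (α j)) _ e)
      (cong₂ ℤ._+_ (coeff-const-* (c j) (linearForm (α j)) e) (eq e))

  Span⇒⟨⟩ : ∀ js {v} → Span js v → ⟨ forms js ⟩ (linearForm (tabulate v))
  Span⇒⟨⟩ js {v} (c , v≡) with combine js c
  ... | h , eq = h , λ e → ≡.trans (at e) (≡.sym (eq e))
    where
    at : ∀ e → coeff (linearForm (tabulate v)) e ≡ ℤᵒ.sumOver js λ j →
      c j ℤ.* coeff (linearForm (α j)) e
    at e with Fin.any? (λ k → unit k ≟ₘ e)
    ... | yes (k , ≡.refl) =
      ≡.trans (coeff-linearForm-unit (tabulate v) k) (≡.trans (Vec.lookup∘tabulate v k)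
      (≡.trans (v≡ k) (ℤΣ.sum-cong js λ j →
        cong (c j ℤ.*_) (≡.sym (coeff-linearForm-unit (α j) k)))))
    ... | no k∉ = ≡.trans (coeff-linearForm-other (tabulate v) e (λ k eq → k∉ (k , eq)))
      (≡.sym (ℤΣ.sum-zero js λ {j} _ →
        ≡.trans (cong (c j ℤ.*_) (coeff-linearForm-other (α j) e λ k eq → k∉ (k , eq)))
          (ℤ.*-zeroʳ (c j))))

  ⟨⟩⇒coeff-0≡0 : ∀ js {g} → ⟨ forms js ⟩ g → coeff g 0ₘ ≡ 0ℤ
  ⟨⟩⇒coeff-0≡0 js (h , eq) = ≡.trans (eq 0ₘ) (go js h)
    where
    go : ∀ js (h : Fin (length (forms js)) → Poly l) →
      coeff (sum λ i → h i * List.lookup (forms js) i) 0ₘ ≡ 0ℤ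
    go []       h = ≡.refl
    go (j ∷ js) h = ≡.trans (coeff-++ (h zero * linearForm (α j)) _ 0ₘ)
      (cong₂ ℤ._+_ (coeff-*-linearForm-0 (h zero) (α j)) (go js (h ∘ suc)))

  -- The constant terms of the multipliers are the coefficients. Multipliers belong to positions in
  -- the list and coefficients to indices, so repeated indices are ruled out.
  ⟨⟩⇒Span : ∀ {js} → Unique js → ∀ {g} → ⟨ forms js ⟩ g → Span js (λ k → coeff g (unit k))
  ⟨⟩⇒Span {js} uniq (h , eq) with go uniq h
    where
    go : ∀ {js} → Unique js → (h : Fin (length (forms js)) → Poly l) →
         Span js λ k → coeff (sum λ i → h i * List.lookup (forms js) i) (unit k)
    go []                      h = (λ _ → 0ℤ) , λ k → ≡.refl
    go (_∷_ {j} {js} j∉ uniq) h with go uniq (h ∘ suc)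
    ... | c , eq = c′ , λ k → ≡.trans (coeff-++ (h zero * linearForm (α j)) _ (unit k))
      (cong₂ ℤ._+_
        (≡.trans (coeff-*-linearForm-unit (h zero) (α j) k)
          (cong (ℤ._* lookup (α j) k) (≡.sym c′-new)))
        (≡.trans (eq k) (ℤΣ.sum-cong-∈ js λ {j′} j′∈ →
          cong (ℤ._* lookup (α j′) k) (≡.sym (c′-old j′∈)))))
      where
      c′ : Fin n → ℤ
      c′ j′ = if does (j′ Fin.≟ j) then coeff (h zero) 0ₘ else c j′
      c′-new : c′ j ≡ coeff (h zero) 0ₘ
      c′-new with j Fin.≟ j
      ... | yes _  = ≡.refl
      ... | no j≢j = ⊥-elim (j≢j ≡.refl)
      c′-old : ∀ {j′} → j′ ∈ₗ js → c′ j′ ≡ c j′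
      c′-old {j′} j′∈ with j′ Fin.≟ j
      ... | yes eq = ⊥-elim (All.lookup j∉ j′∈ (≡.sym eq))
      ... | no _   = ≡.refl
  ... | c , eq′ = c , λ k → ≡.trans (eq (unit k)) (eq′ k)

  Span-minus : ∀ {js u v} r → Span js u → Span js v → Span js (λ k → u k ℤ.- r ℤ.* v k)
  Span-minus {js} {u} {v} r (c , u≡) (d , v≡) = (λ j → c j ℤ.- r ℤ.* d j) , λ k → begin
    u k ℤ.- r ℤ.* v k
      ≡⟨ cong₂ (λ x y → x ℤ.- r ℤ.* y) (u≡ k) (v≡ k) ⟩
    ℤᵒ.sumOver js (λ j → c j ℤ.* lookup (α j) k) ℤ.- r ℤ.* ℤᵒ.sumOver js
      (λ j → d j ℤ.* lookup (α j) k)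
      ≡⟨ cong (λ z → ℤᵒ.sumOver js (λ j → c j ℤ.* lookup (α j) k) ℤ.+ z) (ℤ.neg-distribˡ-* r _) ⟩
    ℤᵒ.sumOver js (λ j → c j ℤ.* lookup (α j) k) ℤ.+ (ℤ.- r) ℤ.* ℤᵒ.sumOver js
      (λ j → d j ℤ.* lookup (α j) k)
      ≡⟨ cong (λ z → ℤᵒ.sumOver js (λ j → c j ℤ.* lookup (α j) k) ℤ.+ z) (ℤΣ.sum-*ˡ js (ℤ.- r) _) ⟨
    ℤᵒ.sumOver js (λ j → c j ℤ.* lookup (α j) k) ℤ.+ ℤᵒ.sumOver js
      (λ j → (ℤ.- r) ℤ.* (d j ℤ.* lookup (α j) k))
      ≡⟨ ℤΣ.sum-+ js (λ j → c j ℤ.* lookup (α j) k) (λ j → (ℤ.- r) ℤ.* (d j ℤ.* lookup (α j) k)) ⟨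
    ℤᵒ.sumOver js (λ j → c j ℤ.* lookup (α j) k ℤ.+ (ℤ.- r) ℤ.* (d j ℤ.* lookup (α j) k))
      ≡⟨ ℤΣ.sum-cong js (λ j → lemma (c j) (d j) r (lookup (α j) k)) ⟩
    ℤᵒ.sumOver js (λ j → (c j ℤ.- r ℤ.* d j) ℤ.* lookup (α j) k) ∎
    where
    open ≡.≡-Reasoning
    lemma : ∀ c d r a → c ℤ.* a ℤ.+ (ℤ.- r) ℤ.* (d ℤ.* a) ≡ (c ℤ.- r ℤ.* d) ℤ.* a
    lemma = ℤ.solve-∀

  Span-cong : ∀ {js u v} → (∀ k → u k ≡ v k) → Span js u → Span js v
  Span-cong eq (c , u≡) = c , λ k → ≡.trans (≡.sym (eq k)) (u≡ k)

  Span-zero : ∀ {js v} → (∀ k → v k ≡ 0ℤ) → Span js v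
  Span-zero {js} eq = (λ _ → 0ℤ) , λ k → ≡.trans (eq k) (≡.sym (ℤΣ.sum-zero js λ _ → ≡.refl))

-- Divisibility by a prime

private
  *-cancel-prime : ∀ {p} → Prime p → ∀ {i j} → + p ℤ.* i ≡ + p ℤ.* j → i ≡ j
  *-cancel-prime {p} pp = ℤ.*-cancelˡ-≡ (+ p) _ _ {{prime⇒nonZero pp}}

-- The arithmetic use of luckiness, with a leading coefficient for `c`: `p` divides `s * c` but not
-- `c`, so Euclid's lemma makes it a factor of `s`, where it cancels.
prime-cofactor : ∀ {p} → Prime p → ∀ {c} → ¬ (+ p ∣ℤ c) → ∀ {v s} → + p ℤ.* v ≡ s ℤ.* c →
  ∃[ r ] v ≡ r ℤ.* c
prime-cofactor {p} pp {c} p∤c {v} {s} eq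
  with euclidsLemma ℤ.∣ s ∣ ℤ.∣ c ∣ pp
    (subst (p ∣ₙ_) (ℤ.abs-* s c)
      (∣⇒∣ᵤ (divides {k = + p} v (≡.trans (≡.sym eq) (ℤ.*-comm (+ p) v)))))
  where open import Data.Nat.Divisibility using () renaming (_∣_ to _∣ₙ_)
... | inj₂ p∣c = ⊥-elim (p∤c p∣c)
... | inj₁ p∣s with ∣ᵤ⇒∣ {+ p} {s} p∣s
...   | divides t s≡tp =
  t , *-cancel-prime pp (≡.trans eq (≡.trans (cong (ℤ._* c) s≡tp) (lemma t (+ p) c)))
  where
  lemma : ∀ t p c → t ℤ.* p ℤ.* c ≡ p ℤ.* (t ℤ.* c)
  lemma = ℤ.solve-∀

-- Leading terms

∈-terms : ∀ (f : Poly n) {e} → coeff f e ≢ 0ℤ → e ∈ₗ List.map proj₂ f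
∈-terms []            ne = ⊥-elim (ne ≡.refl)
∈-terms ((a , m) ∷ f) {e} ne with m ≟ₘ e
... | yes ≡.refl = here ≡.refl
... | no _     = there (∈-terms f (ne ∘ ≡.trans (ℤ.+-identityˡ _)))

module LeadingTerms (σ : TermOrdering n) where
  open TermOrdering σ
  open IsTotalOrder isTotalOrder using (antisym)

  ∈-support : ∀ f {e} → coeff f e ≢ 0ℤ → e ∈ₗ support σ f
  ∈-support f ne = ∈-filter⁺ (λ e → ¬? (coeff f e ℤ.≟ 0ℤ)) (∈-terms f ne) ne

  ≤LT : ∀ f {e} → coeff f e ≢ 0ℤ → e ≤ LT σ f
  ≤LT f ne = All.lookup (Extrema.xs≤max totalOrder 0ₘ (support σ f)) (∈-support f ne)

  LT-unique : ∀ f {e} → coeff f e ≢ 0ℤ → (∀ {e′} → coeff f e′ ≢ 0ℤ → e′ ≤ e) → LT σ f ≡ e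
  LT-unique f {e} ne max = antisym
    -- The default value of the maximum is the monomial 1, which `1≤` bounds by `e`.
    (Extrema.max≤v⁺ totalOrder (1≤ e) (All.tabulate λ e′∈ →
      max (proj₂ (∈-filter⁻ (λ e → ¬? (coeff f e ℤ.≟ 0ℤ)) {xs = List.map proj₂ f} e′∈))))
    (≤LT f ne)

-- Lucky primes

module Luck {n l} (α : Fin n → Vec ℤ l) (σ : TermOrdering l) {p} (p-prime : Prime p)
            {js : List (Fin n)} (js-unique : Unique js) where
  open TermOrdering σ
  open IsTotalOrder isTotalOrder using (antisym) renaming (trans to ≤-trans)
  open LeadingTerms σ
  open Lattice α
  open RawRing (polyRing l) using (_*_; *-rawMagma)
  open MagmaDefs *-rawMagma using (_∣_; _,_)

  infix 4 _≺_
  _≺_ : Fin l → Fin l → Set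
  i ≺ k = unit i ≤ unit k × i ≢ k

  -- The order laws of `σ` make this a strict partial order, and on the finite set of variables
  -- every such order is well-founded.
  ≺-wellFounded : WellFounded _≺_
  ≺-wellFounded = spo-wellFounded record
    { isEquivalence = ≡.isEquivalence
    ; irrefl        = λ i≡k (_ , i≢k) → i≢k i≡k
    ; trans         = λ {i} {j} {k} (i≤j , i≢j) (j≤k , j≢k) → ≤-trans i≤j j≤k ,
                        λ { ≡.refl → i≢j (unit-injective (antisym i≤j j≤k)) }
    ; <-resp-≈      = (λ { ≡.refl q → q }) , (λ { ≡.refl q → q })
    }

  leading : (v : Fin l → ℤ) → (∀ k → v k ≡ 0ℤ) ⊎
            (∃[ k ] v k ≢ 0ℤ × ∀ {k′} → v k′ ≢ 0ℤ → unit k′ ≤ unit k)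
  leading v with filter nonzero? (allFin l) in eq
    where
    nonzero? : (k : Fin l) → Dec (v k ≢ 0ℤ)
    nonzero? k = ¬? (v k ℤ.≟ 0ℤ)
  ... | [] = inj₁ λ k → decidable-stable (v k ℤ.≟ 0ℤ) λ ne →
    case (subst (k ∈ₗ_) eq (∈-filter⁺ (λ k → ¬? (v k ℤ.≟ 0ℤ)) (∈-allFin k) ne))
    where
    case : ∀ {k : Fin l} → ¬ (k ∈ₗ [])
    case ()
  ... | x ∷ xs = inj₂ (argmax unit x xs , ne (sel (argmax-sel unit x xs)) , λ {k′} k′≢0 →
    max (subst (k′ ∈ₗ_) eq (∈-filter⁺ (λ k → ¬? (v k ℤ.≟ 0ℤ)) (∈-allFin k′) k′≢0)))
    where
    open Extrema totalOrder using (argmax; argmax-sel; f[xs]≤f[argmax]; f[⊥]≤f[argmax])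
    sel : ∀ {k} → k ≡ x ⊎ k ∈ₗ xs → k ∈ₗ x ∷ xs
    sel (inj₁ eq) = here eq
    sel (inj₂ k∈) = there k∈
    ne : ∀ {k} → k ∈ₗ x ∷ xs → v k ≢ 0ℤ
    ne k∈ = proj₂ (∈-filter⁻ (λ k → ¬? (v k ℤ.≟ 0ℤ)) {xs = allFin l} (subst (_ ∈ₗ_) (≡.sym eq) k∈))
    max : ∀ {k′} → k′ ∈ₗ x ∷ xs → unit k′ ≤ unit (argmax unit x xs)
    max (here ≡.refl) = f[⊥]≤f[argmax] {f = unit} x xs
    max (there k∈)  = All.lookup (f[xs]≤f[argmax] {f = unit} x xs) k∈

  coeff-*-term : ∀ q c (m : Monomial l) e →
    coeff (q * term c m) e ≡ ℤᵒ.sumOver q (λ (b , m′) → δ b (m′ ∙ m) e) ℤ.* c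
  coeff-*-term q c m e = ≡.trans (coeff-* q (term c m) e) (≡.trans
    (ℤΣ.sum-cong q λ (b , m′) → ≡.trans (cong (b ℤ.*_) (ℤ.+-identityʳ _))
      (≡.trans (≡.sym (δ-*ˡ b c (m′ ∙ m) e)) (δ-*ʳ b c (m′ ∙ m) e)))
    (ℤΣ.sum-*ʳ q c λ (b , m′) → δ b (m′ ∙ m) e))

  module _ (lucky : Lucky σ p ⟨ forms js ⟩) where

    private
      G = proj₁ lucky
      gröbner = proj₁ (proj₂ lucky)
      p∤LC : ∀ {g} → g ∈ₗ G → ¬ (+ p ∣ℤ LC σ g)
      p∤LC = proj₂ (proj₂ lucky)
    open IsMinimalStrongGröbner gröbner

    record ReductionStep (v : Fin l → ℤ) (k : Fin l) : Set where
      field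
        u     : Fin l → ℤ
        u∈    : Span js u
        r     : ℤ
        v≡ru  : v k ≡ r ℤ.* u k
        u-max : ∀ {k′} → u k′ ≢ 0ℤ → unit k′ ≤ unit k

    -- The degree one part of a basis element whose leading monomial divides
    -- that of p · v lies in the span, and its leading coefficient divides v k
    -- because it is prime to p.
    reduce : ∀ {v : Fin l → ℤ} {k} → Span js (λ i → + p ℤ.* v i) → v k ≢ 0ℤ →
             (∀ {k′} → v k′ ≢ 0ℤ → unit k′ ≤ unit k) →
             ReductionStep v k
    reduce {v} {k} pv∈ vk≢0 max = finish (strong f (Span⇒⟨⟩ js pv∈) f≉0)
      where
      pv : Fin l → ℤ
      pv i = + p ℤ.* v i
      f = linearForm (tabulate pv)
      coeff-f : ∀ i → coeff f (unit i) ≡ pv i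
      coeff-f i = ≡.trans (coeff-linearForm-unit (tabulate pv) i) (Vec.lookup∘tabulate pv i)
      pvk≢0 : pv k ≢ 0ℤ
      pvk≢0 eq = vk≢0 (*-cancel-prime p-prime (≡.trans eq (≡.sym (ℤ.*-zeroʳ (+ p)))))
      fk≢0 : coeff f (unit k) ≢ 0ℤ
      fk≢0 eq = pvk≢0 (≡.trans (≡.sym (coeff-f k)) eq)
      f≉0 : ¬ f ≈ₚ []
      f≉0 f≈0 = fk≢0 (f≈0 (unit k))
      LT-f : LT σ f ≡ unit k
      LT-f = LT-unique f fk≢0 bound
        where
        bound : ∀ {e} → coeff f e ≢ 0ℤ → e ≤ unit k
        bound {e} ne with linearForm-support (tabulate pv) e ne
        ... | i , ≡.refl =
          max λ vi≡0 → ne (≡.trans (coeff-f i) (≡.trans (cong (+ p ℤ.*_) vi≡0) (ℤ.*-zeroʳ (+ p))))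
      finish : ∃[ g ] g ∈ₗ G × LM σ g ∣ LM σ f → ReductionStep v k
      finish (g , g∈ , (q , eq)) = record
        { u = u ; u∈ = ⟨⟩⇒Span js-unique {g} g∈I ; r = proj₁ quotient ; v≡ru = proj₂ quotient ; u-max = bound }
        where
        g∈I : ⟨ forms js ⟩ g
        g∈I = proj₁ generates {g} (∈⇒⟨⟩ {g = g} g∈)
        u : Fin l → ℤ
        u i = coeff g (unit i)
        -- Comparing coefficients at `unit k` in `q * LM σ g ≈ LM σ f` gives `s * LC σ g = p * v k`.
        -- If `LT σ g` did not divide this variable, `s` would be zero.
        s = ℤᵒ.sumOver q λ (b , m) → δ b (m ∙ LT σ g) (unit k)
        eqₖ : s ℤ.* LC σ g ≡ pv k
        eqₖ = begin
          s ℤ.* LC σ g                                ≡⟨ coeff-*-term q (LC σ g) (LT σ g) (unit k) ⟨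
          coeff (q * LM σ g) (unit k)                 ≡⟨ eq (unit k) ⟩
          δ (LC σ f) (LT σ f) (unit k) ℤ.+ 0ℤ         ≡⟨ ℤ.+-identityʳ _ ⟩
          δ (LC σ f) (LT σ f) (unit k)                ≡⟨ δ-yes (LC σ f) LT-f ⟩
          LC σ f                                      ≡⟨ cong (coeff f) LT-f ⟩
          coeff f (unit k)                            ≡⟨ coeff-f k ⟩
          pv k                                        ∎
          where open ≡.≡-Reasoning
        LT-g : LT σ g ≡ unit k
        LT-g with divides? (LT σ g) (unit k)
        ... | no ∤ = ⊥-elim (pvk≢0 (≡.trans (≡.sym eqₖ) (≡.trans (cong (ℤ._* LC σ g)
          (ℤΣ.sum-zero q λ {(b , m)} _ → δ-no b λ eq → ∤ (m , ≡.trans (∙-comm (LT σ g) m) eq)))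
            (ℤ.*-zeroˡ (LC σ g)))))
        ... | yes (m , eq) with ∙≡unit (LT σ g) m k eq
        ...   | inj₂ (p , _) = p
        ...   | inj₁ (p , _) = ⊥-elim (pvk≢0 (≡.trans (≡.sym eqₖ) (≡.trans
          (cong (s ℤ.*_) (≡.trans (cong (coeff g) p) (⟨⟩⇒coeff-0≡0 js {g} g∈I))) (ℤ.*-zeroʳ s))))
        cofactor : ∃[ r ] v k ≡ r ℤ.* LC σ g
        cofactor = prime-cofactor p-prime (p∤LC {g} g∈) {v k} {s} (≡.sym eqₖ)
        quotient : ∃[ r ] v k ≡ r ℤ.* u k
        quotient = proj₁ cofactor , ≡.trans (proj₂ cofactor)
          (cong (λ e → proj₁ cofactor ℤ.* coeff g e) LT-g)
        bound : ∀ {k′} → u k′ ≢ 0ℤ → unit k′ ≤ unit k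
        bound ne = subst (_ ≤_) LT-g (≤LT g ne)

    saturated : ∀ {v : Fin l → ℤ} → Span js (λ i → + p ℤ.* v i) → Span js v
    saturated {v} pv∈ with leading v
    ... | inj₁ v≡0            = Span-zero v≡0
    ... | inj₂ (k , vk≢0 , max) = go (≺-wellFounded k) pv∈ vk≢0 max
      where
      go : ∀ {k} → Acc _≺_ k → ∀ {v : Fin l → ℤ} → Span js (λ i → + p ℤ.* v i) → v k ≢ 0ℤ →
           (∀ {k′} → v k′ ≢ 0ℤ → unit k′ ≤ unit k) → Span js v
      go {k} (acc rs) {v} pv∈ vk≢0 max with reduce {v} {k} pv∈ vk≢0 max
      -- `v - r * u` lies in the span by recursion, and subtracting `- r` times `u` restores `v`.
      ... | red = Span-cong (λ i → restore (v i) r (u i)) (Span-minus (ℤ.- r) v′∈ u∈)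
        where
        open ReductionStep red
        v′ : Fin l → ℤ
        v′ i = v i ℤ.- r ℤ.* u i
        restore : ∀ x r y → (x ℤ.- r ℤ.* y) ℤ.- (ℤ.- r) ℤ.* y ≡ x
        restore = ℤ.solve-∀
        v′k≡0 : v′ k ≡ 0ℤ
        v′k≡0 = ≡.trans (cong (ℤ._- r ℤ.* u k) v≡ru) (ℤ.+-inverseʳ (r ℤ.* u k))
        distrib : ∀ p x r y → p ℤ.* x ℤ.- (p ℤ.* r) ℤ.* y ≡ p ℤ.* (x ℤ.- r ℤ.* y)
        distrib = ℤ.solve-∀
        pv′∈ : Span js (λ i → + p ℤ.* v′ i)
        pv′∈ = Span-cong (λ i → distrib (+ p) (v i) r (u i)) (Span-minus (+ p ℤ.* r) pv∈ u∈)
        v′-max : ∀ {k′} → v′ k′ ≢ 0ℤ → unit k′ ≤ unit k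
        v′-max {k′} ne with v k′ ℤ.≟ 0ℤ | u k′ ℤ.≟ 0ℤ
        ... | no v≢0  | _       = max v≢0
        ... | yes _   | no u≢0  = u-max u≢0
        ... | yes v≡0 | yes u≡0 = ⊥-elim (ne (≡.trans (cong₂ (λ x y → x ℤ.- r ℤ.* y) v≡0 u≡0)
          (cong (λ z → 0ℤ ℤ.- z) (ℤ.*-zeroʳ r))))
        v′∈ : Span js v′
        v′∈ with leading v′
        ... | inj₁ v′≡0               = Span-zero v′≡0
        ... | inj₂ (k′ , v′k′≢0 , max′) =
          -- The new leading variable is at most the old one, and differs from it because `v′`
          -- vanishes at `k`.
          go (rs (v′-max v′k′≢0 , λ { ≡.refl → v′k′≢0 v′k≡0 })) pv′∈ v′k′≢0 max′

-- Integral dual vectors with a scale prime to `p`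

ℚ-cancelˡ : ∀ a {x y} → a ≢ 0ℚ → a ℚ.* x ≡ a ℚ.* y → x ≡ y
ℚ-cancelˡ a {x} {y} a≢0 eq = ≡.trans (≡.sym (undo x)) (≡.trans (cong (ℚ.1/ a ℚ.*_) eq) (undo y))
  where
  instance _ = ℚ.≢-nonZero a≢0
  undo : ∀ x → ℚ.1/ a ℚ.* (a ℚ.* x) ≡ x
  undo x = ≡.trans (≡.sym (ℚ.*-assoc (ℚ.1/ a) a x))
    (≡.trans (cong (ℚ._* x) (ℚ.*-inverseˡ a)) (ℚ.*-identityˡ x))

module Descent {n l} (𝒜 : Arrangement l n) {σ : TermOrdering l} {p} (p-prime : Prime p)
               (lucky : LuckyFor 𝒜 σ p) {B} (F : Frames.Frame 𝒜 B) where
  open Arrangement 𝒜 using (α)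
  open Duals α
  open Expansion α
  open Lattice α
  open Frames.Frame F

  private
    js = members α J

  J-lucky : Lucky σ p ⟨ forms js ⟩
  J-lucky = lucky J ∣J∣≡l rk-J

  -- Pairing with the scaled dual vector of `i` isolates one coefficient up to the scale: an
  -- integral form of the uniqueness of coordinates.
  pair-combination : (C : ScaledDual J w) → ∀ (c : Fin n → ℤ) {i} → i ∈ₛ J →
    ℤᵒ.sumOver (allFin l)
      (λ k → ℤᵒ.sumOver js (λ j → c j ℤ.* lookup (α j) k) ℤ.* ScaledDual.vector C i k) ≡
    c i ℤ.* + ScaledDual.scale C
  pair-combination C c {i} i∈ = begin
    ℤᵒ.sumOver (allFin l) (λ k → ℤᵒ.sumOver js (λ j → c j ℤ.* lookup (α j) k) ℤ.* vector i k)
      ≡⟨ ℤΣ.sum-cong (allFin l)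
        (λ k → ≡.sym (ℤΣ.sum-*ʳ js (vector i k) (λ j → c j ℤ.* lookup (α j) k))) ⟩
    ℤᵒ.sumOver (allFin l) (λ k → ℤᵒ.sumOver js λ j → c j ℤ.* lookup (α j) k ℤ.* vector i k)
      ≡⟨ ℤΣ.sum-swap (allFin l) js (λ k j → c j ℤ.* lookup (α j) k ℤ.* vector i k) ⟩
    ℤᵒ.sumOver js (λ j → ℤᵒ.sumOver (allFin l) λ k → c j ℤ.* lookup (α j) k ℤ.* vector i k)
      ≡⟨ ℤΣ.sum-cong js (λ j →
        ≡.trans (ℤΣ.sum-cong (allFin l) λ k → ℤ.*-assoc (c j) _ _)
          (ℤΣ.sum-*ˡ (allFin l) (c j) (λ k → lookup (α j) k ℤ.* vector i k))) ⟩
    ℤᵒ.sumOver js (λ j → c j ℤ.* pair (α j) (vector i))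
      ≡⟨ ℤΣ.sum-single (members-unique J) (∈-members⁺ i∈) (λ j → c j ℤ.* pair (α j) (vector i))
           (λ {j} j∈ j≢i → ≡.trans
             (cong (c j ℤ.*_) (pair-offDiagonal C dual (∈-members⁻ j∈) i∈ j≢i)) (ℤ.*-zeroʳ (c j))) ⟩
    c i ℤ.* pair (α i) (vector i)
      ≡⟨ cong (c i ℤ.*_) (pair-diagonal C dual i∈) ⟩
    c i ℤ.* + scale ∎
    where
    open ≡.≡-Reasoning
    open ScaledDual C

  -- Saturation rewrites the combination as `p` times an integral combination with coefficients `d`.
  -- Pairing both with a scaled dual vector gives `c j * m = p * d j * m`, and the nonzero scale `m`
  -- cancels; at this point `p` may still divide `m`.
  independent-mod-p : ∀ (c : Fin n → ℤ) {v : Fin l → ℤ} →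
    (∀ k → + p ℤ.* v k ≡ ℤᵒ.sumOver js λ j → c j ℤ.* lookup (α j) k) →
                      ∀ {j} → j ∈ₛ J → ∃[ d ] c j ≡ + p ℤ.* d
  independent-mod-p c {v} eq {j} j∈
    with Luck.saturated α σ p-prime (members-unique J) J-lucky {v} (c , eq)
  ... | d , v≡ = d j , ℤ.*-cancelʳ-≡ (c j) (+ p ℤ.* d j) (+ scale) {{nonzero}} (begin
    c j ℤ.* + scale
      ≡⟨ pair-combination C c j∈ ⟨
    ℤᵒ.sumOver (allFin l) (λ k → ℤᵒ.sumOver js (λ j → c j ℤ.* lookup (α j) k) ℤ.* vector j k)
      ≡⟨ ℤΣ.sum-cong (allFin l)
        (λ k → cong (ℤ._* vector j k) (≡.trans (≡.sym (eq k)) (≡.trans (cong (+ p ℤ.*_) (v≡ k))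
           (≡.trans (≡.sym (ℤΣ.sum-*ˡ js (+ p) (λ j → d j ℤ.* lookup (α j) k)))
             (ℤΣ.sum-cong js λ j → ≡.sym (ℤ.*-assoc (+ p) (d j) _)))))) ⟩
    ℤᵒ.sumOver (allFin l)
      (λ k → ℤᵒ.sumOver js (λ j → + p ℤ.* d j ℤ.* lookup (α j) k) ℤ.* vector j k)
      ≡⟨ pair-combination C (λ j → + p ℤ.* d j) j∈ ⟩
    + p ℤ.* d j ℤ.* + scale ∎)
    where
    open ≡.≡-Reasoning
    C = scaledDual J w
    open ScaledDual C

  -- Division by `p` strictly decreases a nonzero scale, so the recursion stops at a scale that `p`
  -- does not divide.
  descend : (C : ScaledDual J w) → Acc ℕ._<_ (ScaledDual.scale C) →
            Σ (ScaledDual J w) λ C → ¬ (p ℕ∣.∣ ScaledDual.scale C)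
  descend C (acc rs) with p ℕ∣.∣? ScaledDual.scale C
  ... | no p∤m  = C , p∤m
  ... | yes (ℕ∣.divides m′ m≡m′p) = descend C′ (rs m′<m)
    where
    open ScaledDual C
    instance
      _ = prime⇒nonZero p-prime
      m≢0 : ℕ.NonZero (m′ ℕ.* p)
      m≢0 = subst ℕ.NonZero m≡m′p nonzero
      m′≢0 : ℕ.NonZero m′
      m′≢0 = ℕ.m*n≢0⇒m≢0 m′
    m′<m : m′ ℕ.< scale
    m′<m = subst (m′ ℕ.<_) (≡.sym m≡m′p)
      (ℕ.m<m*n m′ p (ℕ.nonTrivial⇒n>1 p {{prime⇒nonTrivial p-prime}}))
    m≡pm′ : + scale ≡ + p ℤ.* + m′
    m≡pm′ = ≡.trans (cong +_ (≡.trans m≡m′p (ℕ.*-comm m′ p))) (ℤ.pos-* p m′)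
    divided : ∀ {j} → j ∈ₛ J → ∀ k → ∃[ d ] vector j k ≡ + p ℤ.* d
    divided j∈ k =
      independent-mod-p (λ j → vector j k) {λ k′ → + m′ ℤ.* lookup (ℤΣ.basis k) k′} expansion j∈
      where
      -- The scale times the unit covector at `k` is the combination of the forms in `J` whose
      -- coefficients are the entries at `k` of the scaled dual vectors. It exists because `⋂ α J`
      -- is zero, so every covector vanishes there.
      expansion : ∀ k′ → + p ℤ.* (+ m′ ℤ.* lookup (ℤΣ.basis k) k′) ≡ ℤᵒ.sumOver js λ j →
        vector j k ℤ.* lookup (α j) k′
      expansion k′ =
        ≡.trans (≡.sym (ℤ.*-assoc (+ p) (+ m′) _))
          (≡.trans (cong (ℤ._* lookup (ℤΣ.basis k) k′) (≡.sym m≡pm′))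
        (≡.trans (scaled-expand C {I = J} id dual (ℤΣ.basis k)
          (λ v∈ → ≡.trans (cong (λ v → ℚᵒ.⟪ ℤΣ.basis k , v ⟫) (spans-J v∈))
            (Kernel.dot-𝟘 (map ℚᵒ.fromℤ (ℤΣ.basis k)))) k′)
          (ℤΣ.sum-cong js λ j → cong (ℤ._* lookup (α j) k′) (ℤΣ.sum-basis k (vector j)))))
    vector′ : Fin n → Fin l → ℤ
    vector′ j k with j ∈? J
    ... | yes j∈ = proj₁ (divided j∈ k)
    ... | no _   = 0ℤ
    vector≡ : ∀ {j} → j ∈ₛ J → ∀ k → vector j k ≡ + p ℤ.* vector′ j k
    vector≡ {j} j∈ k with j ∈? J
    ... | yes j∈′ = proj₂ (divided j∈′ k)
    ... | no j∉   = ⊥-elim (j∉ j∈)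
    p≢0 : ℚᵒ.fromℤ (+ p) ≢ 0ℚ
    p≢0 eq = ℕ.≢-nonZero⁻¹ p (ℤ.+-injective (fromℤ-injective {+ p} {0ℤ} eq))
    C′ : ScaledDual J w
    C′ = record
      { scale = m′ ; nonzero = m′≢0 ; vector = vector′
      ; scaled = λ {j} j∈ k → ℚ-cancelˡ (ℚᵒ.fromℤ (+ p)) p≢0 (begin
          P ℚ.* ℚᵒ.fromℤ (vector′ j k)                   ≡⟨ ℚΣ.fromℤ-* (+ p) (vector′ j k) ⟨
          ℚᵒ.fromℤ (+ p ℤ.* vector′ j k)                 ≡⟨ cong ℚᵒ.fromℤ (vector≡ j∈ k) ⟨
          ℚᵒ.fromℤ (vector j k)                          ≡⟨ scaled j∈ k ⟩
          ℚᵒ.fromℤ (+ scale) ℚ.* lookup (w j) k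
            ≡⟨ cong (λ z → ℚᵒ.fromℤ z ℚ.* lookup (w j) k) m≡pm′ ⟩
          ℚᵒ.fromℤ (+ p ℤ.* + m′) ℚ.* lookup (w j) k
            ≡⟨ cong (ℚ._* lookup (w j) k) (ℚΣ.fromℤ-* (+ p) (+ m′)) ⟩
          P ℚ.* M ℚ.* lookup (w j) k                     ≡⟨ ℚ.*-assoc P M _ ⟩
          P ℚ.* (M ℚ.* lookup (w j) k)                   ∎)
      }
      where
      open ≡.≡-Reasoning
      P = ℚᵒ.fromℤ (+ p)
      M = ℚᵒ.fromℤ (+ m′)

  reducedDual : Σ (ScaledDual J w) λ C → ¬ (p ℕ∣.∣ ScaledDual.scale C)
  reducedDual = descend (scaledDual J w) (<-wellFounded _)

-- Iverson brackets and inverses modulo a prime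

[_] : ∀ {a} {A : Set a} → Dec A → ℤ
[ d ] = if does d then 1ℤ else 0ℤ

[]-⇔ : ∀ {a b} {A : Set a} {B : Set b} (d : Dec A) (e : Dec B) → (A → B) → (B → A) → [ d ] ≡ [ e ]
[]-⇔ (yes _) (yes _) f g = ≡.refl
[]-⇔ (yes a) (no ¬b) f g = ⊥-elim (¬b (f a))
[]-⇔ (no ¬a) (yes b) f g = ⊥-elim (¬a (g b))
[]-⇔ (no _)  (no _)  f g = ≡.refl

[]-yes : ∀ {a} {A : Set a} (d : Dec A) → A → [ d ] ≡ 1ℤ
[]-yes (yes _) _ = ≡.refl
[]-yes (no ¬a) a = ⊥-elim (¬a a)

[]-no : ∀ {a} {A : Set a} (d : Dec A) → ¬ A → [ d ] ≡ 0ℤ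
[]-no (yes a) ¬a = ⊥-elim (¬a a)
[]-no (no _)  _  = ≡.refl

[]-* : ∀ {a b c} {A : Set a} {B : Set b} {C : Set c} (d : Dec A) (e : Dec B) (f : Dec C) →
       (A → B → C) → (C → A) → (C → B) → [ d ] ℤ.* [ e ] ≡ [ f ]
[]-* (yes a) e f  AB⇒C C⇒A C⇒B = ≡.trans (ℤ.*-identityˡ [ e ]) ([]-⇔ e f (AB⇒C a) C⇒B)
[]-* (no ¬a) e f  AB⇒C C⇒A C⇒B = ≡.trans (ℤ.*-zeroˡ [ e ]) (≡.sym ([]-no f (¬a ∘ C⇒A)))

ℤ-fromℕ : ∀ m → ℤᵒ.fromℤ (+ m) ≡ + m
ℤ-fromℕ zero    = ≡.refl
ℤ-fromℕ (suc m) = cong (λ z → 1ℤ ℤ.+ z) (ℤ-fromℕ m)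

-- Bézout's identity for `p` and `∣ z ∣`, with the sign of `z` absorbed into `u`.
inverse-mod : ∀ {p} → Prime p → ∀ z → ¬ (+ p ∣ℤ z) → ∃[ u ] ∃[ d ] u ℤ.* z ≡ 1ℤ ℤ.+ d ℤ.* + p
inverse-mod {p} p-prime z p∤z with absolute z | natural (coprime-Bézout coprime)
  where
  m = ℤ.∣ z ∣
  coprime : Coprime p m
  coprime (i∣p , i∣m) with prime⇒irreducible p-prime i∣p
  ... | inj₁ i≡1    = i≡1
  ... | inj₂ ≡.refl = ⊥-elim (p∤z i∣m)
  absolute : ∀ z → ∃[ ε ] ε ℤ.* z ≡ + ℤ.∣ z ∣
  absolute (+ m)    = 1ℤ , ℤ.*-identityˡ (+ m)
  absolute -[1+ m ] = ℤ.- 1ℤ , ℤ.-1*i≡-i -[1+ m ]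
  lift : ∀ x y a b → 1 ℕ.+ x ℕ.* a ≡ y ℕ.* b → 1ℤ ℤ.+ + x ℤ.* + a ≡ + y ℤ.* + b
  lift x y a b eq =
    ≡.trans (cong (λ z → 1ℤ ℤ.+ z) (≡.sym (ℤ.pos-* x a))) (≡.trans (cong +_ eq) (ℤ.pos-* y b))
  natural : Bézout.Identity 1 p m → ∃[ u ] ∃[ d ] u ℤ.* + m ≡ 1ℤ ℤ.+ d ℤ.* + p
  natural (Bézout.-+ x y eq) = + y , + x , ≡.sym (lift x y p m eq)
  natural (Bézout.+- x y eq) = ℤ.- + y , ℤ.- + x , ≡.trans (isolate (+ y) (+ m))
    (≡.trans (cong (λ z → 1ℤ ℤ.- z) (lift y x m p eq)) (collect (+ x) (+ p)))
    where
    isolate : ∀ y m → (ℤ.- y) ℤ.* m ≡ 1ℤ ℤ.- (1ℤ ℤ.+ y ℤ.* m)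
    isolate = ℤ.solve-∀
    collect : ∀ x p → 1ℤ ℤ.- x ℤ.* p ≡ 1ℤ ℤ.+ (ℤ.- x) ℤ.* p
    collect = ℤ.solve-∀
... | ε , εz≡m | u , d , um≡ =
  u ℤ.* ε , d , ≡.trans (ℤ.*-assoc u ε z) (≡.trans (cong (u ℤ.*_) εz≡m) um≡)

-- Finite fields and counting over them

module FiniteFields {q c ℓ} (𝔽 : FiniteField q c ℓ) where
  open FiniteField 𝔽 hiding (zero)
  open Over rawRing
  open RingSums commutativeRing
  open Inverse enumeration using (to; from; to-cong; from-cong; strictlyInverseˡ; strictlyInverseʳ)
  open import Relation.Binary.Reasoning.Setoid setoid

  integral : ∀ {x y} → ¬ x ≈ 0# → x * y ≈ 0# → y ≈ 0#
  integral {x} {y} x≉0 xy≈0 with inverse x x≉0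
  ... | x⁻¹ , xx⁻¹≈1 = begin
    y                 ≈⟨ *-identityˡ y ⟨
    1# * y            ≈⟨ *-congʳ xx⁻¹≈1 ⟨
    x * x⁻¹ * y       ≈⟨ *-congʳ (*-comm x x⁻¹) ⟩
    x⁻¹ * x * y       ≈⟨ *-assoc x⁻¹ x y ⟩
    x⁻¹ * (x * y)     ≈⟨ *-congˡ xy≈0 ⟩
    x⁻¹ * 0#          ≈⟨ zeroʳ x⁻¹ ⟩
    0#                ∎

  elements : List Carrier
  elements = List.map to (allFin q)

  -- Adding `a`, transported to a permutation of the indices of the enumeration, where the
  -- invariance of sums under permutations applies.
  translation : Carrier → Perm.Permutation q q
  translation a =
    Perm.permutation (shift a) (shift (- a)) (shift-shift (-‿inverseˡ a))
      (shift-shift (-‿inverseʳ a))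
    where
    shift : Carrier → Fin q → Fin q
    shift b i = from (to i + b)
    shift-shift : ∀ {b b′} → b + b′ ≈ 0# → ∀ i → shift b′ (shift b i) ≡ i
    shift-shift {b} {b′} b+b′≈0 i = ≡.trans (from-cong (begin
      to (shift b i) + b′   ≈⟨ +-congʳ (strictlyInverseˡ _) ⟩
      to i + b + b′         ≈⟨ +-assoc _ _ _ ⟩
      to i + (b + b′)       ≈⟨ +-congˡ b+b′≈0 ⟩
      to i + 0#             ≈⟨ +-identityʳ _ ⟩
      to i                  ∎)) (strictlyInverseʳ i)

  module Translate {t ℓ′} (T : CommutativeRing t ℓ′) where
    private
      module T = CommutativeRing T
      module TΣ = RingSums T
      module Tᵒ = Over T.rawRing
    open import Algebra.Properties.CommutativeMonoid.Sum T.+-commutativeMonoid using (sum; sum-permute; sum-cong-≋)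

    sum-translate : (f : Carrier → T.Carrier) → (∀ {x y} → x ≈ y → f x T.≈ f y) → ∀ a →
                    Tᵒ.sumOver elements (λ x → f (x + a)) T.≈ Tᵒ.sumOver elements f
    sum-translate f f-cong a = T.sym (T.trans (T.reflexive (fin f))
      (T.trans (sum-permute (f ∘ to) (translation a))
      (T.trans (sum-cong-≋ λ i → f-cong (strictlyInverseˡ (to i + a)))
        (T.reflexive (≡.sym (fin λ x → f (x + a)))))))
      where
      fin : ∀ f → Tᵒ.sumOver elements f ≡ sum (f ∘ to)
      fin f = ≡.trans (TΣ.sum-map to (allFin q) f) (TΣ.sum-allFin q (f ∘ to))

  length-elements : length elements ≡ q
  length-elements = ≡.trans (List.length-map to (allFin q)) (List.length-tabulate id)

  -- Translation by 1 permutes the field, so the sum of all elements equals itself plus `q` times 1.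
  q≈0 : fromℤ (+ q) ≈ 0#
  q≈0 = begin
    fromℤ (+ q)                            ≈⟨ *-identityʳ _ ⟨
    fromℤ (+ q) * 1#
      ≡⟨ cong (λ m → fromℤ (+ m) * 1#) (≡.sym length-elements) ⟩
    fromℤ (+ length elements) * 1#         ≈⟨ sum-const elements 1# ⟨
    sumOver elements (λ _ → 1#)            ≈⟨ +-identityʳ-unique (sumOver elements id) _
      (trans (sym (sum-+ elements id λ _ → 1#))
        (Translate.sum-translate commutativeRing id id 1#)) ⟩
    0#                                     ∎
    where open import Algebra.Properties.Ring ring using (+-identityʳ-unique)

  module Characteristic {p} (p-prime : Prime p) {k} (q≡p^k : q ≡ p ℕ.^ k) where

    -- There are no zero divisors, so a factor of the vanishing power is zero; otherwise cancelling
    -- all factors would leave 1 = 0.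
    p≈0 : fromℤ (+ p) ≈ 0#
    p≈0 = go k (trans (reflexive (cong (λ m → fromℤ (+ m)) (≡.sym q≡p^k))) q≈0)
      where
      go : ∀ k → fromℤ (+ (p ℕ.^ k)) ≈ 0# → fromℤ (+ p) ≈ 0#
      go zero    eq = ⊥-elim (1≉0 (trans (sym fromℤ-1) eq))
      go (suc k) eq with fromℤ (+ p) ≟ 0#
      ... | yes p≈0 = p≈0
      ... | no p≉0  = go k (integral p≉0 (trans (sym (fromℤ-* (+ p) (+ (p ℕ.^ k))))
        (trans (reflexive (cong fromℤ (≡.sym (ℤ.pos-* p (p ℕ.^ k))))) eq)))

    -- An integer prime to `p` has an inverse modulo `p`, and `p` is zero in the field, so the image
    -- of such an integer is a unit.
    fromℤ≈0⇒∣ : ∀ z → fromℤ z ≈ 0# → + p ∣ℤ z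
    fromℤ≈0⇒∣ z z≈0 with p ℕ∣.∣? ℤ.∣ z ∣
    ... | yes p∣z = p∣z
    ... | no p∤z with inverse-mod p-prime z p∤z
    ...   | u , d , uz≡1+dp = ⊥-elim (1≉0 (begin
      1#                                            ≈⟨ fromℤ-1 ⟨
      fromℤ 1ℤ                                      ≈⟨ +-identityʳ _ ⟨
      fromℤ 1ℤ + 0#                                 ≈⟨ +-congˡ (zeroʳ (fromℤ d)) ⟨
      fromℤ 1ℤ + fromℤ d * 0#                       ≈⟨ +-congˡ (*-congˡ p≈0) ⟨
      fromℤ 1ℤ + fromℤ d * fromℤ (+ p)              ≈⟨ +-congˡ (fromℤ-* d (+ p)) ⟨
      fromℤ 1ℤ + fromℤ (d ℤ.* + p)                  ≈⟨ fromℤ-+ 1ℤ (d ℤ.* + p) ⟨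
      fromℤ (1ℤ ℤ.+ d ℤ.* + p)                      ≡⟨ cong fromℤ uz≡1+dp ⟨
      fromℤ (u ℤ.* z)                               ≈⟨ fromℤ-* u z ⟩
      fromℤ u * fromℤ z                             ≈⟨ *-congˡ z≈0 ⟩
      fromℤ u * 0#                                  ≈⟨ zeroʳ _ ⟩
      0#                                            ∎))

  -- Points

  infix 4 _≋_
  _≋_ : ∀ {n} → Vec Carrier n → Vec Carrier n → Set _
  _≋_ = Pointwise _≈_

  infixl 6 _⊹_
  _⊹_ : ∀ {n} → Vec Carrier n → Vec Carrier n → Vec Carrier n
  _⊹_ = zipWith _+_

  ≋-refl : ∀ {n} {v : Vec Carrier n} → v ≋ v
  ≋-refl = Pointwise.refl refl

  points-complete : ∀ {n} (v : Vec Carrier n) → ∃[ v′ ] v′ ∈ₗ points n × v′ ≋ v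
  points-complete []      = [] , here ≡.refl , []
  points-complete (x ∷ v) with points-complete v
  ... | v′ , v′∈ , v′≋v = to (from x) ∷ v′ ,
    ∈-cartesianProductWith⁺ _∷_ (∈-map⁺ to (∈-allFin (from x))) v′∈ , strictlyInverseˡ x ∷ v′≋v

  sum-points-translate : ∀ n (f : Vec Carrier n → ℤ) → (∀ {u v} → u ≋ v → f u ≡ f v) → ∀ w →
                         ℤᵒ.sumOver (points n) (λ v → f (v ⊹ w)) ≡ ℤᵒ.sumOver (points n) f
  sum-points-translate zero    f f-cong []      = ≡.refl
  sum-points-translate (suc n) f f-cong (a ∷ w) =
    ≡.trans (ℤΣ.sum-cartesianProductWith _∷_ elements (points n) (λ v → f (v ⊹ (a ∷ w))))
    (≡.trans (ℤΣ.sum-cong elements {g = λ x → ℤᵒ.sumOver (points n) λ v → f (x + a ∷ v)} λ x →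
      sum-points-translate n (λ v → f (x + a ∷ v)) (λ u≋v → f-cong (refl ∷ u≋v)) w)
    (≡.trans (Translate.sum-translate ℤ.+-*-commutativeRing
      (λ x → ℤᵒ.sumOver (points n) λ v → f (x ∷ v))
        (λ x≈y → ℤΣ.sum-cong (points n) λ v → f-cong (x≈y ∷ ≋-refl)) a)
    (≡.sym (ℤΣ.sum-cartesianProductWith _∷_ elements (points n) f))))

  sum-points-1 : ∀ n → ℤᵒ.sumOver (points n) (λ _ → 1ℤ) ≡ + (q ℕ.^ n)
  sum-points-1 zero    = ≡.refl
  sum-points-1 (suc n) = ≡.trans (ℤΣ.sum-cartesianProductWith _∷_ elements (points n) (λ _ → 1ℤ))
    (≡.trans (ℤΣ.sum-cong elements {g = λ _ → + (q ℕ.^ n)} λ _ → sum-points-1 n)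
    (≡.trans (ℤΣ.sum-const elements (+ (q ℕ.^ n)))
    (≡.trans (cong (ℤ._* + (q ℕ.^ n))
      (≡.trans (ℤ-fromℕ (length elements)) (cong +_ length-elements)))
        (≡.sym (ℤ.pos-* q (q ℕ.^ n))))))

  -- Values of integral forms

  ⟪⟫-cong : ∀ {n} (a : Vec ℤ n) {u v} → u ≋ v → ⟪ a , u ⟫ ≈ ⟪ a , v ⟫
  ⟪⟫-cong []      []            = refl
  ⟪⟫-cong (a ∷ as) (x≈y ∷ u≋v) = +-cong (*-congˡ x≈y) (⟪⟫-cong as u≋v)

  ⟪⟫-⊹ : ∀ {n} (a : Vec ℤ n) u v → ⟪ a , u ⊹ v ⟫ ≈ ⟪ a , u ⟫ + ⟪ a , v ⟫
  ⟪⟫-⊹ []       []      []      = sym (+-identityˡ 0#)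
  ⟪⟫-⊹ (a ∷ as) (x ∷ u) (y ∷ v) =
    trans (+-cong (distribˡ _ x y) (⟪⟫-⊹ as u v)) (interchange _ _ _ _)
    where open import Algebra.Properties.CommutativeSemigroup +-commutativeSemigroup using (interchange)

  ⟪⟫-* : ∀ {n} (a : Vec ℤ n) x v → ⟪ a , map (x *_) v ⟫ ≈ x * ⟪ a , v ⟫
  ⟪⟫-* []       x []      = sym (zeroʳ x)
  ⟪⟫-* (a ∷ as) x (y ∷ v) = trans (+-cong (x∙yz≈y∙xz _ x y) (⟪⟫-* as x v)) (sym (distribˡ x _ _))
    where open import Algebra.Properties.CommutativeSemigroup *-commutativeSemigroup using (x∙yz≈y∙xz)

  -- Counting common zeros

  -- Inserting this factor 1 splits a count of points according to the value of a form.
  sum-elements-[≟] : ∀ y → ℤᵒ.sumOver elements (λ x → [ y ≟ x ]) ≡ 1ℤ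
  sum-elements-[≟] y = ≡.trans (ℤΣ.sum-map to (allFin q) (λ x → [ y ≟ x ]))
    (≡.trans (ℤΣ.sum-single (Unique.allFin⁺ q) (∈-allFin (from y)) (λ i → [ y ≟ to i ])
      (λ {i} _ i≢ → []-no (y ≟ to i) λ y≈ →
        i≢ (≡.trans (≡.sym (strictlyInverseʳ i)) (from-cong (sym y≈)))))
      ([]-yes (y ≟ to (from y)) (sym (strictlyInverseˡ y))))

  module Zeros {n l} (α : Fin n → Vec ℤ l) where

    Zero : Vec Carrier l → Fin n → Set ℓ
    Zero P i = ⟪ α i , P ⟫ ≈ 0#

    zero? : ∀ P i → Dec (Zero P i)
    zero? P i = ⟪ α i , P ⟫ ≟ 0#

    zeros? : ∀ js P → Dec (All (Zero P) js)
    zeros? js P = All.all? (zero? P) js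

    #zeros : List (Fin n) → ℤ
    #zeros js = ℤᵒ.sumOver (points l) λ P → [ zeros? js P ]

    -- The common zeros of js are partitioned by the value of α j, and
    -- translating along w shows that all parts are equinumerous.
    #zeros-∷ : ∀ j js w → ⟪ α j , w ⟫ ≈ 1# → (∀ {i} → i ∈ₗ js → ⟪ α i , w ⟫ ≈ 0#) →
               #zeros js ≡ + q ℤ.* #zeros (j ∷ js)
    #zeros-∷ j js w jw≈1 iw≈0 = ≡R.begin
      #zeros js
        ≡R.≡⟨ ℤΣ.sum-cong (points l) {f = z}
          (λ P → ≡.trans (≡.sym (ℤ.*-identityʳ (z P)))
            (≡.trans (cong (z P ℤ.*_) (≡.sym (sum-elements-[≟] ⟪ α j , P ⟫)))
             (≡.sym (ℤΣ.sum-*ˡ elements (z P) (λ x → [ ⟪ α j , P ⟫ ≟ x ]))))) ⟩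
      ℤᵒ.sumOver (points l) (λ P → ℤᵒ.sumOver elements λ x → part x P)
        ≡R.≡⟨ ℤΣ.sum-swap (points l) elements (λ P x → part x P) ⟩
      ℤᵒ.sumOver elements (λ x → ℤᵒ.sumOver (points l) (part x))
        ≡R.≡⟨ ℤΣ.sum-cong elements {f = λ x → ℤᵒ.sumOver (points l) (part x)} {g = λ _ →
          #zeros (j ∷ js)} (λ x →
            ≡.trans (≡.sym (sum-points-translate l (part x) (part-cong x) (map (x *_) w)))
             (ℤΣ.sum-cong (points l) (part-translate x))) ⟩
      ℤᵒ.sumOver elements (λ x → #zeros (j ∷ js))
        ≡R.≡⟨ ≡.trans (ℤΣ.sum-const elements (#zeros (j ∷ js)))
             (cong (ℤ._* #zeros (j ∷ js))
               (≡.trans (ℤ-fromℕ (length elements)) (cong +_ length-elements))) ⟩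
      + q ℤ.* #zeros (j ∷ js) ≡R.∎
      where
      module ≡R = ≡.≡-Reasoning
      z : Vec Carrier l → ℤ
      z P = [ zeros? js P ]
      part : Carrier → Vec Carrier l → ℤ
      part x P = z P ℤ.* [ ⟪ α j , P ⟫ ≟ x ]
      z-cong : ∀ {P Q} → (∀ {i} → i ∈ₗ js → ⟪ α i , P ⟫ ≈ ⟪ α i , Q ⟫) → z P ≡ z Q
      z-cong {P} {Q} eq = []-⇔ (zeros? js P) (zeros? js Q)
        (λ all → All.tabulate λ i∈ → trans (sym (eq i∈)) (All.lookup all i∈))
        (λ all → All.tabulate λ i∈ → trans (eq i∈) (All.lookup all i∈))
      part-cong : ∀ x {P Q} → P ≋ Q → part x P ≡ part x Q
      part-cong x {P} {Q} P≋Q = cong₂ ℤ._*_ (z-cong λ {i} _ → ⟪⟫-cong (α i) P≋Q)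
        ([]-⇔ (⟪ α j , P ⟫ ≟ x) (⟪ α j , Q ⟫ ≟ x) (trans (sym (⟪⟫-cong (α j) P≋Q)))
          (trans (⟪⟫-cong (α j) P≋Q)))
      part-translate : ∀ x P → part x (P ⊹ map (x *_) w) ≡ [ zeros? (j ∷ js) P ]
      part-translate x P = ≡.trans (cong₂ ℤ._*_
        (z-cong {P ⊹ map (x *_) w} {P} λ {i} i∈ →
          trans (⟪⟫-⊹ (α i) P _)
            (trans (+-congˡ (trans (⟪⟫-* (α i) x w) (trans (*-congˡ (iw≈0 i∈)) (zeroʳ x))))
              (+-identityʳ _)))
        ([]-⇔ (⟪ α j , P ⊹ map (x *_) w ⟫ ≟ x) (zero? P j)
          (λ eq → +-identityˡ-unique _ x (trans (sym value) eq))
          (λ eq → trans value (trans (+-congʳ eq) (+-identityˡ x))))) both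
        where
        open import Algebra.Properties.Ring ring using (+-identityˡ-unique)
        value : ⟪ α j , P ⊹ map (x *_) w ⟫ ≈ ⟪ α j , P ⟫ + x
        value = trans (⟪⟫-⊹ (α j) P _)
          (+-congˡ (trans (⟪⟫-* (α j) x w) (trans (*-congˡ jw≈1) (*-identityʳ x))))
        both : z P ℤ.* [ zero? P j ] ≡ [ zeros? (j ∷ js) P ]
        both = []-* (zeros? js P) (zero? P j) (zeros? (j ∷ js) P)
          (λ all z → z ∷ all) All.tail All.head

    -- Removing a form from the list multiplies the number of zeros by `q`, the translations being
    -- along its own dual vector. Stating the result as a product avoids division.
    #zeros-* : ∀ js → Unique js → (w : Fin n → Vec Carrier l) →
               (∀ {j} → j ∈ₗ js → ⟪ α j , w j ⟫ ≈ 1#) →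
               (∀ {i j} → i ∈ₗ js → j ∈ₗ js → i ≢ j → ⟪ α i , w j ⟫ ≈ 0#) →
               + (q ℕ.^ length js) ℤ.* #zeros js ≡ + (q ℕ.^ l)
    #zeros-* []       _          w diag off = ≡.trans (ℤ.*-identityˡ _) (sum-points-1 l)
    #zeros-* (j ∷ js) (j∉ ∷ uniq) w diag off = ≡R.begin
      + (q ℕ.* q ℕ.^ length js) ℤ.* N          ≡R.≡⟨ cong (λ m → + m ℤ.* N) (ℕ.*-comm q _) ⟩
      + (q ℕ.^ length js ℕ.* q) ℤ.* N          ≡R.≡⟨ cong (ℤ._* N) (ℤ.pos-* (q ℕ.^ length js) q) ⟩
      + (q ℕ.^ length js) ℤ.* + q ℤ.* N        ≡R.≡⟨ ℤ.*-assoc (+ (q ℕ.^ length js)) (+ q) N ⟩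
      + (q ℕ.^ length js) ℤ.* (+ q ℤ.* N)
        ≡R.≡⟨ cong (+ (q ℕ.^ length js) ℤ.*_) (#zeros-∷ j js (w j) (diag (here ≡.refl))
                                                   (λ i∈ → off (there i∈) (here ≡.refl)
                                                     (λ { ≡.refl → All.lookup j∉ i∈ ≡.refl }))) ⟨
      + (q ℕ.^ length js) ℤ.* #zeros js
        ≡R.≡⟨ #zeros-* js uniq w (diag ∘ there) (λ i∈ j∈ → off (there i∈) (there j∈)) ⟩
      + (q ℕ.^ l)                              ≡R.∎
      where
      module ≡R = ≡.≡-Reasoning
      N = #zeros (j ∷ js)

deduplicate-id : ∀ {a r} {A : Set a} {R : Rel A r} (R? : Rel.Decidable R) →
  (∀ {x y} → R x y → x ≡ y) →
                 ∀ {xs} → Unique xs → deduplicate R? xs ≡ xs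
deduplicate-id R? R⇒≡ []                   = ≡.refl
deduplicate-id R? R⇒≡ (_∷_ {x} {xs} x∉ uniq) = cong (x ∷_)
  (≡.trans (cong (List.filter (¬? ∘ R? x)) (deduplicate-id R? R⇒≡ uniq))
    (List.filter-all (¬? ∘ R? x) (All.map (_∘ R⇒≡) x∉)))

-- The arrangement over the finite field

module Reduction {l n q c ℓ} (𝒜 : Arrangement l n) (𝔽 : FiniteField q c ℓ)
                 {p} (p-prime : Prime p) {k} (q≡p^k : q ≡ p ℕ.^ k) where
  open Arrangement 𝒜 using (α; isPrimitive)
  open FiniteField 𝔽 hiding (zero)
  open Over rawRing
  open RingSums commutativeRing
  open FiniteFields 𝔽
  open Characteristic p-prime {k} q≡p^k
  open Zeros α
  open Reduced 𝒜 𝔽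
  open import Relation.Binary.Reasoning.Setoid setoid

  reduce : (Fin l → ℤ) → Vec Carrier l
  reduce v = tabulate (fromℤ ∘ v)

  ⟪⟫-reduce : ∀ a v → ⟪ a , reduce v ⟫ ≈ fromℤ (pair a v)
  ⟪⟫-reduce a v = begin
    ⟪ a , reduce v ⟫                                                       ≈⟨ ⟪⟫-sum a (reduce v) ⟩
    sumOver (allFin l) (λ k → fromℤ (lookup a k) * lookup (reduce v) k)
      ≈⟨ sum-cong (allFin l) (λ k → trans
      (*-congˡ (reflexive (Vec.lookup∘tabulate (fromℤ ∘ v) k)))
        (sym (fromℤ-* (lookup a k) (v k)))) ⟩
    sumOver (allFin l) (λ k → fromℤ (lookup a k ℤ.* v k))
      ≈⟨ fromℤ-sum (allFin l) (λ k → lookup a k ℤ.* v k) ⟨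
    fromℤ (pair a v)                                                       ∎

  module Count {σ : TermOrdering l} (lucky : LuckyFor 𝒜 σ p) (B : Subset n) where
    open Frames 𝒜
    open Frame (frame B)
    open Duals α
    open Expansion α
    open Descent 𝒜 p-prime lucky (frame B)

    private
      C : ScaledDual J w
      C = proj₁ reducedDual
      open ScaledDual C
      m̄ = fromℤ (+ scale)

      m̄≉0 : ¬ m̄ ≈ 0#
      m̄≉0 m̄≈0 = proj₂ reducedDual (fromℤ≈0⇒∣ (+ scale) m̄≈0)

      m̄⁻¹ = proj₁ (inverse m̄ m̄≉0)

      -- Since `p` does not divide the scale, it can be inverted in the field, and the reduced
      -- vectors become dual to the forms in `J` without any scale.
      w̄ : Fin n → Vec Carrier l
      w̄ j = map (m̄⁻¹ *_) (reduce (vector j))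

      ⟪⟫-w̄ : ∀ a j → ⟪ a , w̄ j ⟫ ≈ m̄⁻¹ * fromℤ (pair a (vector j))
      ⟪⟫-w̄ a j = trans (⟪⟫-* a m̄⁻¹ (reduce (vector j))) (*-congˡ (⟪⟫-reduce a (vector j)))

    diagonal-w̄ : ∀ {j} → j ∈ₛ J → ⟪ α j , w̄ j ⟫ ≈ 1#
    diagonal-w̄ {j} j∈ = begin
      ⟪ α j , w̄ j ⟫                              ≈⟨ ⟪⟫-w̄ (α j) j ⟩
      m̄⁻¹ * fromℤ (pair (α j) (vector j))
        ≡⟨ cong (λ z → m̄⁻¹ * fromℤ z) (pair-diagonal C dual j∈) ⟩
      m̄⁻¹ * m̄                                    ≈⟨ *-comm m̄⁻¹ m̄ ⟩
      m̄ * m̄⁻¹                                    ≈⟨ proj₂ (inverse m̄ m̄≉0) ⟩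
      1#                                         ∎

    offDiagonal-w̄ : ∀ {i j} → i ∈ₛ J → j ∈ₛ J → i ≢ j → ⟪ α i , w̄ j ⟫ ≈ 0#
    offDiagonal-w̄ {i} {j} i∈ j∈ i≢j = begin
      ⟪ α i , w̄ j ⟫                              ≈⟨ ⟪⟫-w̄ (α i) j ⟩
      m̄⁻¹ * fromℤ (pair (α i) (vector j))
        ≡⟨ cong (λ z → m̄⁻¹ * fromℤ z) (pair-offDiagonal C dual i∈ j∈ i≢j) ⟩
      m̄⁻¹ * 0#                                   ≈⟨ zeroʳ m̄⁻¹ ⟩
      0#                                         ∎

    zeros-I⇒zeros-B : ∀ {P} → All (Zero P) (members α I) → All (Zero P) (members α B)
    zeros-I⇒zeros-B {P} zeros = All.tabulate λ {b} b∈ → integral m̄≉0 (begin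
      m̄ * ⟪ α b , P ⟫
        ≈⟨ *-congˡ (⟪⟫-sum (α b) P) ⟩
      m̄ * sumOver (allFin l) (λ k → fromℤ (lookup (α b) k) * lookup P k)
        ≈⟨ sum-*ˡ (allFin l) m̄ _ ⟨
      sumOver (allFin l) (λ k → m̄ * (fromℤ (lookup (α b) k) * lookup P k))
        ≈⟨ sum-cong (allFin l)
          (λ k → trans (sym (*-assoc _ _ _))
            (*-congʳ (trans (sym (fromℤ-* (+ scale) (lookup (α b) k)))
             (trans (reflexive (cong fromℤ
               (scaled-expand C {I} I⊆J (Dual-⊆ I⊆J dual) (α b) (spans (∈-members⁻ b∈)) k)))
               (fromℤ-sum (members α I) λ i → pair (α b) (vector i) ℤ.* lookup (α i) k))))) ⟩
      sumOver (allFin l) (λ k →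
        sumOver (members α I) (λ i → fromℤ (pair (α b) (vector i) ℤ.* lookup (α i) k)) * lookup P k)
        ≈⟨ sum-cong (allFin l) (λ k → sym (sum-*ʳ (members α I) (lookup P k) _)) ⟩
      sumOver (allFin l) (λ k → sumOver (members α I) λ i →
        fromℤ (pair (α b) (vector i) ℤ.* lookup (α i) k) * lookup P k)
        ≈⟨ sum-swap (allFin l) (members α I) _ ⟩
      sumOver (members α I)
        (λ i → sumOver (allFin l) λ k →
          fromℤ (pair (α b) (vector i) ℤ.* lookup (α i) k) * lookup P k)
        ≈⟨ sum-zero (members α I)
          (λ {i} i∈ → trans (sum-cong (allFin l) λ k →
            trans (*-congʳ (fromℤ-* (pair (α b) (vector i)) (lookup (α i) k))) (*-assoc _ _ _))
             (trans (sum-*ˡ (allFin l) (fromℤ (pair (α b) (vector i))) _)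
               (trans (*-congˡ (trans (sym (⟪⟫-sum (α i) P)) (All.lookup zeros i∈))) (zeroʳ _)))) ⟩
      0# ∎)

    q≢0 : ℕ.NonZero q
    q≢0 = subst ℕ.NonZero (≡.sym q≡p^k) (ℕ.m^n≢0 p k {{prime⇒nonZero p-prime}})

    #zeros-members : #zeros (members α B) ≡ + (q ℕ.^ (rk α ⊤ ∸ rk α B))
    #zeros-members = ℤ.*-cancelˡ-≡ (+ (q ℕ.^ r)) _ _ {{ℕ.m^n≢0 q r {{q≢0}}}} (≡R.begin
      + (q ℕ.^ r) ℤ.* #zeros (members α B)
        ≡R.≡⟨ cong (+ (q ℕ.^ r) ℤ.*_)
          (ℤΣ.sum-cong (points l) λ P → []-⇔ (zeros? (members α B) P) (zeros? (members α I) P)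
             (λ zeros → All.tabulate λ i∈ →
               All.lookup zeros (∈-members⁺ (I⊆B (∈-members⁻ i∈)))) zeros-I⇒zeros-B) ⟩
      + (q ℕ.^ r) ℤ.* #zeros (members α I)
        ≡R.≡⟨ cong (λ r → + (q ℕ.^ r) ℤ.* #zeros (members α I))
          (≡.trans (≡.sym ∣I∣≡rk) (≡.sym (length-members I))) ⟩
      + (q ℕ.^ length (members α I)) ℤ.* #zeros (members α I)
        ≡R.≡⟨ #zeros-* (members α I) (members-unique I) w̄
          (λ j∈ → diagonal-w̄ (I⊆J (∈-members⁻ j∈)))
             (λ i∈ j∈ → offDiagonal-w̄ (I⊆J (∈-members⁻ i∈)) (I⊆J (∈-members⁻ j∈))) ⟩
      + (q ℕ.^ l)
        -- `rk α B` is itself a truncated difference of `l` and a dimension, hence at most `l`, so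
        -- `l ∸ r` is a true difference.
        ≡R.≡⟨ cong (λ d → + (q ℕ.^ d)) (≡.sym (ℕ.m+[n∸m]≡n (ℕ.m∸n≤m l (proj₁ (dim⋂ α B))))) ⟩
      + (q ℕ.^ (r ℕ.+ (l ∸ r)))
        ≡R.≡⟨ cong +_ (ℕ.^-distribˡ-+-* q r (l ∸ r)) ⟩
      + (q ℕ.^ r ℕ.* q ℕ.^ (l ∸ r))
        ≡R.≡⟨ ℤ.pos-* (q ℕ.^ r) _ ⟩
      + (q ℕ.^ r) ℤ.* + (q ℕ.^ (l ∸ r))
        ≡R.≡⟨ cong (λ d → + (q ℕ.^ r) ℤ.* + (q ℕ.^ (d ∸ r))) (≡.sym rk-⊤) ⟩
      + (q ℕ.^ r) ℤ.* + (q ℕ.^ (rk α ⊤ ∸ r)) ≡R.∎)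
      where
      module ≡R = ≡.≡-Reasoning
      r = rk α B

  -- Good primes

  module Distinct (good : Good 𝒜 p) where

    -- The vector `α_j(k) e_k′ - α_j(k′) e_k`: it is a zero of `α j`, and `α i` takes on it the
    -- value of a 2 by 2 minor of the two forms.
    minor : Fin n → Fin l → Fin l → Fin l → ℤ
    minor j k k′ k″ =
      lookup (α j) k ℤ.* lookup (ℤΣ.basis k′) k″ ℤ.- lookup (α j) k′ ℤ.* lookup (ℤΣ.basis k) k″

    pair-minor : ∀ a j k k′ →
      pair a (minor j k k′) ≡ lookup (α j) k ℤ.* lookup a k′ ℤ.- lookup (α j) k′ ℤ.* lookup a k
    pair-minor a j k k′ = ≡R.begin
      pair a (minor j k k′)
        ≡R.≡⟨ ℤΣ.sum-cong (allFin l)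
          (λ k″ → expand (lookup a k″) (lookup (α j) k) (lookup (ℤΣ.basis k′) k″)
            (lookup (α j) k′) (lookup (ℤΣ.basis k) k″)) ⟩
      ℤᵒ.sumOver (allFin l) (λ k″ → x ℤ.* e k′ k″ ℤ.+ y ℤ.* e k k″)
        ≡R.≡⟨ ℤΣ.sum-+ (allFin l) (λ k″ → x ℤ.* e k′ k″) (λ k″ → y ℤ.* e k k″) ⟩
      ℤᵒ.sumOver (allFin l) (λ k″ → x ℤ.* e k′ k″) ℤ.+ ℤᵒ.sumOver (allFin l) (λ k″ → y ℤ.* e k k″)
        ≡R.≡⟨ cong₂ ℤ._+_ (part x k′) (part y k) ⟩
      x ℤ.* lookup a k′ ℤ.+ y ℤ.* lookup a k
        ≡R.≡⟨ cong (λ z → x ℤ.* lookup a k′ ℤ.+ z)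
          (≡.sym (ℤ.neg-distribˡ-* (lookup (α j) k′) (lookup a k))) ⟩
      x ℤ.* lookup a k′ ℤ.- lookup (α j) k′ ℤ.* lookup a k ≡R.∎
      where
      module ≡R = ≡.≡-Reasoning
      x = lookup (α j) k
      y = ℤ.- lookup (α j) k′
      e : Fin l → Fin l → ℤ
      e k k″ = lookup (ℤΣ.basis k) k″ ℤ.* lookup a k″
      part : ∀ x k → ℤᵒ.sumOver (allFin l) (λ k″ → x ℤ.* e k k″) ≡ x ℤ.* lookup a k
      part x k = ≡.trans (ℤΣ.sum-*ˡ (allFin l) x (e k)) (cong (x ℤ.*_) (ℤΣ.sum-basis k (lookup a)))
      expand : ∀ a x e y f → a ℤ.* (x ℤ.* e ℤ.- y ℤ.* f) ≡ x ℤ.* (e ℤ.* a) ℤ.+ (ℤ.- y) ℤ.* (f ℤ.* a)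
      expand = ℤ.solve-∀

    -- The points minor j k k′ span the hyperplane of α j, so the 2 × 2 minors
    -- of α i and α j vanish modulo p.
    proportional : ∀ i j → (∀ P → H̄ j P → H̄ i P) →
                   ∃[ s ] ∀ k → + p ∣ℤ (lookup (α i) k ℤ.- s ℤ.* lookup (α j) k)
    proportional i j Hj⊆Hi with Fin.¬∀⟶∃¬ l (λ k → + p ∣ℤ lookup (α j) k)
      (λ k → p ℕ∣.∣? ℤ.∣ lookup (α j) k ∣) (isPrimitive j p p-prime)
    ... | k , p∤ with inverse-mod p-prime (lookup (α j) k) p∤
    -- The scalar is the ratio of the two coefficients at `k` modulo `p`; primitivity of `α j`
    -- provides a `k` where the denominator is invertible.
    ...   | u , d , ux≡1+dp = u ℤ.* lookup (α i) k , λ k′ → divisible k′ (∣ᵤ⇒∣ (minor∣ k′))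
      where
      minor∣ : ∀ k′ → + p ∣ℤ
        (lookup (α j) k ℤ.* lookup (α i) k′ ℤ.- lookup (α j) k′ ℤ.* lookup (α i) k)
      minor∣ k′ = fromℤ≈0⇒∣
        (lookup (α j) k ℤ.* lookup (α i) k′ ℤ.- lookup (α j) k′ ℤ.* lookup (α i) k)
          (trans (reflexive (cong fromℤ (≡.sym (pair-minor (α i) j k k′))))
        (trans (sym (⟪⟫-reduce (α i) (minor j k k′))) (Hj⊆Hi (reduce (minor j k k′)) on-Hj)))
        where
        on-Hj : H̄ j (reduce (minor j k k′))
        on-Hj = trans (⟪⟫-reduce (α j) (minor j k k′))
          (reflexive (cong fromℤ (≡.trans (pair-minor (α j) j k k′)
          (≡.trans (cong (λ z → z ℤ.- lookup (α j) k′ ℤ.* lookup (α j) k)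
            (ℤ.*-comm (lookup (α j) k) (lookup (α j) k′)))
              (ℤ.+-inverseʳ (lookup (α j) k′ ℤ.* lookup (α j) k))))))
      divisible : ∀ k′ → ℤ∣._∣_ (+ p)
        (lookup (α j) k ℤ.* lookup (α i) k′ ℤ.- lookup (α j) k′ ℤ.* lookup (α i) k) →
                  + p ∣ℤ (lookup (α i) k′ ℤ.- u ℤ.* lookup (α i) k ℤ.* lookup (α j) k′)
      divisible k′ (divides e eq) = ∣⇒∣ᵤ (divides (u ℤ.* e ℤ.- d ℤ.* b′) (≡R.begin
        -- Both parts of the rearranged expression are divisible by `p`: one is a multiple of the
        -- minor, the other of `u * a - 1`.
        b′ ℤ.- u ℤ.* b ℤ.* a′                                  ≡R.≡⟨ rearrange a b a′ b′ u ⟩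
        u ℤ.* (a ℤ.* b′ ℤ.- a′ ℤ.* b) ℤ.- (u ℤ.* a ℤ.- 1ℤ) ℤ.* b′
          ≡R.≡⟨ cong₂ (λ x y → u ℤ.* x ℤ.- (y ℤ.- 1ℤ) ℤ.* b′) eq ux≡1+dp ⟩
        u ℤ.* (e ℤ.* + p) ℤ.- (1ℤ ℤ.+ d ℤ.* + p ℤ.- 1ℤ) ℤ.* b′      ≡R.≡⟨ factor u e (+ p) d b′ ⟩
        (u ℤ.* e ℤ.- d ℤ.* b′) ℤ.* + p                         ≡R.∎))
        where
        module ≡R = ≡.≡-Reasoning
        a = lookup (α j) k
        b = lookup (α i) k
        a′ = lookup (α j) k′
        b′ = lookup (α i) k′
        rearrange : ∀ a b a′ b′ u →
          b′ ℤ.- u ℤ.* b ℤ.* a′ ≡ u ℤ.* (a ℤ.* b′ ℤ.- a′ ℤ.* b) ℤ.- (u ℤ.* a ℤ.- 1ℤ) ℤ.* b′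
        rearrange = ℤ.solve-∀
        factor : ∀ u e p d b′ →
          u ℤ.* (e ℤ.* p) ℤ.- (1ℤ ℤ.+ d ℤ.* p ℤ.- 1ℤ) ℤ.* b′ ≡ (u ℤ.* e ℤ.- d ℤ.* b′) ℤ.* p
        factor = ℤ.solve-∀

    -- `SameHyperplane` tests only the enumerated points, but every vector agrees with one of these
    -- up to `≋`, and zeros are stable under `≋`.
    SameHyperplane⇒⊆ : ∀ {i j} → SameHyperplane i j →
      (∀ P → H̄ i P → H̄ j P) × (∀ P → H̄ j P → H̄ i P)
    SameHyperplane⇒⊆ {i} {j} same = (λ P → transfer P proj₁) , (λ P → transfer P proj₂)
      where
      transfer : ∀ P {i′ j′} →
        (∀ {P} → (H̄ i P → H̄ j P) × (H̄ j P → H̄ i P) → H̄ i′ P → H̄ j′ P) → H̄ i′ P → H̄ j′ P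
      transfer P {i′} {j′} side HiP with points-complete P
      ... | P′ , P′∈ , P′≋P =
        trans (sym (⟪⟫-cong (α j′) P′≋P))
          (side (All.lookup same P′∈) (trans (⟪⟫-cong (α i′) P′≋P) HiP))

    -- `Good` is stated for `i < j`, with `α i` as the multiple, so the order of the two indices
    -- selects the inclusion to which `proportional` is applied.
    SameHyperplane⇒≡ : ∀ {i j} → SameHyperplane i j → i ≡ j
    SameHyperplane⇒≡ {i} {j} same with Fin.<-cmp i j
    ... | Rel.tri≈ _ i≡j _ = i≡j
    ... | Rel.tri< i<j _ _ = ⊥-elim (good i<j (proportional i j (proj₂ (SameHyperplane⇒⊆ same))))
    ... | Rel.tri> _ _ j<i = ⊥-elim (good j<i (proportional j i (proj₁ (SameHyperplane⇒⊆ same))))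

    hyperplanes≡allFin : hyperplanes ≡ allFin n
    hyperplanes≡allFin = deduplicate-id sameHyperplane? SameHyperplane⇒≡ (Unique.allFin⁺ n)

-- Evaluation of polynomials and the binomial theorem over subsets

module Evaluation {c ℓ} (R : CommutativeRing c ℓ) where
  open CommutativeRing R hiding (zero)
  open Over rawRing
  open RingSums R
  open import Algebra.Properties.Semiring.Exp semiring using (^-homo-*; ^-congˡ) renaming (_^_ to _^ᴿ_)
  open import Algebra.Properties.CommutativeSemigroup *-commutativeSemigroup using (interchange; x∙yz≈y∙xz)
  open import Relation.Binary.Reasoning.Setoid setoid

  power-∙ : ∀ {n} (v : Vec Carrier n) m m′ → power v (m ∙ m′) ≈ power v m * power v m′
  power-∙ []      []      []        = sym (*-identityˡ 1#)
  power-∙ (x ∷ v) (e ∷ m) (e′ ∷ m′) =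
    trans (*-cong (^-homo-* x e e′) (power-∙ v m m′)) (interchange _ _ _ _)

  power-0 : ∀ {n} (v : Vec Carrier n) → power v 0ₘ ≈ 1#
  power-0 []      = refl
  power-0 (x ∷ v) = trans (*-identityˡ _) (power-0 v)

  power-unit : ∀ {n} (v : Vec Carrier n) i → power v (unit i) ≈ lookup v i
  power-unit (x ∷ v) zero    = trans (*-cong (*-identityʳ x) (power-0 v)) (*-identityʳ x)
  power-unit (x ∷ v) (suc i) = trans (*-identityˡ _) (power-unit v i)

  module _ {n} (v : Vec Carrier n) where
    open RawRing (polyRing n) using ()
      renaming (_*_ to _*ₚ_; -_ to -ₚ_; 1# to 1ₚ; rawSemiring to rawSemiringₚ)
    open import Algebra.Definitions.RawSemiring rawSemiringₚ using () renaming (_^_ to _^′_)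

    eval-++ : ∀ f g → eval (f ++ g) v ≈ eval f v + eval g v
    eval-++ f g = sum-++ f g _

    eval-term : ∀ a m → eval (term a m) v ≈ fromℤ a * power v m
    eval-term a m = +-identityʳ _

    eval-1 : eval 1ₚ v ≈ 1#
    eval-1 = trans (eval-term 1ℤ 0ₘ) (trans (*-cong fromℤ-1 (power-0 v)) (*-identityˡ 1#))

    eval-var : ∀ i → eval (var i) v ≈ lookup v i
    eval-var i = trans (eval-term 1ℤ (unit i))
      (trans (*-cong fromℤ-1 (power-unit v i)) (*-identityˡ _))

    eval-neg : ∀ f → eval (-ₚ f) v ≈ - eval f v
    eval-neg []            = sym -0#≈0#
    eval-neg ((a , m) ∷ f) =
      trans (+-cong (trans (*-congʳ (fromℤ-neg a)) (sym (-‿distribˡ-* _ _))) (eval-neg f))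
        (-‿+-comm _ _)

    eval-* : ∀ f g → eval (f *ₚ g) v ≈ eval f v * eval g v
    eval-* f g = begin
      eval (f *ₚ g) v
        ≈⟨ sum-cartesianProductWith _ f g _ ⟩
      sumOver f (λ (a , m) → sumOver g λ (b , m′) → fromℤ (a ℤ.* b) * power v (m ∙ m′))
        ≈⟨ sum-cong f (λ (a , m) →
          trans (sum-cong g λ (b , m′) →
            trans (*-cong (fromℤ-* a b) (power-∙ v m m′)) (interchange _ _ _ _)) (sum-*ˡ g _ _)) ⟩
      sumOver f (λ (a , m) → fromℤ a * power v m * eval g v)
        ≈⟨ sum-*ʳ f _ _ ⟩
      eval f v * eval g v ∎

    eval-^ : ∀ f k → eval (f ^′ k) v ≈ eval f v ^ᴿ k
    eval-^ f zero    = eval-1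
    eval-^ f (suc k) = trans (eval-* f (f ^′ k)) (*-congˡ (eval-^ f k))

    eval-sum : ∀ {a} {A : Set a} (xs : List A) (F : A → Poly n) →
               eval (Over.sumOver (polyRing n) xs F) v ≈ sumOver xs λ x → eval (F x) v
    eval-sum []       F = refl
    eval-sum (x ∷ xs) F = trans (eval-++ (F x) _) (+-congˡ (eval-sum xs F))

  fromℤ-^ : ∀ m k → fromℤ (+ m) ^ᴿ k ≈ fromℤ (+ (m ℕ.^ k))
  fromℤ-^ m zero    = sym fromℤ-1
  fromℤ-^ m (suc k) = trans (*-congˡ (fromℤ-^ m k)) (trans (sym (fromℤ-* (+ m) (+ (m ℕ.^ k))))
    (reflexive (cong fromℤ (≡.sym (ℤ.pos-* m (m ℕ.^ k))))))

  sum-subsets : ∀ n (f : Subset (suc n) → Carrier) → sumOver (subsets (suc n)) f ≈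
                sumOver (subsets n) (f ∘ (inside ∷_)) + sumOver (subsets n) (f ∘ (outside ∷_))
  sum-subsets n f =
    trans (sum-cartesianProductWith _∷_ (inside ∷ outside ∷ []) (subsets n) f)
      (+-congˡ (+-identityʳ _))

  -- Expansion of a product with one factor `1 + s` for each element of `T`. An element outside `T`
  -- offers no choice, since the sets containing it have indicator zero.
  binomial : ∀ s {n} (T : Subset n) →
             sumOver (subsets n) (λ B → fromℤ [ B ⊆? T ] * s ^ᴿ ∣ B ∣) ≈ (1# + s) ^ᴿ ∣ T ∣
  binomial s []      = trans (+-identityʳ _) (trans (*-identityʳ _) fromℤ-1)
  binomial s {suc n} (outside ∷ T) = trans (sum-subsets n _)
    (trans (+-cong (sum-zero (subsets n) λ _ → zeroˡ _) (binomial s T)) (+-identityˡ _))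
  binomial s {suc n} (inside ∷ T) = begin
    sumOver (subsets (suc n)) (λ B → fromℤ [ B ⊆? inside ∷ T ] * s ^ᴿ ∣ B ∣)   ≈⟨ sum-subsets n _ ⟩
    sumOver (subsets n) (λ B → fromℤ [ B ⊆? T ] * (s * s ^ᴿ ∣ B ∣)) + Σ′
      ≈⟨ +-congʳ (sum-cong (subsets n) λ B → x∙yz≈y∙xz _ s _) ⟩
    sumOver (subsets n) (λ B → s * (fromℤ [ B ⊆? T ] * s ^ᴿ ∣ B ∣)) + Σ′
      ≈⟨ +-congʳ (sum-*ˡ (subsets n) s _) ⟩
    s * Σ′ + Σ′                     ≈⟨ +-comm _ _ ⟩
    Σ′ + s * Σ′                     ≈⟨ +-congʳ (*-identityˡ Σ′) ⟨
    1# * Σ′ + s * Σ′                ≈⟨ distribʳ Σ′ 1# s ⟨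
    (1# + s) * Σ′                   ≈⟨ *-congˡ (binomial s T) ⟩
    (1# + s) * (1# + s) ^ᴿ ∣ T ∣    ∎
    where Σ′ = sumOver (subsets n) λ B → fromℤ [ B ⊆? T ] * s ^ᴿ ∣ B ∣

-- The theorem substitutes a constant polynomial for `x`, while counts enter through `fromℤ`, that
-- is, as iterated sums of 1. Already at zero the two differ as lists, one term with coefficient
-- zero against none, so they are compared by coefficients.
const-fromℕ : ∀ {n} m → const {n} (+ m) ≈ₚ Over.fromℤ (polyRing n) (+ m)
const-fromℕ zero e with does (0ₘ ≟ₘ e)
... | true  = ≡.refl
... | false = ≡.refl
const-fromℕ (suc m) e = ≡.trans (split (does (0ₘ ≟ₘ e)))
  (cong (λ z → (if does (0ₘ ≟ₘ e) then 1ℤ else 0ℤ) ℤ.+ z) (const-fromℕ m e))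
  where
  split : ∀ b → (if b then + suc m else 0ℤ) ℤ.+ 0ℤ ≡ (if b then 1ℤ else 0ℤ) ℤ.+
    ((if b then + m else 0ℤ) ℤ.+ 0ℤ)
  split true  = ≡.trans (ℤ.+-identityʳ _) (cong (λ z → 1ℤ ℤ.+ z) (≡.sym (ℤ.+-identityʳ (+ m))))
  split false = ≡.refl

-- The coboundary polynomial as a sum over points

open import Data.Nat.Base using (_^_; _≤_)

theorem4p17 : ∀ {l n} (𝒜 : Arrangement l n) (σ : TermOrdering l) (p : ℕ) → Prime p →
    Good 𝒜 p → LuckyFor 𝒜 σ p →
    ∀ (q k : ℕ) → 1 ≤ k → q ≡ p ^ k →
    ∀ {c ℓ} (𝔽 : FiniteField q c ℓ) →
    Over.eval (polyRing 1) (coboundary 𝒜) (const (+ q) ∷ var zero ∷ []) ≈ₚ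
    Over.sumOver (polyRing 1) (FiniteField.points 𝔽 l) (λ P → var zero ^ₚ Reduced.h 𝒜 𝔽 P)
theorem4p17 {l} {n} 𝒜 σ p p-prime good lucky q k _ q≡p^k 𝔽 = begin
  eval (coboundary 𝒜) v
    ≈⟨ eval-sum v (subsets n) (λ B → X B *₂ Y B) ⟩
  sumOver (subsets n) (λ B → eval (X B *₂ Y B) v)
    ≈⟨ sum-cong (subsets n) {λ B → eval (X B *₂ Y B) v} {λ B →
      fromℤ (#zeros (members α B)) * s ^ₚ ∣ B ∣} summand ⟩
  sumOver (subsets n) (λ B → fromℤ (#zeros (members α B)) * s ^ₚ ∣ B ∣)
    ≈⟨ sum-cong (subsets n) {_} {λ B → sumOver (points l) λ P →
      fromℤ [ B ⊆? zeroSet P ] * s ^ₚ ∣ B ∣} expand ⟩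
  sumOver (subsets n) (λ B → sumOver (points l) λ P → fromℤ [ B ⊆? zeroSet P ] * s ^ₚ ∣ B ∣)
    -- After the exchange the inner sum, for a fixed point, runs over the subsets of its zero set,
    -- which is the situation of `binomial`.
    ≈⟨ sum-swap (subsets n) (points l) (λ B P → fromℤ [ B ⊆? zeroSet P ] * s ^ₚ ∣ B ∣) ⟩
  sumOver (points l) (λ P → sumOver (subsets n) λ B → fromℤ [ B ⊆? zeroSet P ] * s ^ₚ ∣ B ∣)
    ≈⟨ sum-cong (points l) {_} {λ P → var zero ^ₚ Reduced.h 𝒜 𝔽 P} collect ⟩
  sumOver (points l) (λ P → var zero ^ₚ Reduced.h 𝒜 𝔽 P) ∎
  where
  open CommutativeRing (polyCommutativeRing 1)
    using (_≈_; _*_; _+_; -_; 1#; trans; +-congˡ; +-cong; *-congʳ; *-cong; -‿cong;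
           +-identityʳ; +-comm; +-assoc; -‿inverseˡ; setoid; semiring)
  open RingSums (polyCommutativeRing 1)
  open Evaluation (polyCommutativeRing 1)
  open Over (polyRing 1)
  open import Algebra.Properties.Semiring.Exp semiring using (^-congˡ)
  open import Relation.Binary.Reasoning.Setoid setoid
  open FiniteField 𝔽 using (points)
  open Arrangement 𝒜 using (α)
  open Duals α
  open Reduced 𝒜 𝔽 using (H̄?; h)
  open FiniteFields 𝔽 using (module Zeros)
  open Zeros α
  open Reduction 𝒜 𝔽 p-prime {k} q≡p^k
  open Distinct good using (hyperplanes≡allFin)
  open RawRing (polyRing 2) using ()
    renaming (_*_ to _*₂_; _+_ to _+₂_; -_ to -₂_; 1# to 1₂; rawSemiring to rawSemiring₂)
  open import Algebra.Definitions.RawSemiring rawSemiring₂ using () renaming (_^_ to _^₂_)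

  v : Vec (Poly 1) 2
  v = const (+ q) ∷ var zero ∷ []

  X Y : Subset n → Poly 2
  X B = var zero ^₂ (rk α ⊤ ∸ rk α B)
  Y B = (var (suc zero) +₂ (-₂ 1₂)) ^₂ ∣ B ∣

  s : Poly 1
  s = var zero + - 1#

  1+s≈t : 1# + s ≈ var zero
  1+s≈t = begin
    1# + (var zero + - 1#)    ≈⟨ +-comm 1# s ⟩
    var zero + - 1# + 1#      ≈⟨ +-assoc (var zero) (- 1#) 1# ⟩
    var zero + (- 1# + 1#)    ≈⟨ +-congˡ {var zero} { - 1# + 1#} {[]} (-‿inverseˡ 1#) ⟩
    var zero + []             ≈⟨ +-identityʳ (var zero) ⟩
    var zero                  ∎

  eval-X : ∀ B → eval (X B) v ≈ fromℤ (#zeros (members α B))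
  eval-X B = begin
    eval (X B) v                           ≈⟨ eval-^ v (var zero) r ⟩
    eval (var zero) v ^ₚ r
      ≈⟨ ^-congˡ r {eval (var zero) v} {const (+ q)} (eval-var v zero) ⟩
    const (+ q) ^ₚ r
      ≈⟨ ^-congˡ r {const (+ q)} {fromℤ (+ q)} (const-fromℕ q) ⟩
    fromℤ (+ q) ^ₚ r                       ≈⟨ fromℤ-^ q r ⟩
    -- Luckiness enters here: the power of `q` is the number of common zeros over the field.
    fromℤ (+ (q ^ r))                      ≡⟨ cong fromℤ (Count.#zeros-members {σ = σ} lucky B) ⟨
    fromℤ (#zeros (members α B))           ∎
    where r = rk α ⊤ ∸ rk α B

  eval-Y : ∀ B → eval (Y B) v ≈ s ^ₚ ∣ B ∣
  eval-Y B = begin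
    eval (Y B) v
      ≈⟨ eval-^ v (var (suc zero) +₂ (-₂ 1₂)) ∣ B ∣ ⟩
    eval (var (suc zero) +₂ (-₂ 1₂)) v ^ₚ ∣ B ∣
      ≈⟨ ^-congˡ ∣ B ∣ {eval (var (suc zero) +₂ (-₂ 1₂)) v} {s} base ⟩
    s ^ₚ ∣ B ∣                                                ∎
    where
    base : eval (var (suc zero) +₂ (-₂ 1₂)) v ≈ s
    base = begin
      eval (var (suc zero) +₂ (-₂ 1₂)) v          ≈⟨ eval-++ v (var (suc zero)) (-₂ 1₂) ⟩
      eval (var (suc zero)) v + eval (-₂ 1₂) v
        ≈⟨ +-cong {eval (var (suc zero)) v} {var zero} {eval (-₂ 1₂) v} { - 1#}
          (eval-var v (suc zero))
        (trans {eval (-₂ 1₂) v} { - eval 1₂ v} { - 1#} (eval-neg v 1₂)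
          (-‿cong {eval 1₂ v} {1#} (eval-1 v))) ⟩
      s                                           ∎

  summand : ∀ B → eval (X B *₂ Y B) v ≈ fromℤ (#zeros (members α B)) * s ^ₚ ∣ B ∣
  summand B = begin
    eval (X B *₂ Y B) v                                ≈⟨ eval-* v (X B) (Y B) ⟩
    eval (X B) v * eval (Y B) v
      ≈⟨ *-cong {eval (X B) v} {fromℤ (#zeros (members α B))} {eval (Y B) v} {s ^ₚ ∣ B ∣}
        (eval-X B) (eval-Y B) ⟩
    fromℤ (#zeros (members α B)) * s ^ₚ ∣ B ∣          ∎

  zeroSet : Vec (FiniteField.Carrier 𝔽) l → Subset n
  zeroSet P = tabulate (does ∘ H̄? P)

  ∈-zeroSet⁺ : ∀ P {i} → Reduced.H̄ 𝒜 𝔽 i P → i ∈ₛ zeroSet P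
  ∈-zeroSet⁺ P {i} z =
    Vec.lookup⇒[]= i _ (≡.trans (Vec.lookup∘tabulate (does ∘ H̄? P) i) (dec-true (H̄? P i) z))

  ∈-zeroSet⁻ : ∀ P {i} → i ∈ₛ zeroSet P → Reduced.H̄ 𝒜 𝔽 i P
  ∈-zeroSet⁻ P {i} i∈ =
    does⇒ (H̄? P i) (≡.trans (≡.sym (Vec.lookup∘tabulate (does ∘ H̄? P) i)) (Vec.[]=⇒lookup i∈))
    where
    does⇒ : ∀ {a} {A : Set a} (d : Dec A) → does d ≡ true → A
    does⇒ (yes a) _ = a

  expand : ∀ B → fromℤ (#zeros (members α B)) * s ^ₚ ∣ B ∣ ≈
           sumOver (points l) λ P → fromℤ [ B ⊆? zeroSet P ] * s ^ₚ ∣ B ∣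
  expand B = begin
    fromℤ (#zeros (members α B)) * s ^ₚ ∣ B ∣
      ≡⟨ cong (λ z → fromℤ z * s ^ₚ ∣ B ∣)
        -- A point is a common zero of the forms in `B` exactly when `B` is contained in its zero
        -- set.
        (ℤΣ.sum-cong (points l) λ P → []-⇔ (zeros? (members α B) P) (B ⊆? zeroSet P)
           (λ zeros {i} i∈ → ∈-zeroSet⁺ P (All.lookup zeros (∈-members⁺ i∈)))
           (λ B⊆ → All.tabulate λ i∈ → ∈-zeroSet⁻ P (B⊆ (∈-members⁻ i∈)))) ⟩
    fromℤ (ℤᵒ.sumOver (points l) λ P → [ B ⊆? zeroSet P ]) * s ^ₚ ∣ B ∣
      ≈⟨ *-congʳ {s ^ₚ ∣ B ∣} {fromℤ (ℤᵒ.sumOver (points l) λ P → [ B ⊆? zeroSet P ])} {sumOver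
        (points l) (λ P → fromℤ [ B ⊆? zeroSet P ])}
           (fromℤ-sum (points l) (λ P → [ B ⊆? zeroSet P ])) ⟩
    sumOver (points l) (λ P → fromℤ [ B ⊆? zeroSet P ]) * s ^ₚ ∣ B ∣
      ≈⟨ sum-*ʳ (points l) (s ^ₚ ∣ B ∣) (λ P → fromℤ [ B ⊆? zeroSet P ]) ⟨
    sumOver (points l) (λ P → fromℤ [ B ⊆? zeroSet P ] * s ^ₚ ∣ B ∣) ∎

  collect : ∀ P → sumOver (subsets n)
    (λ B → fromℤ [ B ⊆? zeroSet P ] * s ^ₚ ∣ B ∣) ≈ var zero ^ₚ h P
  collect P = begin
    sumOver (subsets n) (λ B → fromℤ [ B ⊆? zeroSet P ] * s ^ₚ ∣ B ∣)   ≈⟨ binomial s (zeroSet P) ⟩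
    (1# + s) ^ₚ ∣ zeroSet P ∣
      ≈⟨ ^-congˡ ∣ zeroSet P ∣ {1# + s} {var zero} 1+s≈t ⟩
    var zero ^ₚ ∣ zeroSet P ∣
      ≡⟨ cong (var zero ^ₚ_) (≡.sym (length-filter-tabulate (H̄? P) id)) ⟩
    var zero ^ₚ length (List.filter (H̄? P) (allFin n))
      -- Goodness enters here: the zero set counts indices, `h` counts distinct hyperplanes.
      ≡⟨ cong (λ js → var zero ^ₚ length (List.filter (H̄? P) js)) (≡.sym hyperplanes≡allFin) ⟩
    var zero ^ₚ h P                                                     ∎
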